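{- Let $q$ be a positive real algebraic number. The weight $w_q$ is unique in each of the following two cases: (i) for some $\sigma\in\mathrm{Gal}(\overline{\mathbb Q}/\mathbb Q)$ the conjugate $q^\sigma$ is real and satisfies $q^\sigma\ge4$; (ii) $q$ is a totally positive algebraic integer.
   Context: Let $q>0$. For an integer $k\ge0$ and $\mathbf m=(m_0,\dots,m_k)\in\mathbb Z^{k+1}$ put $\mathbf m_j=(m_0,\dots,m_j)$. Define $c(q,\mathbf m_0)=m_0$ and recursively $c(q,\mathbf m_j)=m_j+\frac{1}{q\,c(q,\mathbf m_{j-1})}$ for $1\le j\le k$. The vector $\mathbf m$ is a path for $q$ (of length $k$) if $c(q,\mathbf m_j)\ne0$ for $0\le j\le k-1$. The weight of a path is $w_q(\mathbf m)=q^{k/2}\prod_{j=0}^{k-1}|c(q,\mathbf m_j)|$ (and $w_q(\mathbf m)=1$ if $k=0$). The weight $w_q$ is called unique if $w_q(\mathbf m)=w_q(\mathbf n)$ for all paths $\mathbf m,\mathbf n$ for $q$ with $c(q,\mathbf m)=c(q,\mathbf n)$. -}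

module Defs where

open import Algebra.Bundles using (CommutativeRing; RawRing; Ring; Semiring)
import Algebra.Definitions.RawSemiring as RawSemiringDefinitions
open import Algebra.Morphism.Structures using (IsRingHomomorphism; IsRingIsomorphism)
open import Data.Fin.Base using (Fin; toℕ; inject₁; inject≤)
open import Data.Fin.Properties using (toℕ<n)
open import Data.Integer.Base using (ℤ; +_; -[1+_])
open import Data.Nat.Base using (ℕ; zero; suc)
import Data.Nat.Base as ℕ
open import Data.Product.Base using (_×_; _,_; ∃-syntax)
open import Data.Product.Relation.Binary.Pointwise.NonDependent using (Pointwise)
open import Data.Rational.Base using (ℚ; ↥_; ↧ₙ_)
open import Data.Vec.Base using (Vec; []; _∷_; map)
open import Data.Vec.Functional using (Vector; init; last)
open import Level using (Level; _⊔_) renaming (suc to lsuc)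
open import Relation.Binary.Core using (Rel)
import Relation.Binary.Construct.StrictToNonStrict as StrictToNonStrict
open import Relation.Binary.Definitions using (Decidable; tri<; tri≈; tri>)
open import Relation.Binary.Structures using (IsStrictTotalOrder)

private
  variable
    c ℓ₁ ℓ₂ c′ ℓ′ : Level

-- Fields in the classical sense: equality is decidable and every nonzero
-- element is invertible.  The value of 0# ⁻¹ is left unspecified.
record Field c ℓ : Set (lsuc (c ⊔ ℓ)) where
  infix 8 _⁻¹
  field
    commutativeRing : CommutativeRing c ℓ
  open CommutativeRing commutativeRing public
  field
    _≟_       : Decidable _≈_
    1≉0       : 1# ≉ 0#
    _⁻¹       : Carrier → Carrier
    ⁻¹-inverse : ∀ {x} → x ≉ 0# → x * x ⁻¹ ≈ 1#

  open RawSemiringDefinitions (Semiring.rawSemiring semiring) public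
    using (_^_; product)
    renaming (_×_ to infixr 8 _·_)

  fromℕ : ℕ → Carrier
  fromℕ n = n · 1#

  fromℤ : ℤ → Carrier
  fromℤ (+ n)    = fromℕ n
  fromℤ -[1+ n ] = - fromℕ (suc n)

  fromℚ : ℚ → Carrier
  fromℚ r = fromℤ (↥ r) * fromℕ (↧ₙ r) ⁻¹

  -- The vector a₀ ∷ … ∷ aₙ₋₁ ∷ [] stands for the monic polynomial
  -- a₀ + a₁X + ⋯ + aₙ₋₁Xⁿ⁻¹ + Xⁿ of degree n.
  evalMonic : ∀ {n} → Vec Carrier n → Carrier → Carrier
  evalMonic []       x = 1#
  evalMonic (a ∷ as) x = a + x * evalMonic as x

  IsRoot : ∀ {n} → Vec Carrier n → Carrier → Set ℓ
  IsRoot p x = evalMonic p x ≈ 0#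

  IsAlgebraicallyClosed : Set (c ⊔ ℓ)
  IsAlgebraicallyClosed = ∀ {n} (p : Vec Carrier (suc n)) → ∃[ x ] IsRoot p x

  IsAlgebraic : Carrier → Set ℓ
  IsAlgebraic x = ∃[ n ] ∃[ p ] IsRoot (map {n = n} fromℚ p) x

  IsAlgebraicInteger : Carrier → Set ℓ
  IsAlgebraicInteger x = ∃[ n ] ∃[ p ] IsRoot (map {n = n} fromℤ p) x

  IsMinimalPolynomial : ∀ {n} → Vec ℚ n → Carrier → Set ℓ
  IsMinimalPolynomial {n} p x =
    IsRoot (map fromℚ p) x ×
    (∀ {m} (r : Vec ℚ m) → IsRoot (map fromℚ r) x → n ℕ.≤ m)

  -- The conjugates of x are the roots of its minimal polynomial over ℚ.
  IsConjugate : Carrier → Carrier → Set ℓ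
  IsConjugate x y =
    ∃[ n ] ∃[ p ] IsMinimalPolynomial {n} p x × IsRoot (map fromℚ p) y

-- Archimedean ordered fields with square roots of positive elements.  The field
-- of real numbers is one, and classically every one is isomorphic to a subfield
-- of the real numbers.
record RealField c ℓ₁ ℓ₂ : Set (lsuc (c ⊔ ℓ₁ ⊔ ℓ₂)) where
  infix 4 _<_
  field
    underlyingField : Field c ℓ₁
  open Field underlyingField public
  field
    _<_                : Rel Carrier ℓ₂
    isStrictTotalOrder : IsStrictTotalOrder _≈_ _<_
    +-monoˡ-<          : ∀ {x y} z → x < y → x + z < y + z
    *-pos              : ∀ {x y} → 0# < x → 0# < y → 0# < x * y
    archimedean        : ∀ x → ∃[ n ] x < fromℕ n
    √                  : Carrier → Carrier
    √-pos              : ∀ {x} → 0# < x → 0# < √ x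
    √-square           : ∀ {x} → 0# < x → √ x * √ x ≈ x

  open IsStrictTotalOrder isStrictTotalOrder public using (compare)
  open StrictToNonStrict _≈_ _<_ public using (_≤_)

  ∣_∣ : Carrier → Carrier
  ∣ x ∣ with compare x 0#
  ... | tri< _ _ _ = - x
  ... | tri≈ _ _ _ = x
  ... | tri> _ _ _ = x

  -- The complex numbers x + iy, as pairs (x , y).
  complexRawRing : RawRing c ℓ₁
  complexRawRing = record
    { Carrier = Carrier × Carrier
    ; _≈_     = Pointwise _≈_ _≈_
    ; _+_     = λ { (x , y) (u , v) → x + u , y + v }
    ; _*_     = λ { (x , y) (u , v) → x * u - y * v , x * v + y * u }
    ; -_      = λ { (x , y) → - x , - y }
    ; 0#      = 0# , 0#
    ; 1#      = 1# , 0#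
    }

-- The algebraic closure of ℚ inside the complex numbers.  The embedding is
-- automatically injective.
record AlgebraicNumbers (ℝ : RealField c ℓ₁ ℓ₂) c′ ℓ′
       : Set (c ⊔ ℓ₁ ⊔ lsuc (c′ ⊔ ℓ′)) where
  private
    module ℝ = RealField ℝ
    module ℂ = RawRing ℝ.complexRawRing
  field
    underlyingField : Field c′ ℓ′
  open Field underlyingField public
  field
    isAlgebraicallyClosed : IsAlgebraicallyClosed
    isAlgebraic           : ∀ x → IsAlgebraic x
    ι                     : Carrier → ℂ.Carrier
    ι-isRingHomomorphism  : IsRingHomomorphism (Ring.rawRing ring) ℝ.complexRawRing ι

  -- α is the real number x.
  Represents : Carrier → ℝ.Carrier → Set ℓ₁
  Represents α x = ι α ℂ.≈ (x , ℝ.0#)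

  IsTotallyPositive : Carrier → Set (c ⊔ ℓ₁ ⊔ ℓ₂ ⊔ c′ ⊔ ℓ′)
  IsTotallyPositive α =
    ∀ β → IsConjugate α β → ∃[ x ] Represents β x × ℝ.0# ℝ.< x

  -- Field automorphisms; these fix ℚ automatically.
  record Gal : Set (c′ ⊔ ℓ′) where
    field
      ⟦_⟧               : Carrier → Carrier
      isRingIsomorphism : IsRingIsomorphism (Ring.rawRing ring) (Ring.rawRing ring) ⟦_⟧

module Paths (ℝ : RealField c ℓ₁ ℓ₂) (q : RealField.Carrier ℝ) where
  open RealField ℝ

  continuedFraction : ∀ {k} → Vector ℤ (suc k) → Carrier
  continuedFraction {zero}  m = fromℤ (last m)
  continuedFraction {suc k} m =
    fromℤ (last m) + (q * continuedFraction (init m)) ⁻¹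

  prefix : ∀ {k} → Vector ℤ (suc k) → (j : Fin (suc k)) → Vector ℤ (suc (toℕ j))
  prefix m j i = m (inject≤ i (toℕ<n j))

  IsPath : ∀ {k} → Vector ℤ (suc k) → Set ℓ₁
  IsPath {k} m = ∀ (j : Fin k) → continuedFraction (prefix m (inject₁ j)) ≉ 0#

  -- Here √ q ^ k is q^{k/2}.
  weight : ∀ {k} → Vector ℤ (suc k) → Carrier
  weight {k} m =
    √ q ^ k * product (λ (j : Fin k) → ∣ continuedFraction (prefix m (inject₁ j)) ∣)

  HasUniqueWeight : Set ℓ₁
  HasUniqueWeight =
    ∀ {k l} (m : Vector ℤ (suc k)) (n : Vector ℤ (suc l)) → IsPath m → IsPath n →
    continuedFraction m ≈ continuedFraction n → weight m ≈ weight n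

{-# OPTIONS --safe #-}

-- Put u = √ q.  Up to scaling by powers of u, the numerator and the denominator of
-- c(q, 𝐦) form a vector (N , D) in the orbit of (1 , 0) under the group generated by
-- (1 u ; 0 1) and (0 1 ; 1 0), and w_q(𝐦) = |D|.  Uniqueness of the weight says that
-- parallel vectors of this orbit agree up to sign, i.e. that (x , 0) is in the orbit
-- only for x = ± 1.  This is a statement about polynomials in q with integer
-- coefficients, so it can be transferred from any conjugate of q.
--
-- It holds for q ≥ 4 and for q = 4 cos² (π / n), where the group is a Hecke group:
-- a ping-pong with nonnegative matrices writes the vectors of the orbit in a normal
-- form (Ladders).
--
-- Let q be a totally positive algebraic integer with all conjugates 4 cos² θ < 4.
-- For a large prime p, also 4 cos² pθ is a conjugate of q: if h is the minimal
-- polynomial of q then h(4 cos² pθ) ≡ h(q)ᵖ modulo p by Frobenius, so it equals p y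
-- where y is in ℤ[q] and has conjugates O(1/p), and y = 0 since ℤ[q] is discrete in the
-- product of its real embeddings.  As q has finitely many conjugates, θ is a rational
-- multiple of π.  Choose j such that |sin jθ| is minimal among the nonzero ones; then
-- j is prime to the order of θ, so, replacing j by an integer without small prime
-- factors, 4 cos² jθ is a conjugate of q, and it is of the form 4 cos² (π / n).
module Submission where

open import Defs
open import Algebra.Bundles using (CommutativeRing)
open import Algebra.Core using (Op₁; Op₂)
import Algebra.Consequences.Setoid as Consequences
import Algebra.Definitions as AlgebraDefinitions
open import Algebra.Morphism.Structures using (IsRingHomomorphism; IsRingIsomorphism)
import Algebra.Properties.AbelianGroup as AbelianGroupProperties
import Algebra.Properties.CommutativeSemiring.Binomial as Binomial
import Algebra.Properties.CommutativeSemiring.Exp as CommutativeSemiringExp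
import Algebra.Properties.Monoid.Sum as MonoidSum
import Algebra.Properties.Ring as RingProperties
import Algebra.Properties.Semiring.Exp as SemiringExp
import Algebra.Properties.Semiring.Mult as SemiringMult
import Algebra.Properties.Semiring.Mult.TCOptimised as SemiringMult′
import Algebra.Properties.Semiring.Sum as SemiringSum
import Algebra.Solver.Ring as RingSolver
import Algebra.Solver.Ring.AlmostCommutativeRing as ACR
open import Data.Bool.Base using (Bool; true; false)
open import Data.Empty using (⊥; ⊥-elim)
open import Data.Fin.Base using (Fin; toℕ; inject₁; inject≤) renaming (fromℕ to fromℕ<suc)
open import Data.Fin.Properties
  using (pigeonhole; toℕ<n; toℕ-fromℕ; toℕ-inject₁; toℕ-inject≤; toℕ-injective)
open import Data.Integer.Base using (ℤ; +_; -[1+_]; _⊖_)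
import Data.Integer.Base as ℤ
open import Data.Integer.GCD using (gcd)
import Data.Integer.Properties as ℤₚ
open import Data.List.Base as List using (List; []; _∷_)
open import Data.List.Membership.Propositional using (_∈_)
open import Data.List.Relation.Unary.All as ListAll using ([]; _∷_)
open import Data.List.Relation.Unary.Any using (here; there)
open import Data.Maybe.Base using (Maybe; just; nothing)
open import Data.Nat.Base using (ℕ; zero; suc; NonZero)
import Data.Nat.Base as ℕ
open import Data.Nat.Combinatorics
  using (nCk+nC[k+1]≡[n+1]C[k+1]; nCn≡1; nC1≡n) renaming (_C_ to _choose_)
open import Data.Nat.Divisibility
  using (_∣_; _∤_; _∣?_; divides; ∣⇒≤; ∣m+n∣m⇒∣n; ∣n⇒∣m*n; ∣m⇒∣m*n; ∣1⇒≡1; m∣m*n)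
open import Data.Nat.DivMod using (_%_; m≡m%n+[m/n]*n; m%n<n)
open import Data.Nat.Induction using (<-rec)
open import Data.Nat.ListAction using () renaming (product to productℕ)
open import Data.Nat.ListAction.Properties using (∈⇒∣product)
open import Data.Nat.Primality
  using (Prime; prime?; euclidsLemma; prime⇒irreducible; prime⇒nonTrivial; ¬prime[1])
open import Data.Nat.Primality.Factorisation using (factorise)
import Data.Nat.Properties as ℕₚ
import Data.Nat.Tactic.RingSolver as ℕSolver
open import Data.Product.Base using (_×_; _,_; ∃-syntax; Σ-syntax; proj₁; proj₂)
open import Data.Rational.Base using (ℚ; ↥_; ↧_; ↧ₙ_; _/_)
import Data.Rational.Properties as ℚₚ
open import Data.Sum.Base using (_⊎_; inj₁; inj₂)
open import Data.Vec.Base as Vec using (Vec; []; _∷_; zipWith; _∷ʳ_; initLast)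
open import Data.Vec.Functional using (Vector; init; last)
import Data.Vec.Properties as Vecₚ
open import Data.Vec.Relation.Binary.Pointwise.Inductive using (Pointwise; []; _∷_)
open import Data.Vec.Relation.Unary.All as All using (All; []; _∷_)
open import Data.Vec.Relation.Unary.AllPairs using (AllPairs; []; _∷_)
open import Data.Vec.Relation.Unary.Any as Any using (Any; here; there)
import Data.Vec.Relation.Unary.Any.Properties as Anyₚ
open import Function.Base using (_∘_)
open import Level using (Level; _⊔_)
open import Relation.Binary.Bundles using (Setoid)
open import Relation.Binary.Core using (Rel)
open import Relation.Binary.Definitions using (tri<; tri≈; tri>)
open import Relation.Binary.PropositionalEquality.Core as ≡ using (_≡_; _≢_)
open import Relation.Binary.PropositionalEquality.Properties using (module ≡-Reasoning)
import Relation.Binary.Reasoning.Setoid as SetoidReasoning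
open import Relation.Binary.Structures using (IsEquivalence; IsStrictTotalOrder)
open import Relation.Nullary.Decidable using (Dec; yes; no; decidable-stable)
open import Relation.Nullary.Negation.Core using (¬_; contradiction)

module IntegersIn {c ℓ : Level} (R : CommutativeRing c ℓ) where
  open CommutativeRing R
  open RingProperties ring using (-‿distribˡ-*; -‿distribʳ-*; -‿involutive; -0#≈0#)
  open AbelianGroupProperties +-abelianGroup using (⁻¹-∙-comm)
  open SemiringMult semiring using (×-homo-+; ×1-homo-*) renaming (_×_ to _·_)
  open SemiringMult′ semiring using () renaming (_×_ to _·′_; ×ᵤ≈× to ·≈·′)
  open SetoidReasoning setoid

  fromℕ : ℕ → Carrier
  fromℕ n = n · 1#

  fromℤ : ℤ → Carrier
  fromℤ (+ n)    = fromℕ n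
  fromℤ -[1+ n ] = - fromℕ (suc n)

  private
    cancel : ∀ x y z → (x + y) - (x + z) ≈ y - z
    cancel x y z = begin
      (x + y) - (x + z)     ≈⟨ +-congˡ (⁻¹-∙-comm x z) ⟨
      (x + y) + (- x - z)   ≈⟨ +-congʳ (+-comm x y) ⟩
      (y + x) + (- x - z)   ≈⟨ +-assoc y x _ ⟩
      y + (x + (- x - z))   ≈⟨ +-congˡ (+-assoc x (- x) (- z)) ⟨
      y + ((x - x) - z)     ≈⟨ +-congˡ (+-congʳ (-‿inverseʳ x)) ⟩
      y + (0# - z)          ≈⟨ +-congˡ (+-identityˡ (- z)) ⟩
      y - z                 ∎

  fromℤ-⊖ : ∀ m n → fromℤ (m ⊖ n) ≈ fromℕ m - fromℕ n
  fromℤ-⊖ m zero = begin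
    fromℤ (m ⊖ 0)  ≡⟨ ≡.cong fromℤ (ℤₚ.⊖-≥ {m} {0} ℕ.z≤n) ⟩
    fromℕ m        ≈⟨ +-identityʳ _ ⟨
    fromℕ m + 0#   ≈⟨ +-congˡ -0#≈0# ⟨
    fromℕ m - 0#   ∎
  fromℤ-⊖ zero (suc n) = sym (+-identityˡ _)
  fromℤ-⊖ (suc m) (suc n) = begin
    fromℤ (suc m ⊖ suc n)             ≡⟨ ≡.cong fromℤ (ℤₚ.[1+m]⊖[1+n]≡m⊖n m n) ⟩
    fromℤ (m ⊖ n)                     ≈⟨ fromℤ-⊖ m n ⟩
    fromℕ m - fromℕ n                 ≈⟨ cancel 1# (fromℕ m) (fromℕ n) ⟨
    (1# + fromℕ m) - (1# + fromℕ n)   ∎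

  fromℤ-neg : ∀ i → fromℤ (ℤ.- i) ≈ - fromℤ i
  fromℤ-neg (+ zero)   = sym -0#≈0#
  fromℤ-neg (+ suc n)  = refl
  fromℤ-neg -[1+ n ]   = sym (-‿involutive _)

  fromℤ-+ : ∀ i j → fromℤ (i ℤ.+ j) ≈ fromℤ i + fromℤ j
  fromℤ-+ (+ m) (+ n) = ×-homo-+ 1# m n
  fromℤ-+ (+ m) -[1+ n ] = fromℤ-⊖ m (suc n)
  fromℤ-+ -[1+ m ] (+ n) = trans (fromℤ-⊖ n (suc m)) (+-comm _ _)
  fromℤ-+ -[1+ m ] -[1+ n ] = begin
    - fromℕ (suc (suc (m ℕ.+ n)))        ≡⟨ ≡.cong (λ k → - fromℕ (suc k)) (ℕₚ.+-suc m n) ⟨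
    - fromℕ (suc m ℕ.+ suc n)            ≈⟨ -‿cong (×-homo-+ 1# (suc m) (suc n)) ⟩
    - (fromℕ (suc m) + fromℕ (suc n))    ≈⟨ ⁻¹-∙-comm _ _ ⟨
    - fromℕ (suc m) - fromℕ (suc n)      ∎

  private
    pos-* : ∀ m j → fromℤ (+ m ℤ.* j) ≈ fromℕ m * fromℤ j
    pos-* m (+ n) = begin
      fromℤ (+ m ℤ.* + n)  ≡⟨ ≡.cong fromℤ (ℤₚ.pos-* m n) ⟨
      fromℕ (m ℕ.* n)      ≈⟨ ×1-homo-* m n ⟩
      fromℕ m * fromℕ n    ∎
    pos-* m -[1+ n ] = begin
      fromℤ (+ m ℤ.* -[1+ n ])           ≡⟨ ≡.cong fromℤ (ℤₚ.neg-distribʳ-* (+ m) (+ suc n)) ⟨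
      fromℤ (ℤ.- (+ m ℤ.* + suc n))      ≈⟨ fromℤ-neg (+ m ℤ.* + suc n) ⟩
      - fromℤ (+ m ℤ.* + suc n)          ≈⟨ -‿cong (pos-* m (+ suc n)) ⟩
      - (fromℕ m * fromℕ (suc n))        ≈⟨ -‿distribʳ-* _ _ ⟩
      fromℕ m * - fromℕ (suc n)          ∎

  fromℤ-* : ∀ i j → fromℤ (i ℤ.* j) ≈ fromℤ i * fromℤ j
  fromℤ-* (+ m) j = pos-* m j
  fromℤ-* -[1+ m ] j = begin
    fromℤ (-[1+ m ] ℤ.* j)        ≡⟨ ≡.cong fromℤ (ℤₚ.neg-distribˡ-* (+ suc m) j) ⟨
    fromℤ (ℤ.- (+ suc m ℤ.* j))   ≈⟨ fromℤ-neg (+ suc m ℤ.* j) ⟩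
    - fromℤ (+ suc m ℤ.* j)       ≈⟨ -‿cong (pos-* (suc m) j) ⟩
    - (fromℕ (suc m) * fromℤ j)   ≈⟨ -‿distribˡ-* _ _ ⟩
    - fromℕ (suc m) * fromℤ j     ∎

  fromℕ-1 : fromℕ 1 ≈ 1#
  fromℕ-1 = +-identityʳ 1#

  private
    -- Unlike fromℤ, this sends 1 to 1# definitionally, so that solver
    -- constants match the literals of the goals.
    coefficient : ℤ → Carrier
    coefficient (+ n)    = n ·′ 1#
    coefficient -[1+ n ] = - (suc n ·′ 1#)

    coefficient≈ : ∀ i → coefficient i ≈ fromℤ i
    coefficient≈ (+ n)    = sym (·≈·′ n 1#)
    coefficient≈ -[1+ n ] = -‿cong (sym (·≈·′ (suc n) 1#))

    almost : ACR.AlmostCommutativeRing c ℓ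
    almost = ACR.fromCommutativeRing R

    morphism : ℤ.+-*-rawRing ACR.-Raw-AlmostCommutative⟶ almost
    morphism = record
      { ⟦_⟧    = coefficient
      ; +-homo = λ i j → trans (coefficient≈ (i ℤ.+ j))
          (trans (fromℤ-+ i j) (+-cong (sym (coefficient≈ i)) (sym (coefficient≈ j))))
      ; *-homo = λ i j → trans (coefficient≈ (i ℤ.* j))
          (trans (fromℤ-* i j) (*-cong (sym (coefficient≈ i)) (sym (coefficient≈ j))))
      ; -‿homo = λ i → trans (coefficient≈ (ℤ.- i))
          (trans (fromℤ-neg i) (-‿cong (sym (coefficient≈ i))))
      ; 0-homo = refl
      ; 1-homo = refl
      }

    decide : ∀ i j → Maybe (coefficient i ≈ coefficient j)
    decide i j with i ℤₚ.≟ j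
    ... | yes i≡j = just (reflexive (≡.cong coefficient i≡j))
    ... | no _    = nothing

  open RingSolver ℤ.+-*-rawRing almost morphism decide public
    using (Polynomial; solve; _:=_; _:+_; _:*_; _:-_; :-_)
    renaming (con to κ)

  :0 :1 :2 : ∀ {n} → Polynomial n
  :0 = κ (+ 0)
  :1 = κ (+ 1)
  :2 = κ (+ 2)

_Annihilates_ : ∀ {c ℓ : Level} → ℕ → CommutativeRing c ℓ → Set ℓ
p Annihilates R = fromℕ p ≈ 0#
  where
  open CommutativeRing R
  open IntegersIn R

data Expr : Set where
  con : ℤ → Expr
  X   : Expr
  _⊕_ _⊗_ : Expr → Expr → Expr
  ⊝_  : Expr → Expr

infixl 6 _⊕_
infixl 7 _⊗_
infix  8 ⊝_

module Evaluation {c ℓ : Level} (R : CommutativeRing c ℓ) where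
  open CommutativeRing R
  open IntegersIn R using (fromℤ)

  ⟦_⟧ : Expr → Carrier → Carrier
  ⟦ con i ⟧ t = fromℤ i
  ⟦ X ⟧     t = t
  ⟦ a ⊕ b ⟧ t = ⟦ a ⟧ t + ⟦ b ⟧ t
  ⟦ a ⊗ b ⟧ t = ⟦ a ⟧ t * ⟦ b ⟧ t
  ⟦ ⊝ a ⟧   t = - ⟦ a ⟧ t

  ⟦⟧-cong : ∀ e {s t} → s ≈ t → ⟦ e ⟧ s ≈ ⟦ e ⟧ t
  ⟦⟧-cong (con i) s≈t = refl
  ⟦⟧-cong X       s≈t = s≈t
  ⟦⟧-cong (a ⊕ b) s≈t = +-cong (⟦⟧-cong a s≈t) (⟦⟧-cong b s≈t)
  ⟦⟧-cong (a ⊗ b) s≈t = *-cong (⟦⟧-cong a s≈t) (⟦⟧-cong b s≈t)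
  ⟦⟧-cong (⊝ a)   s≈t = -‿cong (⟦⟧-cong a s≈t)

-- For instance the graph of a homomorphism, or "α represents the real number x".
record IsRingRelation {a b ℓ₁ ℓ₂ r : Level} (A : CommutativeRing a ℓ₁) (B : CommutativeRing b ℓ₂)
    (_~_ : CommutativeRing.Carrier A → CommutativeRing.Carrier B → Set r) : Set (a ⊔ b ⊔ r) where
  private
    module A = CommutativeRing A
    module B = CommutativeRing B
  field
    0-rel : A.0# ~ B.0#
    1-rel : A.1# ~ B.1#
    +-rel : ∀ {x y u v} → x ~ u → y ~ v → (x A.+ y) ~ (u B.+ v)
    *-rel : ∀ {x y u v} → x ~ u → y ~ v → (x A.* y) ~ (u B.* v)
    -‿rel : ∀ {x u} → x ~ u → (A.- x) ~ (B.- u)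

  fromℕ-rel : ∀ n → IntegersIn.fromℕ A n ~ IntegersIn.fromℕ B n
  fromℕ-rel zero    = 0-rel
  fromℕ-rel (suc n) = +-rel 1-rel (fromℕ-rel n)

  fromℤ-rel : ∀ i → IntegersIn.fromℤ A i ~ IntegersIn.fromℤ B i
  fromℤ-rel (+ n)    = fromℕ-rel n
  fromℤ-rel -[1+ n ] = -‿rel (fromℕ-rel (suc n))

  ⟦⟧-rel : ∀ e {x u} → x ~ u → Evaluation.⟦_⟧ A e x ~ Evaluation.⟦_⟧ B e u
  ⟦⟧-rel (con i) x~u = fromℤ-rel i
  ⟦⟧-rel X       x~u = x~u
  ⟦⟧-rel (a ⊕ b) x~u = +-rel (⟦⟧-rel a x~u) (⟦⟧-rel b x~u)
  ⟦⟧-rel (a ⊗ b) x~u = *-rel (⟦⟧-rel a x~u) (⟦⟧-rel b x~u)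
  ⟦⟧-rel (⊝ a)   x~u = -‿rel (⟦⟧-rel a x~u)

-- a₀ + a₁X + ⋯ + aₙ₋₁Xⁿ⁻¹ + cXⁿ
horner : ∀ {n} → ℤ → Vec ℤ n → Expr
horner c []       = con c
horner c (a ∷ as) = con a ⊕ X ⊗ horner c as

fromCoefficients : List ℤ → Expr
fromCoefficients []       = con (+ 0)
fromCoefficients (a ∷ as) = con a ⊕ X ⊗ fromCoefficients as

addLists : List ℤ → List ℤ → List ℤ
addLists []       bs       = bs
addLists as       []       = as
addLists (a ∷ as) (b ∷ bs) = a ℤ.+ b ∷ addLists as bs

mulLists : List ℤ → List ℤ → List ℤ
mulLists []       bs = []
mulLists (a ∷ as) bs = addLists (List.map (a ℤ.*_) bs) (+ 0 ∷ mulLists as bs)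

coefficients : Expr → List ℤ
coefficients (con i) = i ∷ []
coefficients X       = + 0 ∷ + 1 ∷ []
coefficients (a ⊕ b) = addLists (coefficients a) (coefficients b)
coefficients (a ⊗ b) = mulLists (coefficients a) (coefficients b)
coefficients (⊝ a)   = List.map (-[1+ 0 ] ℤ.*_) (coefficients a)

module IntegerPolynomials {c ℓ : Level} (R : CommutativeRing c ℓ) where
  open CommutativeRing R
  open IntegersIn R
  open Evaluation R
  open SetoidReasoning setoid

  fromCoefficients-+ : ∀ as bs t →
    ⟦ fromCoefficients (addLists as bs) ⟧ t ≈ ⟦ fromCoefficients as ⟧ t + ⟦ fromCoefficients bs ⟧ t
  fromCoefficients-+ []       bs       t = sym (+-identityˡ _)
  fromCoefficients-+ (a ∷ as) []       t = sym (+-identityʳ _)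
  fromCoefficients-+ (a ∷ as) (b ∷ bs) t =
    trans (+-cong (fromℤ-+ a b) (*-congˡ (fromCoefficients-+ as bs t)))
      (solve 5 (λ x y t u v → (x :+ y) :+ t :* (u :+ v) := (x :+ t :* u) :+ (y :+ t :* v)) refl
        (fromℤ a) (fromℤ b) t (⟦ fromCoefficients as ⟧ t) (⟦ fromCoefficients bs ⟧ t))

  fromCoefficients-scale : ∀ k as t →
    ⟦ fromCoefficients (List.map (k ℤ.*_) as) ⟧ t ≈ fromℤ k * ⟦ fromCoefficients as ⟧ t
  fromCoefficients-scale k []       t = sym (zeroʳ _)
  fromCoefficients-scale k (a ∷ as) t =
    trans (+-cong (fromℤ-* k a) (*-congˡ (fromCoefficients-scale k as t)))
      (solve 4 (λ k a t u → k :* a :+ t :* (k :* u) := k :* (a :+ t :* u)) refl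
        (fromℤ k) (fromℤ a) t (⟦ fromCoefficients as ⟧ t))

  fromCoefficients-* : ∀ as bs t →
    ⟦ fromCoefficients (mulLists as bs) ⟧ t ≈ ⟦ fromCoefficients as ⟧ t * ⟦ fromCoefficients bs ⟧ t
  fromCoefficients-* []       bs t = sym (zeroˡ _)
  fromCoefficients-* (a ∷ as) bs t = begin
    ⟦ fromCoefficients (addLists (List.map (a ℤ.*_) bs) (+ 0 ∷ mulLists as bs)) ⟧ t
      ≈⟨ fromCoefficients-+ (List.map (a ℤ.*_) bs) _ t ⟩
    ⟦ fromCoefficients (List.map (a ℤ.*_) bs) ⟧ t + (0# + t * ⟦ fromCoefficients (mulLists as bs) ⟧ t)
      ≈⟨ +-cong (fromCoefficients-scale a bs t) (+-congˡ (*-congˡ (fromCoefficients-* as bs t))) ⟩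
    fromℤ a * B + (0# + t * (A * B))
      ≈⟨ solve 4 (λ a t u v → a :* v :+ (:0 :+ t :* (u :* v)) := (a :+ t :* u) :* v) refl
           (fromℤ a) t A B ⟩
    (fromℤ a + t * A) * B ∎
    where
    A = ⟦ fromCoefficients as ⟧ t
    B = ⟦ fromCoefficients bs ⟧ t

  coefficients-correct : ∀ e t → ⟦ fromCoefficients (coefficients e) ⟧ t ≈ ⟦ e ⟧ t
  coefficients-correct (con i) t = solve 2 (λ a t → a :+ t :* :0 := a) refl (fromℤ i) t
  coefficients-correct X t =
    trans (+-congˡ (*-congˡ (+-congʳ fromℕ-1)))
      (solve 1 (λ t → :0 :+ t :* (:1 :+ t :* :0) := t) refl t)
  coefficients-correct (a ⊕ b) t = trans (fromCoefficients-+ (coefficients a) _ t)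
    (+-cong (coefficients-correct a t) (coefficients-correct b t))
  coefficients-correct (a ⊗ b) t = trans (fromCoefficients-* (coefficients a) _ t)
    (*-cong (coefficients-correct a t) (coefficients-correct b t))
  coefficients-correct (⊝ a) t = trans (fromCoefficients-scale -[1+ 0 ] (coefficients a) t)
    (trans (*-cong (-‿cong fromℕ-1) (coefficients-correct a t))
      (solve 1 (λ x → (:- :1) :* x := :- x) refl (⟦ a ⟧ t)))

  horner-∷ʳ : ∀ {n} (v : Vec ℤ n) k t → ⟦ horner (+ 0) (v ∷ʳ k) ⟧ t ≈ ⟦ horner k v ⟧ t
  horner-∷ʳ []      k t = trans (+-congˡ (zeroʳ t)) (+-identityʳ _)
  horner-∷ʳ (a ∷ v) k t = +-congˡ (*-congˡ (horner-∷ʳ v k t))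

  combine : ∀ {n} → ℤ → ℤ → Vec ℤ n → Vec ℤ n → Vec ℤ n
  combine k l = zipWith (λ a b → k ℤ.* a ℤ.- l ℤ.* b)

  fromℤ-combine : ∀ k l a b → fromℤ (k ℤ.* a ℤ.- l ℤ.* b) ≈ fromℤ k * fromℤ a - fromℤ l * fromℤ b
  fromℤ-combine k l a b = trans (fromℤ-+ (k ℤ.* a) _)
    (+-cong (fromℤ-* k a) (trans (fromℤ-neg (l ℤ.* b)) (-‿cong (fromℤ-* l b))))

  horner-combine : ∀ {n} k l (v w : Vec ℤ n) a b t →
    ⟦ horner (k ℤ.* a ℤ.- l ℤ.* b) (combine k l v w) ⟧ t
      ≈ fromℤ k * ⟦ horner a v ⟧ t - fromℤ l * ⟦ horner b w ⟧ t
  horner-combine k l []       []       a b t = fromℤ-combine k l a b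
  horner-combine k l (x ∷ v)  (y ∷ w)  a b t =
    trans (+-cong (fromℤ-combine k l x y) (*-congˡ (horner-combine k l v w a b t)))
      (solve 7 (λ k l x y t p q →
          (k :* x :- l :* y) :+ t :* (k :* p :- l :* q) := k :* (x :+ t :* p) :- l :* (y :+ t :* q)) refl
        (fromℤ k) (fromℤ l) (fromℤ x) (fromℤ y) t (⟦ horner a v ⟧ t) (⟦ horner b w ⟧ t))

  horner-scale : ∀ {m} k (w : Vec ℤ m) b t →
    ⟦ horner (k ℤ.* b) (Vec.map (k ℤ.*_) w) ⟧ t ≈ fromℤ k * ⟦ horner b w ⟧ t
  horner-scale k []      b t = fromℤ-* k b
  horner-scale k (y ∷ w) b t = trans (+-cong (fromℤ-* k y) (*-congˡ (horner-scale k w b t)))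
    (solve 4 (λ k y t P → k :* y :+ t :* (k :* P) := k :* (y :+ t :* P)) refl
      (fromℤ k) (fromℤ y) t (⟦ horner b w ⟧ t))

  module Division {n} (a : ℤ) (v : Vec ℤ n) where
    V : Carrier → Carrier
    V = ⟦ horner a v ⟧

    reduceOnce : ∀ d (p : Vec ℤ n) → ∃[ r ] ∀ t →
      fromℤ a * ⟦ horner d p ⟧ t ≈ V t * fromℤ d + ⟦ horner {n} (+ 0) r ⟧ t
    reduceOnce d p = combine a d p v , λ t → begin
      fromℤ a * ⟦ horner d p ⟧ t
        ≈⟨ solve 4 (λ a P V d → a :* P := V :* d :+ (a :* P :- d :* V)) refl
             (fromℤ a) (⟦ horner d p ⟧ t) (V t) (fromℤ d) ⟩
      V t * fromℤ d + (fromℤ a * ⟦ horner d p ⟧ t - fromℤ d * V t)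
        ≈⟨ +-congˡ (horner-combine a d p v d a t) ⟨
      V t * fromℤ d + ⟦ horner (a ℤ.* d ℤ.- d ℤ.* a) (combine a d p v) ⟧ t
        ≡⟨ ≡.cong (λ i → V t * fromℤ d + ⟦ horner i (combine a d p v) ⟧ t)
             (≡.trans (≡.cong (ℤ._- d ℤ.* a) (ℤₚ.*-comm a d)) (ℤₚ.+-inverseʳ (d ℤ.* a))) ⟩
      V t * fromℤ d + ⟦ horner (+ 0) (combine a d p v) ⟧ t ∎

    reduceOnce₀ : ∀ (w : Vec ℤ (suc n)) → ∃[ e ] ∃[ r ] ∀ t →
      fromℤ a * ⟦ horner (+ 0) w ⟧ t ≈ V t * fromℤ e + ⟦ horner {n} (+ 0) r ⟧ t
    reduceOnce₀ w with initLast w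
    ... | p , e , ≡.refl with reduceOnce e p
    ...   | r , eq = e , r , λ t → trans (*-congˡ (horner-∷ʳ p e t)) (eq t)

    pseudoDivision : ∀ j d (p : Vec ℤ (j ℕ.+ n)) → ∃[ k ] ∃[ r ] ∀ t →
      fromℤ (a ℤ.^ suc j) * ⟦ horner d p ⟧ t
        ≈ V t * ⟦ horner {j} (a ℤ.^ j ℤ.* d) k ⟧ t + ⟦ horner {n} (+ 0) r ⟧ t
    pseudoDivision zero d p = [] , proj₁ (reduceOnce d p) , λ t → begin
      fromℤ (a ℤ.* + 1) * ⟦ horner d p ⟧ t
        ≡⟨ ≡.cong (λ i → fromℤ i * ⟦ horner d p ⟧ t) (ℤₚ.*-identityʳ a) ⟩
      fromℤ a * ⟦ horner d p ⟧ t
        ≈⟨ proj₂ (reduceOnce d p) t ⟩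
      V t * fromℤ d + ⟦ horner (+ 0) (proj₁ (reduceOnce d p)) ⟧ t
        ≡⟨ ≡.cong (λ i → V t * fromℤ i + ⟦ horner (+ 0) (proj₁ (reduceOnce d p)) ⟧ t) (ℤₚ.*-identityˡ d) ⟨
      V t * fromℤ (+ 1 ℤ.* d) + ⟦ horner (+ 0) (proj₁ (reduceOnce d p)) ⟧ t ∎
    pseudoDivision (suc j) d (x ∷ p) = e ∷ Vec.map (a ℤ.*_) k , r′ , λ t → begin
      fromℤ (a ℤ.* a ℤ.^ suc j) * (fromℤ x + t * ⟦ horner d p ⟧ t)
        ≈⟨ *-congʳ (fromℤ-* a (a ℤ.^ suc j)) ⟩
      fromℤ a * fromℤ (a ℤ.^ suc j) * (fromℤ x + t * ⟦ horner d p ⟧ t)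
        ≈⟨ solve 5 (λ a a′ x t P → a :* a′ :* (x :+ t :* P) := a :* (a′ :* x :+ t :* (a′ :* P))) refl
             (fromℤ a) (fromℤ (a ℤ.^ suc j)) (fromℤ x) t (⟦ horner d p ⟧ t) ⟩
      fromℤ a * (fromℤ (a ℤ.^ suc j) * fromℤ x + t * (fromℤ (a ℤ.^ suc j) * ⟦ horner d p ⟧ t))
        ≈⟨ *-congˡ (+-cong (sym (fromℤ-* (a ℤ.^ suc j) x)) (*-congˡ (eq t))) ⟩
      fromℤ a * (fromℤ (a ℤ.^ suc j ℤ.* x) + t * (V t * ⟦ horner (a ℤ.^ j ℤ.* d) k ⟧ t + ⟦ horner (+ 0) r ⟧ t))
        ≈⟨ solve 6 (λ a y t v k r → a :* (y :+ t :* (v :* k :+ r))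
                      := v :* (t :* (a :* k)) :+ a :* (y :+ t :* r)) refl
             (fromℤ a) (fromℤ (a ℤ.^ suc j ℤ.* x)) t (V t) (⟦ horner (a ℤ.^ j ℤ.* d) k ⟧ t) (⟦ horner (+ 0) r ⟧ t) ⟩
      V t * (t * (fromℤ a * ⟦ horner (a ℤ.^ j ℤ.* d) k ⟧ t)) + fromℤ a * (fromℤ (a ℤ.^ suc j ℤ.* x) + t * ⟦ horner (+ 0) r ⟧ t)
        ≈⟨ +-cong (*-congˡ (*-congˡ (sym (horner-scale a k (a ℤ.^ j ℤ.* d) t)))) (eq′ t) ⟩
      V t * (t * ⟦ horner (a ℤ.* (a ℤ.^ j ℤ.* d)) (Vec.map (a ℤ.*_) k) ⟧ t) + (V t * fromℤ e + ⟦ horner (+ 0) r′ ⟧ t)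
        ≡⟨ ≡.cong (λ i → V t * (t * ⟦ horner i (Vec.map (a ℤ.*_) k) ⟧ t) + (V t * fromℤ e + ⟦ horner (+ 0) r′ ⟧ t))
             (≡.sym (ℤₚ.*-assoc a (a ℤ.^ j) d)) ⟩
      V t * (t * ⟦ horner (a ℤ.* a ℤ.^ j ℤ.* d) (Vec.map (a ℤ.*_) k) ⟧ t) + (V t * fromℤ e + ⟦ horner (+ 0) r′ ⟧ t)
        ≈⟨ solve 5 (λ v t k e r → v :* (t :* k) :+ (v :* e :+ r) := v :* (e :+ t :* k) :+ r) refl
             (V t) t (⟦ horner (a ℤ.* a ℤ.^ j ℤ.* d) (Vec.map (a ℤ.*_) k) ⟧ t) (fromℤ e) (⟦ horner (+ 0) r′ ⟧ t) ⟩
      V t * (fromℤ e + t * ⟦ horner (a ℤ.* a ℤ.^ j ℤ.* d) (Vec.map (a ℤ.*_) k) ⟧ t) + ⟦ horner (+ 0) r′ ⟧ t ∎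
      where
      quotient = pseudoDivision j d p
      k = proj₁ quotient
      r = proj₁ (proj₂ quotient)
      eq = proj₂ (proj₂ quotient)
      reduced = reduceOnce₀ (a ℤ.^ suc j ℤ.* x ∷ r)
      e = proj₁ reduced
      r′ = proj₁ (proj₂ reduced)
      eq′ = proj₂ (proj₂ reduced)

    reduceList : ∀ as → ∃[ r ] ∀ t → V t ≈ 0# →
      fromℤ (a ℤ.^ List.length as) * ⟦ fromCoefficients as ⟧ t ≈ ⟦ horner {n} (+ 0) r ⟧ t
    reduceList [] = Vec.replicate n (+ 0) , λ t _ → trans (zeroʳ _) (sym (zeros n t))
      where
      zeros : ∀ m t → ⟦ horner (+ 0) (Vec.replicate m (+ 0)) ⟧ t ≈ 0#
      zeros zero    t = refl
      zeros (suc m) t = trans (+-identityˡ _) (trans (*-congˡ (zeros m t)) (zeroʳ t))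
    reduceList (x ∷ as) = r′ , λ t V≈0 → begin
      fromℤ (a ℤ.* a^l) * (fromℤ x + t * ⟦ fromCoefficients as ⟧ t)
        ≈⟨ *-congʳ (fromℤ-* a a^l) ⟩
      fromℤ a * fromℤ a^l * (fromℤ x + t * ⟦ fromCoefficients as ⟧ t)
        ≈⟨ solve 5 (λ a a′ x t P → a :* a′ :* (x :+ t :* P) := a :* (a′ :* x :+ t :* (a′ :* P))) refl
             (fromℤ a) (fromℤ a^l) (fromℤ x) t (⟦ fromCoefficients as ⟧ t) ⟩
      fromℤ a * (fromℤ a^l * fromℤ x + t * (fromℤ a^l * ⟦ fromCoefficients as ⟧ t))
        ≈⟨ *-congˡ (+-cong (sym (fromℤ-* a^l x)) (*-congˡ (eq t V≈0))) ⟩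
      fromℤ a * (fromℤ (a^l ℤ.* x) + t * ⟦ horner (+ 0) r ⟧ t)
        ≈⟨ eq′ t ⟩
      V t * fromℤ e + ⟦ horner (+ 0) r′ ⟧ t    ≈⟨ +-congʳ (trans (*-congʳ V≈0) (zeroˡ _)) ⟩
      0# + ⟦ horner (+ 0) r′ ⟧ t               ≈⟨ +-identityˡ _ ⟩
      ⟦ horner (+ 0) r′ ⟧ t ∎
      where
      a^l = a ℤ.^ List.length as
      r = proj₁ (reduceList as)
      eq = proj₂ (reduceList as)
      reduced = reduceOnce₀ (a^l ℤ.* x ∷ r)
      e = proj₁ reduced
      r′ = proj₁ (proj₂ reduced)
      eq′ = proj₂ (proj₂ reduced)

    division-≤ : ∀ {m} → n ℕ.≤ m → ∀ d (p : Vec ℤ m) → ∃[ j ] j ℕ.+ n ≡ m × ∃[ k ] ∃[ r ] ∀ t →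
      fromℤ (a ℤ.^ suc j) * ⟦ horner d p ⟧ t
        ≈ V t * ⟦ horner {j} (a ℤ.^ j ℤ.* d) k ⟧ t + ⟦ horner {n} (+ 0) r ⟧ t
    division-≤ {m} n≤m d = go (m ℕ.∸ n) (ℕₚ.m∸n+n≡m n≤m)
      where
      go : ∀ j {m} → j ℕ.+ n ≡ m → ∀ (p : Vec ℤ m) → ∃[ j ] j ℕ.+ n ≡ m × ∃[ k ] ∃[ r ] ∀ t →
        fromℤ (a ℤ.^ suc j) * ⟦ horner d p ⟧ t
          ≈ V t * ⟦ horner {j} (a ℤ.^ j ℤ.* d) k ⟧ t + ⟦ horner {n} (+ 0) r ⟧ t
      go j ≡.refl p = j , ≡.refl , pseudoDivision j d p

    reduce : ∀ e → ∃[ l ] ∃[ r ] ∀ t → V t ≈ 0# →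
      fromℤ (a ℤ.^ l) * ⟦ e ⟧ t ≈ ⟦ horner {n} (+ 0) r ⟧ t
    reduce e with reduceList (coefficients e)
    ... | r , eq = List.length (coefficients e) , r ,
      λ t V≈0 → trans (*-congˡ (sym (coefficients-correct e t))) (eq t V≈0)

[1+k]*[1+n]C[1+k]≡[1+n]*nCk : ∀ n k → suc k ℕ.* (suc n choose suc k) ≡ suc n ℕ.* (n choose k)
[1+k]*[1+n]C[1+k]≡[1+n]*nCk zero zero = ≡.refl
[1+k]*[1+n]C[1+k]≡[1+n]*nCk zero (suc k) = ℕₚ.*-zeroʳ (suc (suc k))
[1+k]*[1+n]C[1+k]≡[1+n]*nCk (suc n) zero = ≡.trans (ℕₚ.*-identityˡ _)
  (≡.trans (nC1≡n (suc (suc n))) (≡.sym (ℕₚ.*-identityʳ _)))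
[1+k]*[1+n]C[1+k]≡[1+n]*nCk (suc n) (suc k) = begin
  suc (suc k) ℕ.* (suc (suc n) choose suc (suc k))
    ≡⟨ ≡.cong (suc (suc k) ℕ.*_) (nCk+nC[k+1]≡[n+1]C[k+1] (suc n) (suc k)) ⟨
  suc (suc k) ℕ.* (c ℕ.+ (suc n choose suc (suc k)))
    ≡⟨ expand k c _ ⟩
  c ℕ.+ (suc k ℕ.* c ℕ.+ suc (suc k) ℕ.* (suc n choose suc (suc k)))
    ≡⟨ ≡.cong (c ℕ.+_) (≡.cong₂ ℕ._+_ ([1+k]*[1+n]C[1+k]≡[1+n]*nCk n k) ([1+k]*[1+n]C[1+k]≡[1+n]*nCk n (suc k))) ⟩
  c ℕ.+ (suc n ℕ.* (n choose k) ℕ.+ suc n ℕ.* (n choose suc k))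
    ≡⟨ ≡.cong (c ℕ.+_) (ℕₚ.*-distribˡ-+ (suc n) (n choose k) (n choose suc k)) ⟨
  c ℕ.+ suc n ℕ.* ((n choose k) ℕ.+ (n choose suc k))
    ≡⟨ ≡.cong (λ x → c ℕ.+ suc n ℕ.* x) (nCk+nC[k+1]≡[n+1]C[k+1] n k) ⟩
  suc (suc n) ℕ.* c ∎
  where
  open ≡-Reasoning
  c = suc n choose suc k
  expand : ∀ k c d → suc (suc k) ℕ.* (c ℕ.+ d) ≡ c ℕ.+ (suc k ℕ.* c ℕ.+ suc (suc k) ℕ.* d)
  expand = ℕSolver.solve-∀

prime∣binomial : ∀ {m k} → Prime (suc m) → k ℕ.< m → suc m ∣ suc m choose suc k
prime∣binomial {m} {k} p-prime k<m
  with euclidsLemma (suc k) (suc m choose suc k) p-prime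
         (divides (m choose k) (≡.trans ([1+k]*[1+n]C[1+k]≡[1+n]*nCk m k) (ℕₚ.*-comm (suc m) (m choose k))))
... | inj₁ p∣1+k = contradiction (∣⇒≤ p∣1+k) (ℕₚ.<⇒≱ (ℕ.s≤s k<m))
... | inj₂ p∣C   = p∣C

module Frobenius {c ℓ : Level} (R : CommutativeRing c ℓ) {p : ℕ}
    (p-prime : Prime p) (p≈0 : p Annihilates R) where
  open CommutativeRing R
  open IntegersIn R using (solve; _:=_; _:+_; _:-_)
  open SemiringExp semiring
  open CommutativeSemiringExp commutativeSemiring using (^-distrib-*)
  open SemiringMult semiring using (×-assoc-*; ×-assocˡ; ×-congʳ) renaming (_×_ to _·_)
  open SemiringSum semiring
  open SetoidReasoning setoid

  private
    p∣k⇒k×x≈0 : ∀ {k} x → p ∣ k → k · x ≈ 0#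
    p∣k⇒k×x≈0 {k} x (divides j ≡.refl) = begin
      (j ℕ.* p) · x          ≈⟨ ×-assocˡ x j p ⟨
      j · (p · x)            ≈⟨ ×-congʳ j (×-congʳ p (*-identityˡ x)) ⟨
      j · (p · (1# * x))     ≈⟨ ×-congʳ j (×-assoc-* p 1# x) ⟨
      j · ((p · 1#) * x)     ≈⟨ ×-congʳ j (trans (*-congʳ p≈0) (zeroˡ x)) ⟩
      j · 0#                 ≈⟨ sum-replicate j ⟨
      sum {j} (λ _ → 0#)     ≈⟨ sum-replicate-zero j ⟩
      0#                     ∎

    expansion : ∀ m → Prime (suc m) → (∀ {k} x → suc m ∣ k → k · x ≈ 0#) →
      ∀ x y → (x + y) ^ suc m ≈ x ^ suc m + y ^ suc m
    expansion m m-prime vanish x y = begin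
      (x + y) ^ suc m             ≈⟨ Binomial.theorem commutativeSemiring (suc m) x y ⟩
      term Fin.zero + sum rest       ≈⟨ +-cong first (sum-init-last rest) ⟩
      y ^ suc m + (sum (init rest) + last rest)
        ≈⟨ +-congˡ (+-cong (trans (sum-cong-≋ middle) (sum-replicate-zero m)) final) ⟩
      y ^ suc m + (0# + x ^ suc m)
        ≈⟨ trans (+-congˡ (+-identityˡ _)) (+-comm _ _) ⟩
      x ^ suc m + y ^ suc m       ∎
      where
      term = Binomial.binomialTerm commutativeSemiring x y (suc m)
      rest = λ i → term (Fin.suc i)
      first : term Fin.zero ≈ y ^ suc m
      first = trans (+-identityʳ _) (*-identityˡ _)
      middle : ∀ i → init rest i ≈ 0#
      middle i = vanish _ (prime∣binomial m-prime
        (≡.subst (ℕ._< m) (≡.sym (toℕ-inject₁ i)) (toℕ<n i)))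
      final : last rest ≈ x ^ suc m
      final rewrite toℕ-fromℕ m | nCn≡1 (suc m) | ℕₚ.n∸n≡0 m = trans (+-identityʳ _) (*-identityʳ _)

  ^p-+ : ∀ x y → (x + y) ^ p ≈ x ^ p + y ^ p
  ^p-+ = go p p-prime p∣k⇒k×x≈0
    where
    go : ∀ p → Prime p → (∀ {k} x → p ∣ k → k · x ≈ 0#) → ∀ x y → (x + y) ^ p ≈ x ^ p + y ^ p
    go zero    0-prime = contradiction 0-prime λ ()
    go (suc m) = expansion m

  ^p-0 : 0# ^ p ≈ 0#
  ^p-0 = begin
    0# ^ p                          ≈⟨ solve 1 (λ x → x := (x :+ x) :- x) refl (0# ^ p) ⟩
    (0# ^ p + 0# ^ p) - 0# ^ p      ≈⟨ +-congʳ (^p-+ 0# 0#) ⟨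
    (0# + 0#) ^ p - 0# ^ p          ≈⟨ +-congʳ (^-congˡ p (+-identityˡ 0#)) ⟩
    0# ^ p - 0# ^ p                 ≈⟨ -‿inverseʳ _ ⟩
    0#                              ∎

  ^p-neg : ∀ x → (- x) ^ p ≈ - (x ^ p)
  ^p-neg x = begin
    (- x) ^ p                          ≈⟨ solve 2 (λ a b → b := (a :+ b) :- a) refl (x ^ p) ((- x) ^ p) ⟩
    (x ^ p + (- x) ^ p) - x ^ p        ≈⟨ +-congʳ (^p-+ x (- x)) ⟨
    (x - x) ^ p - x ^ p                ≈⟨ +-congʳ (trans (^-congˡ p (-‿inverseʳ x)) ^p-0) ⟩
    0# - x ^ p                         ≈⟨ +-identityˡ _ ⟩
    - (x ^ p)                          ∎

  ^p-isRingRelation : IsRingRelation R R (λ x y → x ^ p ≈ y)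
  ^p-isRingRelation = record
    { 0-rel = ^p-0
    ; 1-rel = trans (^-congˡ p refl) (1^ p)
    ; +-rel = λ {x} {y} x~u y~v → trans (^p-+ x y) (+-cong x~u y~v)
    ; *-rel = λ {x} {y} x~u y~v → trans (^-distrib-* x y p) (*-cong x~u y~v)
    ; -‿rel = λ {x} x~u → trans (^p-neg x) (-‿cong x~u)
    }
    where
    1^ : ∀ n → 1# ^ n ≈ 1#
    1^ zero    = refl
    1^ (suc n) = trans (*-identityˡ _) (1^ n)

module _ {c ℓ : Level} {A : Set c} (_≈_ : Rel A ℓ) (_+_ _*_ : Op₂ A) (-_ : Op₁ A) (0# 1# : A) where
  open AlgebraDefinitions _≈_

  mkCommutativeRing : IsEquivalence _≈_ →
    Congruent₂ _+_ → Congruent₂ _*_ → Congruent₁ -_ →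
    Associative _+_ → Commutative _+_ → LeftIdentity 0# _+_ → LeftInverse 0# -_ _+_ →
    Associative _*_ → Commutative _*_ → LeftIdentity 1# _*_ → _*_ DistributesOverˡ _+_ →
    CommutativeRing c ℓ
  mkCommutativeRing isEquivalence +-cong *-cong -‿cong +-assoc +-comm +-identityˡ -‿inverseˡ
      *-assoc *-comm *-identityˡ distribˡ = record
    { isCommutativeRing = record
      { isRing = record
        { +-isAbelianGroup = record
          { isGroup = record
            { isMonoid = record
              { isSemigroup = record
                { isMagma = record { isEquivalence = isEquivalence ; ∙-cong = +-cong }
                ; assoc   = +-assoc
                }
              ; identity = comm∧idˡ⇒id +-comm +-identityˡ
              }
            ; inverse = comm∧invˡ⇒inv +-comm -‿inverseˡ
            ; ⁻¹-cong = -‿cong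
            }
          ; comm = +-comm
          }
        ; *-cong     = *-cong
        ; *-assoc    = *-assoc
        ; *-identity = comm∧idˡ⇒id *-comm *-identityˡ
        ; distrib    = comm∧distrˡ⇒distr +-cong *-comm distribˡ
        }
      ; *-comm = *-comm
      }
    }
    where
    setoid : Setoid c ℓ
    setoid = record { isEquivalence = isEquivalence }
    open Consequences setoid

module _ {c ℓ : Level} (R : CommutativeRing c ℓ) where
  open CommutativeRing R
  open IntegersIn R

  quotientRing : Carrier → CommutativeRing c (c ⊔ ℓ)
  quotientRing m = mkCommutativeRing _≡ₘ_ _+_ _*_ -_ 0# 1#
    (record { refl = lift refl ; sym = ≡ₘ-sym ; trans = ≡ₘ-trans })
    ≡ₘ-+ ≡ₘ-* ≡ₘ-neg
    (λ x y z → lift (+-assoc x y z)) (λ x y → lift (+-comm x y))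
    (λ x → lift (+-identityˡ x)) (λ x → lift (-‿inverseˡ x))
    (λ x y z → lift (*-assoc x y z)) (λ x y → lift (*-comm x y))
    (λ x → lift (*-identityˡ x)) (λ x y z → lift (distribˡ x y z))
    where
    _≡ₘ_ : Rel Carrier (c ⊔ ℓ)
    x ≡ₘ y = ∃[ d ] x ≈ y + m * d
    lift : ∀ {x y} → x ≈ y → x ≡ₘ y
    lift {x} {y} x≈y = 0# , trans x≈y (solve 2 (λ y m → y := y :+ m :* :0) refl y m)
    ≡ₘ-sym : ∀ {x y} → x ≡ₘ y → y ≡ₘ x
    ≡ₘ-sym {x} {y} (d , eq) = - d , trans
      (solve 3 (λ y m d → y := (y :+ m :* d) :+ m :* (:- d)) refl y m d) (+-congʳ (sym eq))
    ≡ₘ-trans : ∀ {x y z} → x ≡ₘ y → y ≡ₘ z → x ≡ₘ z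
    ≡ₘ-trans {x} {y} {z} (d , eq) (e , eq′) = e + d , trans eq (trans (+-congʳ eq′)
      (solve 4 (λ z m d e → (z :+ m :* e) :+ m :* d := z :+ m :* (e :+ d)) refl z m d e))
    ≡ₘ-+ : ∀ {x y u v} → x ≡ₘ y → u ≡ₘ v → (x + u) ≡ₘ (y + v)
    ≡ₘ-+ {x} {y} {u} {v} (d , eq) (e , eq′) = d + e , trans (+-cong eq eq′)
      (solve 5 (λ y v m d e → (y :+ m :* d) :+ (v :+ m :* e) := (y :+ v) :+ m :* (d :+ e)) refl y v m d e)
    ≡ₘ-* : ∀ {x y u v} → x ≡ₘ y → u ≡ₘ v → (x * u) ≡ₘ (y * v)
    ≡ₘ-* {x} {y} {u} {v} (d , eq) (e , eq′) = y * e + d * v + m * d * e , trans (*-cong eq eq′)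
      (solve 5 (λ y v m d e → (y :+ m :* d) :* (v :+ m :* e)
                  := y :* v :+ m :* (y :* e :+ d :* v :+ m :* d :* e)) refl y v m d e)
    ≡ₘ-neg : ∀ {x y} → x ≡ₘ y → (- x) ≡ₘ (- y)
    ≡ₘ-neg {x} {y} (d , eq) = - d , trans (-‿cong eq)
      (solve 3 (λ y m d → :- (y :+ m :* d) := :- y :+ m :* (:- d)) refl y m d)

  -- R[τ] / (τ² − x τ + 1), with (a , b) standing for a + b τ.
  adjoinUnit : Carrier → CommutativeRing c ℓ
  adjoinUnit x = mkCommutativeRing _≋_
    (λ { (a , b) (d , e) → a + d , b + e })
    (λ { (a , b) (d , e) → a * d - b * e , a * e + b * d + x * (b * e) })
    (λ { (a , b) → - a , - b })
    (0# , 0#) (1# , 0#)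
    (record
      { refl  = refl , refl
      ; sym   = λ (p , r) → sym p , sym r
      ; trans = λ (p , r) (p′ , r′) → trans p p′ , trans r r′
      })
    (λ (p , r) (p′ , r′) → +-cong p p′ , +-cong r r′)
    (λ (p , r) (p′ , r′) → +-cong (*-cong p p′) (-‿cong (*-cong r r′))
      , +-cong (+-cong (*-cong p r′) (*-cong r p′)) (*-congˡ (*-cong r r′)))
    (λ (p , r) → -‿cong p , -‿cong r)
    (λ _ _ _ → +-assoc _ _ _ , +-assoc _ _ _)
    (λ _ _ → +-comm _ _ , +-comm _ _)
    (λ _ → +-identityˡ _ , +-identityˡ _)
    (λ _ → -‿inverseˡ _ , -‿inverseˡ _)
    (λ (a , b) (d , e) (f , g) →
      solve 7 (λ x a b d e f g →
          (a :* d :- b :* e) :* f :- (a :* e :+ b :* d :+ x :* (b :* e)) :* g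
          := a :* (d :* f :- e :* g) :- b :* (d :* g :+ e :* f :+ x :* (e :* g))) refl x a b d e f g
      , solve 7 (λ x a b d e f g →
          (a :* d :- b :* e) :* g :+ (a :* e :+ b :* d :+ x :* (b :* e)) :* f
            :+ x :* ((a :* e :+ b :* d :+ x :* (b :* e)) :* g)
          := a :* (d :* g :+ e :* f :+ x :* (e :* g)) :+ b :* (d :* f :- e :* g)
            :+ x :* (b :* (d :* g :+ e :* f :+ x :* (e :* g)))) refl x a b d e f g)
    (λ (a , b) (d , e) →
      solve 4 (λ a b d e → a :* d :- b :* e := d :* a :- e :* b) refl a b d e
      , solve 5 (λ x a b d e → a :* e :+ b :* d :+ x :* (b :* e)
          := d :* b :+ e :* a :+ x :* (e :* b)) refl x a b d e)
    (λ (a , b) →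
      solve 2 (λ a b → :1 :* a :- :0 :* b := a) refl a b
      , solve 3 (λ x a b → :1 :* b :+ :0 :* a :+ x :* (:0 :* b) := b) refl x a b)
    (λ (a , b) (d , e) (f , g) →
      solve 6 (λ a b d e f g → a :* (d :+ f) :- b :* (e :+ g)
          := (a :* d :- b :* e) :+ (a :* f :- b :* g)) refl a b d e f g
      , solve 7 (λ x a b d e f g →
          a :* (e :+ g) :+ b :* (d :+ f) :+ x :* (b :* (e :+ g))
          := (a :* e :+ b :* d :+ x :* (b :* e)) :+ (a :* g :+ b :* f :+ x :* (b :* g)))
          refl x a b d e f g)
    where
    _≋_ : Rel (Carrier × Carrier) ℓ
    (a , b) ≋ (d , e) = a ≈ d × b ≈ e

-- ℤ[X], but with polynomials compared as functions on R.
exprRing : ∀ {c ℓ : Level} → CommutativeRing c ℓ → CommutativeRing Level.zero (c ⊔ ℓ)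
exprRing R = mkCommutativeRing (λ a b → ∀ t → ⟦ a ⟧ t ≈ ⟦ b ⟧ t) _⊕_ _⊗_ ⊝_ (con (+ 0)) (con (+ 1))
  (record
    { refl  = λ t → refl
    ; sym   = λ p t → sym (p t)
    ; trans = λ p r t → trans (p t) (r t)
    })
  (λ p r t → +-cong (p t) (r t))
  (λ p r t → *-cong (p t) (r t))
  (λ p t → -‿cong (p t))
  (λ _ _ _ t → +-assoc _ _ _)
  (λ _ _ t → +-comm _ _)
  (λ _ t → +-identityˡ _)
  (λ _ t → -‿inverseˡ _)
  (λ _ _ _ t → *-assoc _ _ _)
  (λ _ _ t → *-comm _ _)
  (λ _ t → trans (*-congʳ fromℕ-1) (*-identityˡ _))
  (λ _ _ _ t → distribˡ _ _ _)
  where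
  open CommutativeRing R
  open IntegersIn R
  open Evaluation R

module _ {c ℓ : Level} (R : CommutativeRing c ℓ) where
  open CommutativeRing R

  -- The Lucas and Fibonacci type solutions of the recurrence
  -- aₙ₊₂ = x aₙ₊₁ − aₙ: for x = 2 cos θ, these are 2 cos nθ and sin nθ / sin θ.
  recurrence : Carrier → Carrier → Carrier → ℕ → Carrier
  recurrence a b x zero          = a
  recurrence a b x (suc zero)    = b
  recurrence a b x (suc (suc n)) = x * recurrence a b x (suc n) - recurrence a b x n

  cosine sine : Carrier → ℕ → Carrier
  cosine x = recurrence (1# + 1#) x x
  sine     = recurrence 0# 1#

  -- For q = 4 cos² θ this is 4 cos² nθ.
  multiple : Carrier → ℕ → Carrier
  multiple q n = (1# + 1#) + cosine (q - (1# + 1#)) n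

  module _ where
    open SemiringExp semiring using (_^_)
    open IntegersIn R

    power-sum : ∀ {τ τ̄} → τ * τ̄ ≈ 1# → ∀ n → τ ^ n + τ̄ ^ n ≈ cosine (τ + τ̄) n
    power-sum ττ̄≈1 zero          = refl
    power-sum ττ̄≈1 (suc zero)    = +-cong (*-identityʳ _) (*-identityʳ _)
    power-sum {τ} {τ̄} ττ̄≈1 (suc (suc n)) =
      trans (solve 4 (λ t u a b →
          t :* (t :* a) :+ u :* (u :* b) := (t :+ u) :* (t :* a :+ u :* b) :- (t :* u) :* (a :+ b)) refl
          τ τ̄ (τ ^ n) (τ̄ ^ n))
        (+-cong (*-congˡ (power-sum ττ̄≈1 (suc n)))
          (-‿cong (trans (*-cong ττ̄≈1 (power-sum ττ̄≈1 n)) (*-identityˡ _))))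

module _ {a b ℓ₁ ℓ₂ r : Level} {A : CommutativeRing a ℓ₁} {B : CommutativeRing b ℓ₂}
    {_~_ : CommutativeRing.Carrier A → CommutativeRing.Carrier B → Set r}
    (isRingRelation : IsRingRelation A B _~_) where
  open IsRingRelation isRingRelation

  recurrence-rel : ∀ {a b x a′ b′ x′} → a ~ a′ → b ~ b′ → x ~ x′ →
    ∀ n → recurrence A a b x n ~ recurrence B a′ b′ x′ n
  recurrence-rel a~ b~ x~ zero          = a~
  recurrence-rel a~ b~ x~ (suc zero)    = b~
  recurrence-rel a~ b~ x~ (suc (suc n)) =
    +-rel (*-rel x~ (recurrence-rel a~ b~ x~ (suc n))) (-‿rel (recurrence-rel a~ b~ x~ n))

  multiple-rel : ∀ {q q′} → q ~ q′ → ∀ n → multiple A q n ~ multiple B q′ n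
  multiple-rel q~ n = +-rel 2~ (recurrence-rel 2~ x~ x~ n)
    where
    2~ = +-rel 1-rel 1-rel
    x~ = +-rel q~ (-‿rel 2~)

module _ {c ℓ : Level} (R : CommutativeRing c ℓ) (x : CommutativeRing.Carrier R) where
  open CommutativeRing R
  open IntegersIn R
  private module S = CommutativeRing (adjoinUnit R x)

  embedding-isRingRelation : IsRingRelation R (adjoinUnit R x) (λ a z → z S.≈ (a , 0#))
  embedding-isRingRelation = record
    { 0-rel = refl , refl
    ; 1-rel = refl , refl
    ; +-rel = λ (p , p′) (r , r′) → +-cong p r , trans (+-cong p′ r′) (+-identityˡ 0#)
    ; *-rel = λ (p , p′) (r , r′) →
        trans (+-cong (*-cong p r) (-‿cong (*-cong p′ r′)))
          (solve 2 (λ a b → a :* b :- :0 :* :0 := a :* b) refl _ _)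
        , trans (+-cong (+-cong (*-cong p r′) (*-cong p′ r)) (*-congˡ (*-cong p′ r′)))
          (solve 3 (λ x a b → a :* :0 :+ :0 :* b :+ x :* (:0 :* :0) := :0) refl x _ _)
    ; -‿rel = λ (p , p′) → -‿cong p , trans (-‿cong p′) (solve 0 (:- :0 := :0) refl)
    }

  root conjugate : S.Carrier
  root      = 0# , 1#
  conjugate = x , - 1#

  root+conjugate≈x : root S.+ conjugate S.≈ (x , 0#)
  root+conjugate≈x = +-identityˡ x , -‿inverseʳ 1#

  root*conjugate≈1 : root S.* conjugate S.≈ S.1#
  root*conjugate≈1 =
    solve 1 (λ x → :0 :* x :- :1 :* (:- :1) := :1) refl x
    , solve 1 (λ x → :0 :* (:- :1) :+ :1 :* x :+ x :* (:1 :* (:- :1))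
                := :0) refl x

module _ {c ℓ : Level} (R : CommutativeRing c ℓ) {p : ℕ}
    (p-prime : Prime p) (p≈0 : p Annihilates R) where
  open CommutativeRing R
  open SemiringExp semiring using (_^_)
  open Frobenius R p-prime p≈0

  cosine-sum-p : ∀ {τ τ̄} → τ * τ̄ ≈ 1# → cosine R (τ + τ̄) p ≈ (τ + τ̄) ^ p
  cosine-sum-p {τ} {τ̄} ττ̄≈1 = trans (sym (power-sum R ττ̄≈1 p)) (sym (^p-+ τ τ̄))

module _ {c ℓ : Level} (R : CommutativeRing c ℓ) {p : ℕ}
    (p-prime : Prime p) (p≈0 : p Annihilates R) where
  open CommutativeRing R
  open SemiringExp semiring using (_^_)
  open IntegersIn R using (solve; _:=_; _:+_; _:-_; :2)
  open Frobenius R p-prime p≈0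
  private module F = IsRingRelation ^p-isRingRelation

  cosine-p≈^p : ∀ x → cosine R x p ≈ x ^ p
  cosine-p≈^p x = proj₁ (S.trans (S.sym cosine-embed)
    (S.trans (cosine-sum-p S′ p-prime (S.trans (E.fromℕ-rel p) (p≈0 , refl)) (root*conjugate≈1 R x)) (embed-^ p)))
    where
    S′ = adjoinUnit R x
    module S where
      open CommutativeRing S′ public
      open SemiringExp (CommutativeRing.semiring S′) public using (_^_)
    module E = IsRingRelation (embedding-isRingRelation R x)
    cosine-embed : cosine S′ (root R x S.+ conjugate R x) p S.≈ (cosine R x p , 0#)
    cosine-embed = recurrence-rel (embedding-isRingRelation R x) (E.+-rel E.1-rel E.1-rel)
      (root+conjugate≈x R x) (root+conjugate≈x R x) p
    embed-^ : ∀ n → (root R x S.+ conjugate R x) S.^ n S.≈ (x ^ n , 0#)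
    embed-^ zero    = S.refl
    embed-^ (suc n) = E.*-rel (root+conjugate≈x R x) (embed-^ n)

  multiple-p≈^p : ∀ q → multiple R q p ≈ q ^ p
  multiple-p≈^p q = trans (+-congˡ (trans (cosine-p≈^p (q - (1# + 1#)))
    (F.+-rel refl (trans (^p-neg (1# + 1#)) (-‿cong (F.+-rel F.1-rel F.1-rel))))))
    (solve 1 (λ y → :2 :+ (y :- :2) := y) refl (q ^ p))

module _ {c ℓ : Level} (R : CommutativeRing c ℓ) (m : CommutativeRing.Carrier R) where
  open CommutativeRing R

  quotient-isRingRelation : IsRingRelation R (quotientRing R m) _≈_
  quotient-isRingRelation = record
    { 0-rel = refl
    ; 1-rel = refl
    ; +-rel = +-cong
    ; *-rel = *-cong
    ; -‿rel = -‿cong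
    }

module _ {c ℓ : Level} (R : CommutativeRing c ℓ) where
  open CommutativeRing R
  open SemiringExp semiring using (_^_)
  open IntegersIn R using (fromℕ)
  open Evaluation R

  private
    congruence : ∀ h {p} → Prime p → ∀ x → ∃[ d ]
      ⟦ h ⟧ (multiple R x p) ≈ ⟦ h ⟧ x ^ p + fromℕ p * d
    congruence h {p} p-prime x = Q.trans
      (lift (⟦⟧-≈Q h (multiple-rel (quotient-isRingRelation R (fromℕ p)) refl p)))
      (Q.trans (Evaluation.⟦⟧-cong Q h (multiple-p≈^p Q p-prime p≈0 x))
      (Q.trans (Q.sym (IsRingRelation.⟦⟧-rel (Frobenius.^p-isRingRelation Q p-prime p≈0) h {x} Q.refl))
        (lift (sym (^-≈Q (⟦⟧-≈Q h refl) p)))))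
      where
      Q = quotientRing R (fromℕ p)
      module Q where
        open CommutativeRing Q public
        open SemiringExp (CommutativeRing.semiring Q) public using (_^_)
      open IsRingRelation (quotient-isRingRelation R (fromℕ p))
        renaming (fromℕ-rel to fromℕ-≈Q; ⟦⟧-rel to ⟦⟧-≈Q)
      lift : ∀ {a b} → a ≈ b → a Q.≈ b
      lift {a} {b} a≈b = 0# , trans a≈b (trans (sym (+-identityʳ b)) (+-congˡ (sym (zeroʳ _))))
      p≈0 : IntegersIn.fromℕ Q p Q.≈ 0#
      p≈0 = 1# , trans (sym (fromℕ-≈Q p)) (trans (sym (*-identityʳ _)) (sym (+-identityˡ _)))
      ^-≈Q : ∀ {a b} → a ≈ b → ∀ n → a ^ n ≈ b Q.^ n
      ^-≈Q a≈b zero    = refl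
      ^-≈Q a≈b (suc n) = *-cong a≈b (^-≈Q a≈b n)

  abstract
    multiple-frobenius : ∀ h {p} → Prime p → ∀ x → ∃[ d ]
      ⟦ h ⟧ (multiple R x p) ≈ ⟦ h ⟧ x ^ p + fromℕ p * d
    multiple-frobenius = congruence

module _ {a b ℓ₁ ℓ₂ r : Level} {A : CommutativeRing a ℓ₁} {B : CommutativeRing b ℓ₂}
    {_~_ : CommutativeRing.Carrier A → CommutativeRing.Carrier B → Set r}
    (isRingRelation : IsRingRelation A B _~_) where
  open IsRingRelation isRingRelation
  private
    module A where
      open CommutativeRing A public
      open SemiringExp (CommutativeRing.semiring A) public using (_^_)
    module B where
      open CommutativeRing B public
      open SemiringExp (CommutativeRing.semiring B) public using (_^_)

  ^-rel : ∀ {x u} → x ~ u → ∀ n → (x A.^ n) ~ (u B.^ n)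
  ^-rel x~u zero    = 1-rel
  ^-rel x~u (suc n) = *-rel x~u (^-rel x~u n)

  multiple-frobenius-rel : ∀ h {p} → Prime p → ∀ {x u} → x ~ u → ∀ {d e} → d ~ e →
    (∀ {x y u v} → x A.≈ y → x ~ u → y ~ v → u B.≈ v) →
    Evaluation.⟦_⟧ A h (multiple A x p) A.≈ Evaluation.⟦_⟧ A h x A.^ p A.+ IntegersIn.fromℕ A p A.* d →
    Evaluation.⟦_⟧ B h (multiple B u p) B.≈ Evaluation.⟦_⟧ B h u B.^ p B.+ IntegersIn.fromℕ B p B.* e
  multiple-frobenius-rel h {p} p-prime x~u d~e functional eq = functional eq
    (⟦⟧-rel h (multiple-rel isRingRelation x~u p))
    (+-rel (^-rel (⟦⟧-rel h x~u) p) (*-rel (fromℕ-rel p) d~e))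

module _ {c ℓ : Level} (R : CommutativeRing c ℓ) where
  open CommutativeRing R
  open SemiringExp semiring using (_^_)
  open IntegersIn R using (fromℕ)
  open Evaluation R

  evaluation-isRingRelation : ∀ t → IsRingRelation (exprRing R) R (λ e x → ⟦ e ⟧ t ≈ x)
  evaluation-isRingRelation t = record
    { 0-rel = refl
    ; 1-rel = IntegersIn.fromℕ-1 R
    ; +-rel = +-cong
    ; *-rel = *-cong
    ; -‿rel = -‿cong
    }

  multiple-frobenius-polynomial : ∀ h {p} → Prime p → ∃[ y ] ∀ t →
    ⟦ h ⟧ (multiple R t p) ≈ ⟦ h ⟧ t ^ p + fromℕ p * ⟦ y ⟧ t
  multiple-frobenius-polynomial h {p} p-prime with multiple-frobenius (exprRing R) h p-prime X
  ... | y , eq = y , λ t →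
    multiple-frobenius-rel (evaluation-isRingRelation t) h p-prime {X} {t} refl {y} {⟦ y ⟧ t} refl
      (λ a≈b a~u b~v → trans (sym a~u) (trans (a≈b t) b~v)) eq

module Chebyshev {c ℓ : Level} (R : CommutativeRing c ℓ) where
  open CommutativeRing R
  open IntegersIn R
  open SetoidReasoning setoid

  private
    2# 4# : Carrier
    2# = 1# + 1#
    4# = 2# + 2#

  recurrence-cong : ∀ {a b x a′ b′ x′} → a ≈ a′ → b ≈ b′ → x ≈ x′ →
    ∀ n → recurrence R a b x n ≈ recurrence R a′ b′ x′ n
  recurrence-cong p q r zero          = p
  recurrence-cong p q r (suc zero)    = q
  recurrence-cong p q r (suc (suc n)) =
    +-cong (*-cong r (recurrence-cong p q r (suc n))) (-‿cong (recurrence-cong p q r n))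

  cosine-cong : ∀ {x y} → x ≈ y → ∀ n → cosine R x n ≈ cosine R y n
  cosine-cong x≈y = recurrence-cong refl x≈y x≈y

  sine-cong : ∀ {x y} → x ≈ y → ∀ n → sine R x n ≈ sine R y n
  sine-cong = recurrence-cong refl refl

  multiple-cong : ∀ {x y} → x ≈ y → ∀ n → multiple R x n ≈ multiple R y n
  multiple-cong x≈y n = +-congˡ (cosine-cong (+-congʳ x≈y) n)

  module _ (u : Carrier) where
    private
      s w : ℕ → Carrier
      s = sine R u
      w = cosine R u

    cosine-*-recurrence : ∀ {a b} → let r = recurrence R a b u in
      ∀ j i → w j * r (j ℕ.+ i) ≈ r (j ℕ.+ (j ℕ.+ i)) + r i
    cosine-*-recurrence {a} {b} zero i = solve 1 (λ x → :2 :* x := x :+ x) refl _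
    cosine-*-recurrence {a} {b} (suc zero) i =
      solve 3 (λ u x y → u :* x := (u :* x :- y) :+ y) refl u _ (recurrence R a b u i)
    cosine-*-recurrence {a} {b} (suc (suc j)) i = begin
      (u * w (suc j) - w j) * r (suc (suc j) ℕ.+ i)
        ≈⟨ solve 4 (λ u x y z → (u :* x :- y) :* z := u :* (x :* z) :- y :* z) refl
             u (w (suc j)) (w j) (r (suc (suc j) ℕ.+ i)) ⟩
      u * (w (suc j) * r (suc (suc j) ℕ.+ i)) - w j * r (suc (suc j) ℕ.+ i)
        ≡⟨ ≡.cong₂ (λ x y → u * (w (suc j) * r x) - w j * r y) (≡.sym i₁) (≡.sym i₂) ⟩
      u * (w (suc j) * r (suc j ℕ.+ suc i)) - w j * r (j ℕ.+ suc (suc i))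
        ≈⟨ +-cong (*-congˡ (cosine-*-recurrence (suc j) (suc i))) (-‿cong (cosine-*-recurrence j (suc (suc i)))) ⟩
      u * (r (suc j ℕ.+ (suc j ℕ.+ suc i)) + r (suc i)) - (r (j ℕ.+ (j ℕ.+ suc (suc i))) + r (suc (suc i)))
        ≡⟨ ≡.cong₂ (λ x y → u * (r x + r (suc i)) - (r y + r (suc (suc i)))) i₃ i₄ ⟩
      u * (r (suc (suc (suc (j ℕ.+ (j ℕ.+ i))))) + r (suc i)) - (r (suc (suc (j ℕ.+ (j ℕ.+ i)))) + (u * r (suc i) - r i))
        ≈⟨ solve 5 (λ u x y z v → u :* (x :+ y) :- (z :+ (u :* y :- v)) := (u :* x :- z) :+ v) refl
             u (r (suc (suc (suc (j ℕ.+ (j ℕ.+ i)))))) (r (suc i)) (r (suc (suc (j ℕ.+ (j ℕ.+ i))))) (r i) ⟩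
      r (suc (suc (suc (suc (j ℕ.+ (j ℕ.+ i)))))) + r i
        ≡⟨ ≡.cong (λ x → r x + r i) (≡.sym i₅) ⟩
      r (suc (suc j) ℕ.+ (suc (suc j) ℕ.+ i)) + r i ∎
      where
      r = recurrence R a b u
      i₁ : suc j ℕ.+ suc i ≡ suc (suc j) ℕ.+ i
      i₁ = ≡.cong suc (ℕₚ.+-suc j i)
      i₂ : j ℕ.+ suc (suc i) ≡ suc (suc j) ℕ.+ i
      i₂ = ≡.trans (ℕₚ.+-suc j (suc i)) i₁
      i₄ : j ℕ.+ (j ℕ.+ suc (suc i)) ≡ suc (suc (j ℕ.+ (j ℕ.+ i)))
      i₄ = ≡.trans (≡.cong (j ℕ.+_) i₂)
        (≡.trans (ℕₚ.+-suc j (suc (j ℕ.+ i))) (≡.cong suc (ℕₚ.+-suc j (j ℕ.+ i))))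
      i₃ : suc j ℕ.+ (suc j ℕ.+ suc i) ≡ suc (suc (suc (j ℕ.+ (j ℕ.+ i))))
      i₃ = ≡.cong suc (≡.trans (≡.cong (j ℕ.+_) i₁)
        (≡.trans (ℕₚ.+-suc j (suc (j ℕ.+ i))) (≡.cong suc (ℕₚ.+-suc j (j ℕ.+ i)))))
      i₅ : suc (suc j) ℕ.+ (suc (suc j) ℕ.+ i) ≡ suc (suc (suc (suc (j ℕ.+ (j ℕ.+ i)))))
      i₅ = ≡.cong (λ x → suc (suc x)) (≡.trans (ℕₚ.+-suc j (suc (j ℕ.+ i))) (≡.cong suc (ℕₚ.+-suc j (j ℕ.+ i))))

    sine-invariant : ∀ k → s (suc k) * s (suc k) + s k * s k - u * (s (suc k) * s k) ≈ 1#
    sine-invariant zero = solve 1 (λ u → :1 :* :1 :+ :0 :* :0 :- u :* (:1 :* :0) := :1) refl u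
    sine-invariant (suc k) = trans
      (solve 3 (λ u x y → (u :* x :- y) :* (u :* x :- y) :+ x :* x :- u :* ((u :* x :- y) :* x)
          := x :* x :+ y :* y :- u :* (x :* y)) refl u (s (suc k)) (s k))
      (sine-invariant k)

    sine-+ : ∀ a b → s (a ℕ.+ suc b) ≈ s (suc a) * s (suc b) - s a * s b
    sine-+ zero b = solve 2 (λ x y → x := :1 :* x :- :0 :* y) refl (s (suc b)) (s b)
    sine-+ (suc zero) b = solve 3 (λ u x y → u :* x :- y := (u :* :1 :- :0) :* x :- :1 :* y) refl
      u (s (suc b)) (s b)
    sine-+ (suc (suc a)) b = trans (+-cong (*-congˡ (sine-+ (suc a) b)) (-‿cong (sine-+ a b)))
      (solve 5 (λ u p q x y → u :* ((u :* p :- q) :* x :- p :* y) :- (p :* x :- q :* y)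
          := (u :* (u :* p :- q) :- p) :* x :- (u :* p :- q) :* y) refl
        u (s (suc a)) (s a) (s (suc b)) (s b))

    cosine≈ : ∀ k → w k ≈ 2# * s (suc k) - u * s k
    cosine≈ zero = solve 1 (λ u → :1 :+ :1 := :2 :* :1 :- u :* :0) refl u
    cosine≈ (suc zero) = solve 1 (λ u → u := :2 :* (u :* :1 :- :0) :- u :* :1) refl u
    cosine≈ (suc (suc k)) = trans (+-cong (*-congˡ (cosine≈ (suc k))) (-‿cong (cosine≈ k)))
      (solve 3 (λ u x y → u :* (:2 :* (u :* x :- y) :- u :* x) :- (:2 :* x :- u :* y)
          := :2 :* (u :* (u :* x :- y) :- x) :- u :* (u :* x :- y)) refl u (s (suc k)) (s k))

    4-cosine² : ∀ k → 4# - w k * w k ≈ (4# - u * u) * (s k * s k)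
    4-cosine² k = begin
      4# - w k * w k
        ≈⟨ +-cong (sym (*-identityʳ 4#)) (-‿cong (*-cong (cosine≈ k) (cosine≈ k))) ⟩
      4# * 1# - (2# * s (suc k) - u * s k) * (2# * s (suc k) - u * s k)
        ≈⟨ +-congʳ (*-congˡ (sine-invariant k)) ⟨
      4# * (s (suc k) * s (suc k) + s k * s k - u * (s (suc k) * s k))
        - (2# * s (suc k) - u * s k) * (2# * s (suc k) - u * s k)
        ≈⟨ solve 3 (λ u x y → (:2 :+ :2) :* (x :* x :+ y :* y :- u :* (x :* y)) :- (:2 :* x :- u :* y) :* (:2 :* x :- u :* y)
             := ((:2 :+ :2) :- u :* u) :* (y :* y)) refl u (s (suc k)) (s k) ⟩
      (4# - u * u) * (s k * s k) ∎

    sine-*-cosine : ∀ j k → sine R (w j) k * s j ≈ s (k ℕ.* j)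
    sine-*-cosine j zero = zeroˡ _
    sine-*-cosine j (suc zero) = trans (*-identityˡ _) (reflexive (≡.cong s (≡.sym (ℕₚ.+-identityʳ j))))
    sine-*-cosine j (suc (suc k)) = begin
      (w j * sine R (w j) (suc k) - sine R (w j) k) * s j
        ≈⟨ solve 4 (λ w x y z → (w :* x :- y) :* z := w :* (x :* z) :- y :* z) refl
             (w j) (sine R (w j) (suc k)) (sine R (w j) k) (s j) ⟩
      w j * (sine R (w j) (suc k) * s j) - sine R (w j) k * s j
        ≈⟨ +-cong (*-congˡ (sine-*-cosine j (suc k))) (-‿cong (sine-*-cosine j k)) ⟩
      w j * s (j ℕ.+ k ℕ.* j) - s (k ℕ.* j)
        ≈⟨ +-congʳ (cosine-*-recurrence j (k ℕ.* j)) ⟩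
      (s (j ℕ.+ (j ℕ.+ k ℕ.* j)) + s (k ℕ.* j)) - s (k ℕ.* j)
        ≈⟨ solve 2 (λ x y → (x :+ y) :- y := x) refl _ _ ⟩
      s (j ℕ.+ (j ℕ.+ k ℕ.* j)) ∎

    cosine-cosine : ∀ j k → cosine R (w j) k ≈ w (k ℕ.* j)
    cosine-cosine j zero = refl
    cosine-cosine j (suc zero) = reflexive (≡.cong w (≡.sym (ℕₚ.+-identityʳ j)))
    cosine-cosine j (suc (suc k)) = begin
      w j * cosine R (w j) (suc k) - cosine R (w j) k
        ≈⟨ +-cong (*-congˡ (cosine-cosine j (suc k))) (-‿cong (cosine-cosine j k)) ⟩
      w j * w (j ℕ.+ k ℕ.* j) - w (k ℕ.* j)
        ≈⟨ +-congʳ (cosine-*-recurrence j (k ℕ.* j)) ⟩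
      (w (j ℕ.+ (j ℕ.+ k ℕ.* j)) + w (k ℕ.* j)) - w (k ℕ.* j)
        ≈⟨ solve 2 (λ x y → (x :+ y) :- y := x) refl _ _ ⟩
      w (j ℕ.+ (j ℕ.+ k ℕ.* j)) ∎

    sine²-sine² : ∀ d b → s (d ℕ.+ b) * s (d ℕ.+ b) - s b * s b ≈ s (d ℕ.+ (b ℕ.+ b)) * s d
    sine²-sine² d zero rewrite ℕₚ.+-identityʳ d =
      solve 1 (λ x → x :* x :- :0 :* :0 := x :* x) refl (s d)
    sine²-sine² d (suc b) = begin
      s (d ℕ.+ suc b) * s (d ℕ.+ suc b) - B′ * B′
        ≈⟨ +-cong (*-cong (sine-+ d b) (sine-+ d b)) (-‿cong (sym (*-identityʳ _))) ⟩
      (D′ * B′ - D * B) * (D′ * B′ - D * B) - B′ * B′ * 1#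
        ≈⟨ +-congˡ (-‿cong (*-congˡ (sine-invariant d))) ⟨
      (D′ * B′ - D * B) * (D′ * B′ - D * B) - B′ * B′ * (D′ * D′ + D * D - u * (D′ * D))
        ≈⟨ solve 5 (λ u p q x y →
             (p :* x :- q :* y) :* (p :* x :- q :* y) :- x :* x :* (p :* p :+ q :* q :- u :* (p :* q))
             := (p :* ((u :* x :- y) :* x :- x :* y) :- q :* (x :* x :- y :* y)) :* q) refl u D′ D B′ B ⟩
      (D′ * (s (suc (suc b)) * B′ - B′ * B) - D * (B′ * B′ - B * B)) * D
        ≈⟨ *-congʳ (+-cong (*-congˡ (sine-+ (suc b) b)) (-‿cong (*-congˡ (sine-+ b b)))) ⟨
      (D′ * s (suc b ℕ.+ suc b) - D * s (b ℕ.+ suc b)) * D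
        ≈⟨ *-congʳ (sine-+ d (b ℕ.+ suc b)) ⟨
      s (d ℕ.+ suc (b ℕ.+ suc b)) * D ∎
      where
      D′ = s (suc d)
      D  = s d
      B′ = s (suc b)
      B  = s b

    cosine²-cosine² : ∀ d b →
      w b * w b - w (d ℕ.+ b) * w (d ℕ.+ b) ≈ (4# - u * u) * (s (d ℕ.+ (b ℕ.+ b)) * s d)
    cosine²-cosine² d b = begin
      w b * w b - w (d ℕ.+ b) * w (d ℕ.+ b)
        ≈⟨ solve 3 (λ f x y → y :- x := (f :- x) :- (f :- y)) refl 4# (w (d ℕ.+ b) * w (d ℕ.+ b)) (w b * w b) ⟩
      (4# - w (d ℕ.+ b) * w (d ℕ.+ b)) - (4# - w b * w b)
        ≈⟨ +-cong (4-cosine² (d ℕ.+ b)) (-‿cong (4-cosine² b)) ⟩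
      (4# - u * u) * (s (d ℕ.+ b) * s (d ℕ.+ b)) - (4# - u * u) * (s b * s b)
        ≈⟨ solve 3 (λ f x y → f :* x :- f :* y := f :* (x :- y)) refl (4# - u * u) _ _ ⟩
      (4# - u * u) * (s (d ℕ.+ b) * s (d ℕ.+ b) - s b * s b)
        ≈⟨ *-congˡ (sine²-sine² d b) ⟩
      (4# - u * u) * (s (d ℕ.+ (b ℕ.+ b)) * s d) ∎

    multiple≈cosine² : ∀ k → multiple R (u * u) k ≈ w k * w k
    multiple≈cosine² k = begin
      2# + cosine R (w 2) k        ≈⟨ +-congˡ (cosine-cosine 2 k) ⟩
      2# + w (k ℕ.* 2)             ≡⟨ ≡.cong (λ i → 2# + w i) (ℕₚ.*-comm k 2) ⟩
      2# + w (k ℕ.+ (k ℕ.+ 0))     ≈⟨ +-comm _ _ ⟩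
      w (k ℕ.+ (k ℕ.+ 0)) + w 0    ≈⟨ cosine-*-recurrence k 0 ⟨
      w k * w (k ℕ.+ 0)            ≡⟨ ≡.cong (λ i → w k * w i) (ℕₚ.+-identityʳ k) ⟩
      w k * w k                    ∎

  multiple-multiple : ∀ q j k → multiple R (multiple R q j) k ≈ multiple R q (k ℕ.* j)
  multiple-multiple q j k = +-congˡ (trans
    (cosine-cong (solve 2 (λ t x → (t :+ x) :- t := x) refl 2# (cosine R (q - 2#) j)) k)
    (cosine-cosine (q - 2#) j k))

  sine-neg : ∀ u k → sine R (- u) k * sine R (- u) k ≈ sine R u k * sine R u k
  sine-neg u k = trans (*-cong (signed k) (signed k)) (trans
    (solve 2 (λ a b → (a :* b) :* (a :* b) := (a :* a) :* (b :* b)) refl (sign k) (sine R u k))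
    (trans (*-congʳ (sign² k)) (*-identityˡ _)))
    where
    sign : ℕ → Carrier
    sign zero    = - 1#
    sign (suc k) = - sign k
    sign² : ∀ k → sign k * sign k ≈ 1#
    sign² zero    = solve 0 ((:- :1) :* (:- :1) := :1) refl
    sign² (suc k) = trans (solve 1 (λ x → (:- x) :* (:- x) := x :* x) refl (sign k)) (sign² k)
    signed : ∀ k → sine R (- u) k ≈ sign k * sine R u k
    signed zero = sym (zeroʳ _)
    signed (suc zero) = solve 0 (:1 := (:- (:- :1)) :* :1) refl
    signed (suc (suc k)) = trans (+-cong (*-congˡ (signed (suc k))) (-‿cong (signed k)))
      (solve 4 (λ u e x y → (:- u) :* ((:- e) :* x) :- e :* y := (:- (:- e)) :* (u :* x :- y)) refl
        u (sign k) (sine R u (suc k)) (sine R u k))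

module FieldProperties {c ℓ : Level} (F : Field c ℓ) where
  open Field F
  open IntegersIn commutativeRing using (solve; _:=_; _:+_; _:*_; _:-_; :-_)

  *-cancel-≉0 : ∀ {x y} → x ≉ 0# → x * y ≈ 0# → y ≈ 0#
  *-cancel-≉0 {x} {y} x≉0 xy≈0 = begin
    y                   ≈⟨ *-identityˡ y ⟨
    1# * y              ≈⟨ *-congʳ (⁻¹-inverse x≉0) ⟨
    x * x ⁻¹ * y        ≈⟨ solve 3 (λ x i y → x :* i :* y := i :* (x :* y)) refl x (x ⁻¹) y ⟩
    x ⁻¹ * (x * y)      ≈⟨ *-congˡ xy≈0 ⟩
    x ⁻¹ * 0#           ≈⟨ zeroʳ _ ⟩
    0#                  ∎
    where open SetoidReasoning setoid

  *-≉0 : ∀ {x y} → x ≉ 0# → y ≉ 0# → x * y ≉ 0#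
  *-≉0 x≉0 y≉0 xy≈0 = y≉0 (*-cancel-≉0 x≉0 xy≈0)

  *≈0⇒≈0⊎≈0 : ∀ {x y} → x * y ≈ 0# → x ≈ 0# ⊎ y ≈ 0#
  *≈0⇒≈0⊎≈0 {x} xy≈0 with x ≟ 0#
  ... | yes x≈0 = inj₁ x≈0
  ... | no  x≉0 = inj₂ (*-cancel-≉0 x≉0 xy≈0)

  x²≈0⇒x≈0 : ∀ {x} → x * x ≈ 0# → x ≈ 0#
  x²≈0⇒x≈0 x²≈0 with *≈0⇒≈0⊎≈0 x²≈0
  ... | inj₁ x≈0 = x≈0
  ... | inj₂ x≈0 = x≈0

  x-y≈0⇒x≈y : ∀ {x y} → x - y ≈ 0# → x ≈ y
  x-y≈0⇒x≈y {x} {y} x-y≈0 = trans (solve 2 (λ x y → x := (x :- y) :+ y) refl x y)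
    (trans (+-congʳ x-y≈0) (+-identityˡ y))

  x≈y⇒x-y≈0 : ∀ {x y} → x ≈ y → x - y ≈ 0#
  x≈y⇒x-y≈0 x≈y = trans (+-congʳ x≈y) (-‿inverseʳ _)

  *-cancelˡ-≉0 : ∀ {x y z} → x ≉ 0# → x * y ≈ x * z → y ≈ z
  *-cancelˡ-≉0 {x} {y} {z} x≉0 xy≈xz = x-y≈0⇒x≈y (*-cancel-≉0 x≉0
    (trans (solve 3 (λ x y z → x :* (y :- z) := x :* y :- x :* z) refl x y z) (x≈y⇒x-y≈0 xy≈xz)))

  x²≈y²⇒x≈±y : ∀ {x y} → x * x ≈ y * y → x ≈ y ⊎ x ≈ - y
  x²≈y²⇒x≈±y {x} {y} x²≈y² with *≈0⇒≈0⊎≈0 (trans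
    (solve 2 (λ x y → (x :- y) :* (x :- (:- y)) := x :* x :- y :* y) refl x y) (x≈y⇒x-y≈0 x²≈y²))
  ... | inj₁ x-y≈0 = inj₁ (x-y≈0⇒x≈y x-y≈0)
  ... | inj₂ x+y≈0 = inj₂ (x-y≈0⇒x≈y x+y≈0)

module OrderedField {c ℓ₁ ℓ₂ : Level} (ℝ : RealField c ℓ₁ ℓ₂) where
  open RealField ℝ hiding (zero; fromℤ)
  open FieldProperties underlyingField
  open IntegersIn commutativeRing
    using (fromℤ; solve; _:=_; _:+_; _:*_; _:-_; :-_; :0; :1; :2)
  open IsStrictTotalOrder isStrictTotalOrder using (irrefl)
    renaming (trans to <-trans; <-respˡ-≈ to <-respˡ; <-respʳ-≈ to <-respʳ)

  Pos NonNeg : Carrier → Set _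
  Pos x    = 0# < x
  NonNeg x = ¬ Pos (- x)

  <⇒Pos : ∀ {x y} → x < y → Pos (y - x)
  <⇒Pos {x} x<y = <-respˡ (-‿inverseʳ x) (+-monoˡ-< (- x) x<y)

  Pos⇒< : ∀ {x y} → Pos (y - x) → x < y
  Pos⇒< {x} {y} p = <-respˡ (+-identityˡ x)
    (<-respʳ (solve 2 (λ x y → (y :- x) :+ x := y) refl x y) (+-monoˡ-< x p))

  pos-cong : ∀ {x y} → x ≈ y → Pos x → Pos y
  pos-cong = <-respʳ

  pos⇒≉0 : ∀ {x} → Pos x → x ≉ 0#
  pos⇒≉0 p x≈0 = irrefl (sym x≈0) p

  data Sign (x : Carrier) : Set (ℓ₁ ⊔ ℓ₂) where
    isPos  : Pos x → Sign x
    isZero : x ≈ 0# → Sign x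
    isNeg  : Pos (- x) → Sign x

  sign : ∀ x → Sign x
  sign x with compare x 0#
  ... | tri< x<0 _ _ = isNeg (<-respʳ (+-identityˡ _) (<⇒Pos x<0))
  ... | tri≈ _ x≈0 _ = isZero x≈0
  ... | tri> _ _ 0<x = isPos 0<x

  pos-+ : ∀ {x y} → Pos x → Pos y → Pos (x + y)
  pos-+ {x} {y} p q = <-trans q (<-respˡ (+-identityˡ y) (+-monoˡ-< y p))

  pos⇒¬neg : ∀ {x} → Pos x → ¬ Pos (- x)
  pos⇒¬neg p q = irrefl refl (<-respʳ (-‿inverseʳ _) (pos-+ p q))

  pos⇒nonNeg : ∀ {x} → Pos x → NonNeg x
  pos⇒nonNeg = pos⇒¬neg

  nonNeg-cong : ∀ {x y} → x ≈ y → NonNeg x → NonNeg y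
  nonNeg-cong x≈y n p = n (pos-cong (-‿cong (sym x≈y)) p)

  ≈0⇒nonNeg : ∀ {x} → x ≈ 0# → NonNeg x
  ≈0⇒nonNeg x≈0 p = pos⇒≉0 p (trans (-‿cong x≈0) (solve 0 (:- :0 := :0) refl))

  nonNeg⇒pos⊎≈0 : ∀ {x} → NonNeg x → Pos x ⊎ x ≈ 0#
  nonNeg⇒pos⊎≈0 {x} n with sign x
  ... | isPos p  = inj₁ p
  ... | isZero z = inj₂ z
  ... | isNeg p  = contradiction p n

  ¬pos⇒nonNeg-neg : ∀ {x} → ¬ Pos x → NonNeg (- x)
  ¬pos⇒nonNeg-neg {x} n p = n (pos-cong (solve 1 (λ x → :- (:- x) := x) refl x) p)

  pos-+-nonNeg : ∀ {x y} → Pos x → NonNeg y → Pos (x + y)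
  pos-+-nonNeg p n with nonNeg⇒pos⊎≈0 n
  ... | inj₁ q   = pos-+ p q
  ... | inj₂ y≈0 = pos-cong (sym (trans (+-congˡ y≈0) (+-identityʳ _))) p

  nonNeg-+ : ∀ {x y} → NonNeg x → NonNeg y → NonNeg (x + y)
  nonNeg-+ {x} {y} m n with nonNeg⇒pos⊎≈0 m
  ... | inj₁ p   = pos⇒nonNeg (pos-+-nonNeg p n)
  ... | inj₂ x≈0 = nonNeg-cong (sym (trans (+-congʳ x≈0) (+-identityˡ y))) n

  nonNeg-* : ∀ {x y} → NonNeg x → NonNeg y → NonNeg (x * y)
  nonNeg-* {x} {y} m n with nonNeg⇒pos⊎≈0 m | nonNeg⇒pos⊎≈0 n
  ... | inj₁ p   | inj₁ q   = pos⇒nonNeg (*-pos p q)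
  ... | inj₂ x≈0 | _        = ≈0⇒nonNeg (trans (*-congʳ x≈0) (zeroˡ y))
  ... | _        | inj₂ y≈0 = ≈0⇒nonNeg (trans (*-congˡ y≈0) (zeroʳ x))

  pos-cancel : ∀ {x y} → Pos x → Pos (x * y) → Pos y
  pos-cancel {x} {y} p q with sign y
  ... | isPos r  = r
  ... | isZero z = contradiction (trans (*-congˡ z) (zeroʳ x)) (pos⇒≉0 q)
  ... | isNeg r  = contradiction
    (pos-cong (solve 2 (λ x y → x :* (:- y) := :- (x :* y)) refl x y) (*-pos p r)) (pos⇒¬neg q)

  nonNeg-cancel : ∀ {x y} → Pos x → NonNeg (x * y) → NonNeg y
  nonNeg-cancel {x} {y} p n r = n (pos-cong (solve 2 (λ x y → x :* (:- y) := :- (x :* y)) refl x y) (*-pos p r))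

  square-pos : ∀ {x} → x ≉ 0# → Pos (x * x)
  square-pos {x} x≉0 with sign x
  ... | isPos p  = *-pos p p
  ... | isZero z = contradiction z x≉0
  ... | isNeg p  = pos-cong (solve 1 (λ x → (:- x) :* (:- x) := x :* x) refl x) (*-pos p p)

  square-nonNeg : ∀ x → NonNeg (x * x)
  square-nonNeg x with x ≟ 0#
  ... | yes x≈0 = ≈0⇒nonNeg (trans (*-congˡ x≈0) (zeroʳ x))
  ... | no  x≉0 = pos⇒nonNeg (square-pos x≉0)

  1-pos : Pos 1#
  1-pos = pos-cong (*-identityˡ 1#) (square-pos 1≉0)

  ⁻¹-pos : ∀ {x} → Pos x → Pos (x ⁻¹)
  ⁻¹-pos p = pos-cancel p (pos-cong (sym (⁻¹-inverse (pos⇒≉0 p))) 1-pos)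

  fromℕ-pos : ∀ n → Pos (fromℕ (suc n))
  fromℕ-nonNeg : ∀ n → NonNeg (fromℕ n)
  fromℕ-pos n = pos-+-nonNeg 1-pos (fromℕ-nonNeg n)
  fromℕ-nonNeg zero    = ≈0⇒nonNeg refl
  fromℕ-nonNeg (suc n) = pos⇒nonNeg (fromℕ-pos n)

  fromℤ≈0⇒≡0 : ∀ i → fromℤ i ≈ 0# → i ≡ + 0
  fromℤ≈0⇒≡0 (+ zero)  _  = ≡.refl
  fromℤ≈0⇒≡0 (+ suc n) eq = contradiction eq (pos⇒≉0 (fromℕ-pos n))
  fromℤ≈0⇒≡0 -[1+ n ]  eq = contradiction
    (trans (solve 1 (λ x → x := :- (:- x)) refl (fromℕ (suc n))) (trans (-‿cong eq)
      (solve 0 (:- :0 := :0) refl))) (pos⇒≉0 (fromℕ-pos n))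

  Bounded : Carrier → Carrier → Set ℓ₂
  Bounded ε y = NonNeg (ε - y) × NonNeg (ε + y)

  bounded-cong : ∀ {ε x y} → x ≈ y → Bounded ε x → Bounded ε y
  bounded-cong x≈y (p , n) = nonNeg-cong (+-congˡ (-‿cong x≈y)) p , nonNeg-cong (+-congˡ x≈y) n

  bounded-≤ : ∀ {ε δ y} → NonNeg (δ - ε) → Bounded ε y → Bounded δ y
  bounded-≤ {ε} {δ} {y} m (p , n) =
    nonNeg-cong (solve 3 (λ d e y → (d :- e) :+ (e :- y) := d :- y) refl δ ε y) (nonNeg-+ m p)
    , nonNeg-cong (solve 3 (λ d e y → (d :- e) :+ (e :+ y) := d :+ y) refl δ ε y) (nonNeg-+ m n)

  bounded-+ : ∀ {ε δ x y} → Bounded ε x → Bounded δ y → Bounded (ε + δ) (x + y)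
  bounded-+ {ε} {δ} {x} {y} (p , n) (p′ , n′) =
    nonNeg-cong (solve 4 (λ e d x y → (e :- x) :+ (d :- y) := (e :+ d) :- (x :+ y)) refl ε δ x y) (nonNeg-+ p p′)
    , nonNeg-cong (solve 4 (λ e d x y → (e :+ x) :+ (d :+ y) := (e :+ d) :+ (x :+ y)) refl ε δ x y) (nonNeg-+ n n′)

  bounded-neg : ∀ {ε x} → Bounded ε x → Bounded ε (- x)
  bounded-neg {ε} {x} (p , n) =
    nonNeg-cong (solve 2 (λ e x → e :+ x := e :- (:- x)) refl ε x) n , p

  -- (ε − x)(δ + y) + (ε + x)(δ − y) = 2 (εδ − xy)
  bounded-* : ∀ {ε δ x y} → Bounded ε x → Bounded δ y → Bounded (ε * δ) (x * y)
  bounded-* {ε} {δ} {x} {y} (p , n) (p′ , n′) =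
    nonNeg-cancel 2-pos (nonNeg-cong
      (solve 4 (λ e d x y → (e :- x) :* (d :+ y) :+ (e :+ x) :* (d :- y)
          := :2 :* (e :* d :- x :* y)) refl ε δ x y)
      (nonNeg-+ (nonNeg-* p n′) (nonNeg-* n p′)))
    , nonNeg-cancel 2-pos (nonNeg-cong
      (solve 4 (λ e d x y → (e :+ x) :* (d :+ y) :+ (e :- x) :* (d :- y)
          := :2 :* (e :* d :+ x :* y)) refl ε δ x y)
      (nonNeg-+ (nonNeg-* n n′) (nonNeg-* p p′)))
    where
    2-pos : Pos (1# + 1#)
    2-pos = pos-+ 1-pos 1-pos

  bounded-self : ∀ {x} → NonNeg x → Bounded x x
  bounded-self {x} n = ≈0⇒nonNeg (-‿inverseʳ x) , nonNeg-+ n n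

  boundOf : ∀ x → ∃[ ε ] Pos ε × Bounded ε x
  boundOf x with sign x
  ... | isPos p  = x , p , bounded-self (pos⇒nonNeg p)
  ... | isZero z = 1# , 1-pos , bounded-cong (sym z)
    (nonNeg-cong (solve 0 (:1 := :1 :- :0) refl) (pos⇒nonNeg 1-pos)
    , nonNeg-cong (sym (+-identityʳ 1#)) (pos⇒nonNeg 1-pos))
  ... | isNeg p  = - x , p , bounded-cong (solve 1 (λ x → :- (:- x) := x) refl x)
    (bounded-neg (bounded-self (pos⇒nonNeg p)))

  bounded<1⇒≡0 : ∀ i {ε} → Bounded ε (fromℤ i) → Pos (1# - ε) → i ≡ + 0
  bounded<1⇒≡0 (+ zero) _ _ = ≡.refl
  bounded<1⇒≡0 (+ suc n) {ε} (p , _) q = contradiction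
    (pos-cong (solve 2 (λ e n → (:1 :- e) :+ n := :- (e :- (:1 :+ n))) refl ε (fromℕ n))
      (pos-+-nonNeg q (fromℕ-nonNeg n))) p
  bounded<1⇒≡0 -[1+ n ] {ε} (_ , p) q = contradiction
    (pos-cong (solve 2 (λ e n → (:1 :- e) :+ n := :- (e :+ (:- (:1 :+ n)))) refl ε (fromℕ n))
      (pos-+-nonNeg q (fromℕ-nonNeg n))) p

-- Continuants with entries u m: for a path (m₀, …, mₖ), listed last entry
-- first, and u = √ q, they satisfy c(q, 𝐦) = numerator / (u · denominator) and
-- |denominator| = w_q(𝐦).
module _ {c ℓ₁ ℓ₂ : Level} (ℝ : RealField c ℓ₁ ℓ₂) where
  open RealField ℝ
  open IntegersIn commutativeRing using () renaming (fromℤ to fromInt)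

  numerator denominator : Carrier → List ℤ → Carrier
  numerator   u []       = 1#
  numerator   u (m ∷ ms) = fromInt m * u * numerator u ms + denominator u ms
  denominator u []       = 0#
  denominator u (m ∷ ms) = numerator u ms

module Ladders {c ℓ₁ ℓ₂ : Level} (ℝ : RealField c ℓ₁ ℓ₂) (u : RealField.Carrier ℝ) where
  open RealField ℝ hiding (zero; fromℤ)
  open FieldProperties underlyingField
  open OrderedField ℝ
  open IntegersIn commutativeRing
    using (fromℤ; fromℤ-neg; solve; _:=_; _:+_; _:*_; _:-_; :-_; :0; :1; :2)

  Matrix : Set c
  Matrix = Carrier × Carrier × Carrier × Carrier

  topLeft topRight bottomLeft bottomRight : Matrix → Carrier
  topLeft     (p , q , r , s) = p
  topRight    (p , q , r , s) = q
  bottomLeft  (p , q , r , s) = r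
  bottomRight (p , q , r , s) = s

  _≋_ : Matrix → Matrix → Set ℓ₁
  (p , q , r , s) ≋ (p′ , q′ , r′ , s′) = p ≈ p′ × q ≈ q′ × r ≈ r′ × s ≈ s′

  -- U = (u −1 ; 1 0) and its inverse generate, together with S = (0 −1 ; 1 0),
  -- the group of T = (1 u ; 0 1) = U S⁻¹ and S.
  U· U⁻¹· : Matrix → Matrix
  U·   (p , q , r , s) = u * p - r , u * q - s , p , q
  U⁻¹· (p , q , r , s) = r , s , u * r - p , u * s - q

  S -S : Matrix
  S  = 0# , - 1# , 1# , 0#
  -S = 0# , 1# , - 1# , 0#

  -- Nonnegative matrices B such that the U B are again of this kind, until
  -- they reach S; for u = 2 cos (π / n), these are B = − Uᵏ S with 0 < k < n.
  record Ladder : Set (Level.suc Level.zero ⊔ c ⊔ ℓ₁ ⊔ ℓ₂) where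
    field
      I      : Set
      matrix : I → Matrix
      a-pos    : ∀ i → Pos (topLeft (matrix i))
      b-nonNeg : ∀ i → NonNeg (topRight (matrix i))
      c-nonNeg : ∀ i → NonNeg (bottomLeft (matrix i))
      d-pos    : ∀ i → Pos (bottomRight (matrix i))
      b≈0⇒d≈1  : ∀ i → topRight (matrix i) ≈ 0# → bottomRight (matrix i) ≈ 1#
      c≈0⇒a≈1  : ∀ i → bottomLeft (matrix i) ≈ 0# → topLeft (matrix i) ≈ 1#
      up       : ∀ i → (∃[ j ] U· (matrix i) ≋ matrix j) ⊎ U· (matrix i) ≋ S
      down     : ∀ i → (∃[ j ] U⁻¹· (matrix i) ≋ matrix j) ⊎ U⁻¹· (matrix i) ≋ -S
      firstRung : ∃[ i ] matrix i ≋ (1# , u , 0# , 1#)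
      lastRung  : ∃[ i ] matrix i ≋ (1# , 0# , u , 1#)

  module Orbits (ladder : Ladder) where
    open Ladder ladder

    private
      a b′ c′ d : I → Carrier
      a i  = topLeft (matrix i)
      b′ i = topRight (matrix i)
      c′ i = bottomLeft (matrix i)
      d i  = bottomRight (matrix i)

    data Cone : Carrier → Carrier → Set (c ⊔ ℓ₁) where
      e₁   : ∀ {x y} → x ≈ 1# → y ≈ 0# → Cone x y
      e₂   : ∀ {x y} → x ≈ 0# → y ≈ 1# → Cone x y
      step : ∀ {x y x′ y′} i → Cone x y →
        x′ ≈ a i * x + b′ i * y → y′ ≈ c′ i * x + d i * y → Cone x′ y′

    cone-cong : ∀ {x y x′ y′} → x ≈ x′ → y ≈ y′ → Cone x y → Cone x′ y′
    cone-cong p q (e₁ r s)       = e₁ (trans (sym p) r) (trans (sym q) s)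
    cone-cong p q (e₂ r s)       = e₂ (trans (sym p) r) (trans (sym q) s)
    cone-cong p q (step i v r s) = step i v (trans (sym p) r) (trans (sym q) s)

    cone-nonNeg : ∀ {x y} → Cone x y → NonNeg x × NonNeg y
    cone-nonNeg (e₁ p q) = nonNeg-cong (sym p) (pos⇒nonNeg 1-pos) , ≈0⇒nonNeg q
    cone-nonNeg (e₂ p q) = ≈0⇒nonNeg p , nonNeg-cong (sym q) (pos⇒nonNeg 1-pos)
    cone-nonNeg (step i v p q) with cone-nonNeg v
    ... | m , n =
      nonNeg-cong (sym p) (nonNeg-+ (nonNeg-* (pos⇒nonNeg (a-pos i)) m) (nonNeg-* (b-nonNeg i) n))
      , nonNeg-cong (sym q) (nonNeg-+ (nonNeg-* (c-nonNeg i) m) (nonNeg-* (pos⇒nonNeg (d-pos i)) n))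

    private
      +≈0 : ∀ {x y} → NonNeg x → NonNeg y → x + y ≈ 0# → x ≈ 0# × y ≈ 0#
      +≈0 {x} {y} m n eq with nonNeg⇒pos⊎≈0 m | nonNeg⇒pos⊎≈0 n
      ... | inj₁ p   | _        = contradiction eq (pos⇒≉0 (pos-+-nonNeg p n))
      ... | inj₂ _   | inj₁ p   = contradiction (trans (+-comm y x) eq) (pos⇒≉0 (pos-+-nonNeg p m))
      ... | inj₂ x≈0 | inj₂ y≈0 = x≈0 , y≈0

    cone-axes : ∀ {x y} → Cone x y → (y ≈ 0# → x ≈ 1#) × (x ≈ 0# → y ≈ 1#)
    cone-axes (e₁ p q) = (λ _ → p) , λ x≈0 → contradiction (trans (sym p) x≈0) 1≉0
    cone-axes (e₂ p q) = (λ y≈0 → contradiction (trans (sym q) y≈0) 1≉0) , λ _ → q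
    cone-axes (step {x} {y} i v p q) with cone-axes v | cone-nonNeg v
    ... | onX , onY | m , n = horizontal , vertical
      where
      horizontal : _ ≈ 0# → _ ≈ 1#
      horizontal y′≈0 with +≈0 (nonNeg-* (c-nonNeg i) m) (nonNeg-* (pos⇒nonNeg (d-pos i)) n) (trans (sym q) y′≈0)
      ... | cx≈0 , dy≈0 = trans p (trans
          (+-cong (trans (*-cong (c≈0⇒a≈1 i c≈0) x≈1) (*-identityˡ 1#)) (trans (*-congˡ y≈0) (zeroʳ _)))
          (+-identityʳ 1#))
        where
        y≈0 = *-cancel-≉0 (pos⇒≉0 (d-pos i)) dy≈0
        x≈1 = onX y≈0
        c≈0 : c′ i ≈ 0#
        c≈0 = trans (sym (*-identityʳ _)) (trans (*-congˡ (sym x≈1)) cx≈0)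
      vertical : _ ≈ 0# → _ ≈ 1#
      vertical x′≈0 with +≈0 (nonNeg-* (pos⇒nonNeg (a-pos i)) m) (nonNeg-* (b-nonNeg i) n) (trans (sym p) x′≈0)
      ... | ax≈0 , by≈0 = trans q (trans
          (+-cong (trans (*-congˡ x≈0) (zeroʳ _)) (trans (*-cong (b≈0⇒d≈1 i b≈0) y≈1) (*-identityˡ 1#)))
          (+-identityˡ 1#))
        where
        x≈0 = *-cancel-≉0 (pos⇒≉0 (a-pos i)) ax≈0
        y≈1 = onY x≈0
        b≈0 : b′ i ≈ 0#
        b≈0 = trans (sym (*-identityʳ _)) (trans (*-congˡ (sym y≈1)) by≈0)

    -- The vectors v such that one of ± v, ± S⁻¹ v is in the cone.
    data Orbit (x y : Carrier) : Set (c ⊔ ℓ₁) where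
      plain   : Cone x y → Orbit x y
      minus   : Cone (- x) (- y) → Orbit x y
      turned  : Cone y (- x) → Orbit x y
      turned⁻ : Cone (- y) x → Orbit x y

    orbit-cong : ∀ {x y x′ y′} → x ≈ x′ → y ≈ y′ → Orbit x y → Orbit x′ y′
    orbit-cong p q (plain v)   = plain (cone-cong p q v)
    orbit-cong p q (minus v)   = minus (cone-cong (-‿cong p) (-‿cong q) v)
    orbit-cong p q (turned v)  = turned (cone-cong q (-‿cong p) v)
    orbit-cong p q (turned⁻ v) = turned⁻ (cone-cong (-‿cong q) p v)

    private
      neg-neg : ∀ x → x ≈ - (- x)
      neg-neg x = solve 1 (λ x → x := :- (:- x)) refl x

    orbit-neg : ∀ {x y} → Orbit x y → Orbit (- x) (- y)
    orbit-neg (plain v)   = minus (cone-cong (neg-neg _) (neg-neg _) v)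
    orbit-neg (minus v)   = plain v
    orbit-neg (turned v)  = turned⁻ (cone-cong (neg-neg _) refl v)
    orbit-neg (turned⁻ v) = turned (cone-cong refl (neg-neg _) v)

    orbit-S : ∀ {x y} → Orbit x y → Orbit (- y) x
    orbit-S (plain v)   = turned (cone-cong refl (neg-neg _) v)
    orbit-S (minus v)   = turned⁻ v
    orbit-S (turned v)  = minus (cone-cong (neg-neg _) refl v)
    orbit-S (turned⁻ v) = plain v

    private
      apply : ∀ {p q r s p′ q′ r′ s′} x y → (p , q , r , s) ≋ (p′ , q′ , r′ , s′) →
        p * x + q * y ≈ p′ * x + q′ * y × r * x + s * y ≈ r′ * x + s′ * y
      apply x y (p , q , r , s) = +-cong (*-congʳ p) (*-congʳ q) , +-cong (*-congʳ r) (*-congʳ s)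

      stepTo : ∀ {m} x y → ∃[ i ] matrix i ≋ m → Cone x y → let p , q , r , s = m in
        Cone (p * x + q * y) (r * x + s * y)
      stepTo x y (i , eq) v = let p , q = apply x y eq in step i v (sym p) (sym q)

    cone-U : ∀ {x y} → Cone x y → Orbit (u * x - y) x
    cone-U (e₁ p q) = plain (cone-cong
      (trans (solve 1 (λ u → :1 :* :0 :+ u :* :1 := u :* :1 :- :0) refl u)
        (+-cong (*-congˡ (sym p)) (-‿cong (sym q))))
      (trans (solve 0 (:0 :* :0 :+ :1 :* :1 := :1) refl) (sym p))
      (stepTo 0# 1# firstRung (e₂ refl refl)))
    cone-U (e₂ p q) = minus (e₁
      (trans (-‿cong (+-cong (*-congˡ p) (-‿cong q)))
        (solve 1 (λ u → :- (u :* :0 :- :1) := :1) refl u))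
      (trans (-‿cong p) (solve 0 (:- :0 := :0) refl)))
    cone-U (step {x} {y} i v p q) with up i
    ... | inj₁ (j , eq) = let p′ , q′ = apply x y eq in plain (step j v
      (trans (+-cong (*-congˡ p) (-‿cong q)) (trans
        (solve 7 (λ u a b c d x y → u :* (a :* x :+ b :* y) :- (c :* x :+ d :* y)
          := (u :* a :- c) :* x :+ (u :* b :- d) :* y) refl u (a i) (b′ i) (c′ i) (d i) x y) p′))
      (trans p q′))
    ... | inj₂ eq = let p′ , q′ = apply x y eq in turned (cone-cong
      (trans (solve 2 (λ x y → x := :1 :* x :+ :0 :* y) refl x y) (trans (sym q′) (sym p)))
      (trans (solve 2 (λ x y → y := :- (:0 :* x :+ (:- :1) :* y)) refl x y) (-‿cong (trans (sym p′)
        (trans (solve 7 (λ u a b c d x y → (u :* a :- c) :* x :+ (u :* b :- d) :* y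
          := u :* (a :* x :+ b :* y) :- (c :* x :+ d :* y)) refl u (a i) (b′ i) (c′ i) (d i) x y)
          (sym (+-cong (*-congˡ p) (-‿cong q)))))))
      v)

    cone-U⁻¹ : ∀ {x y} → Cone x y → Orbit y (u * y - x)
    cone-U⁻¹ (e₁ p q) = minus (e₂
      (trans (-‿cong q) (solve 0 (:- :0 := :0) refl))
      (trans (-‿cong (+-cong (*-congˡ q) (-‿cong p)))
        (solve 1 (λ u → :- (u :* :0 :- :1) := :1) refl u)))
    cone-U⁻¹ (e₂ p q) = plain (cone-cong
      (trans (solve 0 (:1 :* :1 :+ :0 :* :0 := :1) refl) (sym q))
      (trans (solve 1 (λ u → u :* :1 :+ :1 :* :0 := u :* :1 :- :0) refl u)
        (+-cong (*-congˡ (sym q)) (-‿cong (sym p))))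
      (stepTo 1# 0# lastRung (e₁ refl refl)))
    cone-U⁻¹ (step {x} {y} i v p q) with down i
    ... | inj₁ (j , eq) = let p′ , q′ = apply x y eq in plain (step j v (trans q p′)
      (trans (+-cong (*-congˡ q) (-‿cong p)) (trans
        (solve 7 (λ u a b c d x y → u :* (c :* x :+ d :* y) :- (a :* x :+ b :* y)
          := (u :* c :- a) :* x :+ (u :* d :- b) :* y) refl u (a i) (b′ i) (c′ i) (d i) x y) q′)))
    ... | inj₂ eq = let p′ , q′ = apply x y eq in turned⁻ (cone-cong
      (trans (solve 2 (λ x y → x := :- ((:- :1) :* x :+ :0 :* y)) refl x y) (-‿cong (trans (sym q′)
        (trans (solve 7 (λ u a b c d x y → (u :* c :- a) :* x :+ (u :* d :- b) :* y
          := u :* (c :* x :+ d :* y) :- (a :* x :+ b :* y)) refl u (a i) (b′ i) (c′ i) (d i) x y)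
          (sym (+-cong (*-congˡ q) (-‿cong p)))))))
      (trans (solve 2 (λ x y → y := :0 :* x :+ :1 :* y) refl x y) (trans (sym p′) (sym q)))
      v)

    orbit-U : ∀ {x y} → Orbit x y → Orbit (u * x - y) x
    orbit-U (plain v) = cone-U v
    orbit-U {x} {y} (minus v) = orbit-cong
      (solve 3 (λ u x y → :- (u :* (:- x) :- (:- y)) := u :* x :- y) refl u x y)
      (sym (neg-neg x)) (orbit-neg (cone-U v))
    orbit-U {x} {y} (turned v) = minus (cone-cong
      (solve 3 (λ u x y → :1 :* y :+ u :* (:- x) := :- (u :* x :- y)) refl u x y)
      (solve 2 (λ x y → :0 :* y :+ :1 :* (:- x) := :- x) refl x y)
      (stepTo y (- x) firstRung v))
    orbit-U {x} {y} (turned⁻ v) = plain (cone-cong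
      (solve 3 (λ u x y → :1 :* (:- y) :+ u :* x := u :* x :- y) refl u x y)
      (solve 2 (λ x y → :0 :* (:- y) :+ :1 :* x := x) refl x y)
      (stepTo (- y) x firstRung v))

    orbit-U⁻¹ : ∀ {x y} → Orbit x y → Orbit y (u * y - x)
    orbit-U⁻¹ (plain v) = cone-U⁻¹ v
    orbit-U⁻¹ {x} {y} (minus v) = orbit-cong (sym (neg-neg y))
      (solve 3 (λ u x y → :- (u :* (:- y) :- (:- x)) := u :* y :- x) refl u x y)
      (orbit-neg (cone-U⁻¹ v))
    orbit-U⁻¹ {x} {y} (turned v) = plain (cone-cong
      (solve 2 (λ x y → :1 :* y :+ :0 :* (:- x) := y) refl x y)
      (solve 3 (λ u x y → u :* y :+ :1 :* (:- x) := u :* y :- x) refl u x y)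
      (stepTo y (- x) lastRung v))
    orbit-U⁻¹ {x} {y} (turned⁻ v) = minus (cone-cong
      (solve 2 (λ x y → :1 :* (:- y) :+ :0 :* x := :- y) refl x y)
      (solve 3 (λ u x y → u :* (:- y) :+ :1 :* x := :- (u :* y :- x)) refl u x y)
      (stepTo (- y) x lastRung v))

    orbit-Tⁿ : ∀ n {x y} → Orbit x y → Orbit (x + fromℕ n * u * y) y
    orbit-Tⁿ zero {x} {y} v = orbit-cong
      (solve 3 (λ u x y → x := x :+ :0 :* u :* y) refl u x y) refl v
    orbit-Tⁿ (suc n) {x} {y} v = orbit-cong
      (solve 4 (λ u n x y → :- (u :* (:- y) :- (x :+ n :* u :* y)) := x :+ (:1 :+ n) :* u :* y) refl
        u (fromℕ n) x y)
      (sym (neg-neg y))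
      (orbit-neg (orbit-U (orbit-S (orbit-Tⁿ n v))))

    orbit-T⁻ⁿ : ∀ n {x y} → Orbit x y → Orbit (x + (- fromℕ n) * u * y) y
    orbit-T⁻ⁿ zero {x} {y} v = orbit-cong
      (solve 3 (λ u x y → x := x :+ (:- :0) :* u :* y) refl u x y) refl v
    orbit-T⁻ⁿ (suc n) {x} {y} v = orbit-cong
      (solve 4 (λ u n x y → :- (u :* y :- (x :+ (:- n) :* u :* y)) := x :+ (:- (:1 :+ n)) :* u :* y) refl
        u (fromℕ n) x y)
      refl
      (orbit-S (orbit-U⁻¹ (orbit-T⁻ⁿ n v)))

    orbit-Tᵐ : ∀ m {x y} → Orbit x y → Orbit (x + fromℤ m * u * y) y
    orbit-Tᵐ (+ n)    = orbit-Tⁿ n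
    orbit-Tᵐ -[1+ n ] = orbit-T⁻ⁿ (suc n)

    -- Closed under (x , y) ↦ (y , x) as well.
    Orbit± : Carrier → Carrier → Set (c ⊔ ℓ₁)
    Orbit± x y = Orbit x y ⊎ Orbit x (- y)

    orbit±-J : ∀ {x y} → Orbit± x y → Orbit± y x
    orbit±-J (inj₁ v) = inj₂ (orbit-cong (sym (neg-neg _)) refl (orbit-neg (orbit-S v)))
    orbit±-J (inj₂ v) = inj₁ (orbit-cong (sym (neg-neg _)) refl (orbit-S v))

    orbit±-Tᵐ : ∀ m {x y} → Orbit± x y → Orbit± (x + fromℤ m * u * y) y
    orbit±-Tᵐ m (inj₁ v) = inj₁ (orbit-Tᵐ m v)
    orbit±-Tᵐ m {x} {y} (inj₂ v) = inj₂ (orbit-cong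
      (trans (+-congˡ (*-congʳ (*-congʳ (fromℤ-neg m))))
        (solve 4 (λ m u x y → x :+ (:- m) :* u :* (:- y) := x :+ m :* u :* y) refl (fromℤ m) u x y))
      refl (orbit-Tᵐ (ℤ.- m) v))

    private
      y≈0⇒-y≈0 : ∀ {y} → y ≈ 0# → - y ≈ 0#
      y≈0⇒-y≈0 y≈0 = trans (-‿cong y≈0) (solve 0 (:- :0 := :0) refl)

      -x≈1⇒x≈-1 : ∀ {x} → - x ≈ 1# → x ≈ - 1#
      -x≈1⇒x≈-1 {x} eq = trans (neg-neg x) (-‿cong eq)

    orbit-horizontal : ∀ {x y} → y ≈ 0# → Orbit x y → x ≈ 1# ⊎ x ≈ - 1#
    orbit-horizontal y≈0 (plain v)   = inj₁ (proj₁ (cone-axes v) y≈0)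
    orbit-horizontal y≈0 (minus v)   = inj₂ (-x≈1⇒x≈-1 (proj₁ (cone-axes v) (y≈0⇒-y≈0 y≈0)))
    orbit-horizontal y≈0 (turned v)  = inj₂ (-x≈1⇒x≈-1 (proj₂ (cone-axes v) y≈0))
    orbit-horizontal y≈0 (turned⁻ v) = inj₁ (proj₂ (cone-axes v) (y≈0⇒-y≈0 y≈0))

    orbit±-horizontal : ∀ {x y} → y ≈ 0# → Orbit± x y → x ≈ 1# ⊎ x ≈ - 1#
    orbit±-horizontal y≈0 (inj₁ v) = orbit-horizontal y≈0 v
    orbit±-horizontal y≈0 (inj₂ v) = orbit-horizontal (y≈0⇒-y≈0 y≈0) v

    path-orbit : ∀ ms → Orbit± (numerator ℝ u ms) (denominator ℝ u ms)
    path-orbit []       = inj₁ (plain (e₁ refl refl))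
    path-orbit (m ∷ ms) with orbit±-Tᵐ m (orbit±-J (path-orbit ms))
    ... | inj₁ v = inj₁ (orbit-cong (+-comm _ _) refl v)
    ... | inj₂ v = inj₂ (orbit-cong (+-comm _ _) refl v)

    private
      N D : List ℤ → Carrier
      N = numerator ℝ u
      D = denominator ℝ u

      rebuild : ∀ m {x y} → x ≈ fromℤ m * u * y + (x + fromℤ (ℤ.- m) * u * y)
      rebuild m {x} {y} = trans
        (solve 4 (λ m u x y → x := m :* u :* y :+ (x :+ (:- m) :* u :* y)) refl (fromℤ m) u x y)
        (+-congˡ (+-congˡ (*-congʳ (*-congʳ (sym (fromℤ-neg m))))))

    -- Undoing the path on both vectors reduces to the vectors (1 , 0) and (x , 0).
    parallel⇒± : ∀ ms {x y} → Orbit± x y → N ms * y ≈ x * D ms →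
      (x ≈ N ms × y ≈ D ms) ⊎
      (x ≈ - N ms × y ≈ - D ms)
    parallel⇒± [] {x} {y} v eq = conclude (orbit±-horizontal y≈0 v)
      where
      y≈0 : y ≈ 0#
      y≈0 = trans (sym (*-identityˡ y)) (trans eq (zeroʳ x))
      conclude : x ≈ 1# ⊎ x ≈ - 1# → (x ≈ 1# × y ≈ 0#) ⊎ (x ≈ - 1# × y ≈ - 0#)
      conclude (inj₁ x≈1)  = inj₁ (x≈1 , y≈0)
      conclude (inj₂ x≈-1) = inj₂ (x≈-1 , trans y≈0 (solve 0 (:0 := :- :0) refl))
    parallel⇒± (m ∷ ms) {x} {y} v eq = conclude (parallel⇒± ms (orbit±-J (orbit±-Tᵐ (ℤ.- m) v)) (begin
      N ms * (x + fromℤ (ℤ.- m) * u * y)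
        ≈⟨ *-congˡ (+-congˡ (*-congʳ (*-congʳ (fromℤ-neg m)))) ⟩
      N ms * (x + (- fromℤ m) * u * y)
        ≈⟨ solve 5 (λ n m u x y → n :* (x :+ (:- m) :* u :* y) := x :* n :- (m :* u :* n) :* y) refl
             (N ms) (fromℤ m) u x y ⟩
      x * N ms - (fromℤ m * u * N ms) * y
        ≈⟨ +-congʳ (sym eq) ⟩
      (fromℤ m * u * N ms + D ms) * y - (fromℤ m * u * N ms) * y
        ≈⟨ solve 5 (λ n d m u y → (m :* u :* n :+ d) :* y :- (m :* u :* n) :* y := y :* d) refl
             (N ms) (D ms) (fromℤ m) u y ⟩
      y * D ms ∎))
      where
      open SetoidReasoning setoid
      x′ = x + fromℤ (ℤ.- m) * u * y
      conclude : (y ≈ N ms × x′ ≈ D ms) ⊎ (y ≈ - N ms × x′ ≈ - D ms) →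
        (x ≈ N (m ∷ ms) × y ≈ N ms) ⊎ (x ≈ - N (m ∷ ms) × y ≈ - N ms)
      conclude (inj₁ (p , q)) = inj₁ (trans (rebuild m) (+-cong (*-congˡ p) q) , p)
      conclude (inj₂ (p , q)) = inj₂ (trans (rebuild m) (trans (+-cong (*-congˡ p) q)
        (solve 3 (λ k n d → k :* (:- n) :+ (:- d) := :- (k :* n :+ d)) refl (fromℤ m * u) (N ms) (D ms))) , p)

    proportional⇒denominator² : ∀ ms ns →
      N ms * D ns ≈ N ns * D ms →
      D ms * D ms ≈ D ns * D ns
    proportional⇒denominator² ms ns eq with parallel⇒± ms (path-orbit ns) eq
    ... | inj₁ (_ , p) = sym (*-cong p p)
    ... | inj₂ (_ , p) = sym (trans (*-cong p p) (solve 1 (λ d → (:- d) :* (:- d) := d :* d) refl (D ms)))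

  private
    s : ℕ → Carrier
    s = sine commutativeRing u

    u·1-0≈u : u * 1# - 0# ≈ u
    u·1-0≈u = solve 1 (λ u → u :* :1 :- :0 := u) refl u

    previous : ∀ k → s k ≈ u * s (suc k) - s (suc (suc k))
    previous k = solve 3 (λ u x y → y := u :* x :- (u :* x :- y)) refl u (s (suc k)) (s k)

    rung rung⁻ : ℕ → Matrix
    rung i  = s (suc i) , s (suc (suc i)) , s i , s (suc i)
    rung⁻ i = s (suc i) , s i , s (suc (suc i)) , s (suc i)

    rung-down : ∀ i → U⁻¹· (rung (suc i)) ≋ rung i
    rung-down i = refl , refl , sym (previous i) , sym (previous (suc i))

    rung₀-down : U⁻¹· (rung 0) ≋ -S
    rung₀-down = refl , refl
      , solve 1 (λ u → u :* :0 :- :1 := :- :1) refl u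
      , solve 1 (λ u → u :* :1 :- (u :* :1 :- :0) := :0) refl u

  finiteLadder : ∀ n → (∀ k → k ℕ.≤ n → Pos (s (suc k))) →
    s (suc n) ≈ 1# → s (suc (suc n)) ≈ 0# → Ladder
  finiteLadder n positive sₙ₊₁≈1 sₙ₊₂≈0 = record
    { I        = ∃[ i ] i ℕ.≤ n
    ; matrix   = λ (i , _) → rung i
    ; a-pos    = λ (i , i≤n) → positive i i≤n
    ; b-nonNeg = λ (i , i≤n) → nonNeg (suc (suc i)) (ℕ.s≤s (ℕ.s≤s i≤n))
    ; c-nonNeg = λ (i , i≤n) → nonNeg i (ℕₚ.≤-trans i≤n (ℕₚ.m≤n+m n 2))
    ; d-pos    = λ (i , i≤n) → positive i i≤n
    ; b≈0⇒d≈1  = λ (i , i≤n) → top i i≤n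
    ; c≈0⇒a≈1  = λ { (zero , _) _ → refl
                   ; (suc i , i<n) eq → contradiction eq (pos⇒≉0 (positive i (ℕₚ.<⇒≤ i<n))) }
    ; up       = λ (i , i≤n) → up′ i (ℕₚ.m≤n⇒m<n∨m≡n i≤n)
    ; down     = λ { (zero , _) → inj₂ rung₀-down
                   ; (suc i , i<n) → inj₁ ((i , ℕₚ.<⇒≤ i<n) , rung-down i) }
    ; firstRung = (0 , ℕ.z≤n) , refl , u·1-0≈u , refl , refl
    ; lastRung  = (n , ℕₚ.≤-refl) , sₙ₊₁≈1 , sₙ₊₂≈0
      , trans (previous n) (trans (+-cong (*-congˡ sₙ₊₁≈1) (-‿cong sₙ₊₂≈0)) u·1-0≈u) , sₙ₊₁≈1
    }
    where
    nonNeg : ∀ i → i ℕ.≤ suc (suc n) → NonNeg (s i)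
    nonNeg zero    _ = ≈0⇒nonNeg refl
    nonNeg (suc i) (ℕ.s≤s i≤1+n) with ℕₚ.m≤n⇒m<n∨m≡n i≤1+n
    ... | inj₁ (ℕ.s≤s i≤n) = pos⇒nonNeg (positive i i≤n)
    ... | inj₂ ≡.refl      = ≈0⇒nonNeg sₙ₊₂≈0
    top : ∀ i → i ℕ.≤ n → s (suc (suc i)) ≈ 0# → s (suc i) ≈ 1#
    top i i≤n eq with ℕₚ.m≤n⇒m<n∨m≡n i≤n
    ... | inj₁ i<n    = contradiction eq (pos⇒≉0 (positive (suc i) i<n))
    ... | inj₂ ≡.refl = sₙ₊₁≈1
    up′ : ∀ i → i ℕ.< n ⊎ i ≡ n →
      (Σ[ j ∈ ∃[ i ] i ℕ.≤ n ] U· (rung i) ≋ rung (proj₁ j)) ⊎ U· (rung i) ≋ S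
    up′ i (inj₁ i<n)    = inj₁ ((suc i , i<n) , refl , refl , refl , refl)
    up′ i (inj₂ ≡.refl) = inj₂ (sₙ₊₂≈0
      , trans (+-cong (*-congˡ sₙ₊₂≈0) (-‿cong sₙ₊₁≈1))
          (solve 1 (λ u → u :* :0 :- :1 := :- :1) refl u)
      , sₙ₊₁≈1 , sₙ₊₂≈0)

  infiniteLadder : NonNeg (u - (1# + 1#)) → Ladder
  infiniteLadder u≥2 = record
    { I        = Bool × ℕ
    ; matrix   = λ { (true , i) → rung i ; (false , i) → rung⁻ i }
    ; a-pos    = λ { (true , i) → positive i ; (false , i) → positive i }
    ; b-nonNeg = λ { (true , i) → pos⇒nonNeg (positive (suc i)) ; (false , i) → nonNeg i }
    ; c-nonNeg = λ { (true , i) → nonNeg i ; (false , i) → pos⇒nonNeg (positive (suc i)) }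
    ; d-pos    = λ { (true , i) → positive i ; (false , i) → positive i }
    ; b≈0⇒d≈1  = λ { (true , i) eq → contradiction eq (pos⇒≉0 (positive (suc i))) ; (false , i) → bottom i }
    ; c≈0⇒a≈1  = λ { (true , i) → bottom i ; (false , i) eq → contradiction eq (pos⇒≉0 (positive (suc i))) }
    ; up       = λ { (true , i) → inj₁ ((true , suc i) , refl , refl , refl , refl)
                   ; (false , zero) → inj₂
                       ( solve 1 (λ u → u :* :1 :- (u :* :1 :- :0) := :0) refl u
                       , solve 1 (λ u → u :* :0 :- :1 := :- :1) refl u , refl , refl)
                   ; (false , suc i) → inj₁ ((false , i) , sym (previous (suc i)) , sym (previous i) , refl , refl) }
    ; down     = λ { (true , zero) → inj₂ rung₀-down
                   ; (true , suc i) → inj₁ ((true , i) , rung-down i)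
                   ; (false , i) → inj₁ ((false , suc i) , refl , refl , refl , refl) }
    ; firstRung = (true , 0) , refl , u·1-0≈u , refl , refl
    ; lastRung  = (false , 0) , refl , refl , u·1-0≈u , refl
    }
    where
    increasing : ∀ k → Pos (s (suc k)) × NonNeg (s (suc k) - s k)
    increasing zero = 1-pos , nonNeg-cong (solve 0 (:1 := :1 :- :0) refl) (pos⇒nonNeg 1-pos)
    increasing (suc k) with increasing k
    ... | p , n = pos-cong (solve 2 (λ x y → x :+ (y :- x) := y) refl (s (suc k)) (s (suc (suc k)))) (pos-+-nonNeg p n′) , n′
      where
      n′ : NonNeg (s (suc (suc k)) - s (suc k))
      n′ = nonNeg-cong (solve 3 (λ u x y → (u :- :2) :* x :+ (x :- y) := (u :* x :- y) :- x) refl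
        u (s (suc k)) (s k)) (nonNeg-+ (nonNeg-* u≥2 (pos⇒nonNeg p)) n)
    positive : ∀ k → Pos (s (suc k))
    positive k = proj₁ (increasing k)
    nonNeg : ∀ i → NonNeg (s i)
    nonNeg zero    = ≈0⇒nonNeg refl
    nonNeg (suc i) = pos⇒nonNeg (positive i)
    bottom : ∀ i → s i ≈ 0# → s (suc i) ≈ 1#
    bottom zero    _  = refl
    bottom (suc i) eq = contradiction eq (pos⇒≉0 (positive i))

-- As polynomials in q, c(q, 𝐦) = pathNumerator 𝐦 / pathDenominator 𝐦.
pathNumerator pathDenominator : ∀ {k} → Vector ℤ (suc k) → Expr
pathNumerator   {zero}  m = con (last m)
pathNumerator   {suc k} m = con (last m) ⊗ X ⊗ pathNumerator (init m) ⊕ pathDenominator (init m)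
pathDenominator {zero}  m = con (+ 1)
pathDenominator {suc k} m = X ⊗ pathNumerator (init m)

reversed : ∀ {k} → Vector ℤ (suc k) → List ℤ
reversed {zero}  m = last m ∷ []
reversed {suc k} m = last m ∷ reversed (init m)

X^ : ℕ → Expr
X^ zero    = con (+ 1)
X^ (suc n) = X ⊗ X^ n

-- Vanishing means c(q, 𝐦) = c(q, 𝐧).
crossDifference : ∀ {k l} → Vector ℤ (suc k) → Vector ℤ (suc l) → Expr
crossDifference m n = pathNumerator m ⊗ pathDenominator n ⊕ ⊝ (pathNumerator n ⊗ pathDenominator m)

-- Vanishing means w_q(𝐦)² = w_q(𝐧)².
weightDifference : ∀ {k l} → Vector ℤ (suc k) → Vector ℤ (suc l) → Expr
weightDifference {k} {l} m n =
  pathDenominator m ⊗ pathDenominator m ⊗ X^ l ⊕ ⊝ (pathDenominator n ⊗ pathDenominator n ⊗ X^ k)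

module Weights {c ℓ₁ ℓ₂ : Level} (ℝ : RealField c ℓ₁ ℓ₂) where
  open RealField ℝ hiding (zero; fromℤ)
  open FieldProperties underlyingField
  open OrderedField ℝ
  open IntegersIn commutativeRing
    using (fromℤ; fromℕ-1; solve; _:=_; _:+_; _:*_; _:-_; :-_; :0; :1)
  open Evaluation commutativeRing
  open CommutativeSemiringExp commutativeSemiring using (^-distrib-*)
  open SetoidReasoning setoid

  fromℤ≡ : ∀ i → RealField.fromℤ ℝ i ≡ fromℤ i
  fromℤ≡ (+ n)    = ≡.refl
  fromℤ≡ -[1+ n ] = ≡.refl

  ⟦X^⟧ : ∀ n t → ⟦ X^ n ⟧ t ≈ t ^ n
  ⟦X^⟧ zero    t = fromℕ-1
  ⟦X^⟧ (suc n) t = *-congˡ (⟦X^⟧ n t)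

  ^-≉0 : ∀ {x} n → x ≉ 0# → x ^ n ≉ 0#
  ^-≉0 zero    x≉0 = 1≉0
  ^-≉0 (suc n) x≉0 = *-≉0 x≉0 (^-≉0 n x≉0)

  private
    scaled : ∀ {k} (m : Vector ℤ (suc k)) u →
      u * ⟦ pathNumerator m ⟧ (u * u) ≈ u ^ k * numerator ℝ u (reversed m) ×
      ⟦ pathDenominator m ⟧ (u * u) ≈ u ^ k * denominator ℝ u (reversed m)
    scaled {zero} m u =
      solve 2 (λ u x → u :* x := :1 :* (x :* u :* :1 :+ :0)) refl u (fromℤ (last m))
      , trans fromℕ-1 (sym (*-identityˡ 1#))
    scaled {suc k} m u with scaled (init m) u
    ... | p , q = (begin
      u * (fromℤ (last m) * (u * u) * ⟦ pathNumerator (init m) ⟧ (u * u) + ⟦ pathDenominator (init m) ⟧ (u * u))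
        ≈⟨ solve 4 (λ u a x y → u :* (a :* (u :* u) :* x :+ y) := u :* (a :* u :* (u :* x) :+ y)) refl
             u (fromℤ (last m)) (⟦ pathNumerator (init m) ⟧ (u * u)) (⟦ pathDenominator (init m) ⟧ (u * u)) ⟩
      u * (fromℤ (last m) * u * (u * ⟦ pathNumerator (init m) ⟧ (u * u)) + ⟦ pathDenominator (init m) ⟧ (u * u))
        ≈⟨ *-congˡ (+-cong (*-congˡ p) q) ⟩
      u * (fromℤ (last m) * u * (u ^ k * N) + u ^ k * D)
        ≈⟨ solve 5 (λ u a v x y → u :* (a :* u :* (v :* x) :+ v :* y) := u :* v :* (a :* u :* x :+ y)) refl
             u (fromℤ (last m)) (u ^ k) N D ⟩
      u * u ^ k * (fromℤ (last m) * u * N + D) ∎)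
      , trans (*-assoc u u _) (trans (*-congˡ p) (sym (*-assoc u (u ^ k) N)))
      where
      N = numerator ℝ u (reversed (init m))
      D = denominator ℝ u (reversed (init m))

  ladder-transfer : ∀ {u} → u ≉ 0# → Ladders.Ladder ℝ u →
    ∀ {k l} (m : Vector ℤ (suc k)) (n : Vector ℤ (suc l)) →
    ⟦ crossDifference m n ⟧ (u * u) ≈ 0# → ⟦ weightDifference m n ⟧ (u * u) ≈ 0#
  ladder-transfer {u} u≉0 ladder {k} {l} m n cross≈0 = x≈y⇒x-y≈0 (begin
    Y * Y * ⟦ X^ l ⟧ (u * u)
      ≈⟨ *-cong (*-cong (proj₂ (scaled m u)) (proj₂ (scaled m u))) (trans (⟦X^⟧ l (u * u)) (^-distrib-* u u l)) ⟩
    (u ^ k * D) * (u ^ k * D) * (u ^ l * u ^ l)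
      ≈⟨ solve 3 (λ a b d → (a :* d) :* (a :* d) :* (b :* b) := (a :* b) :* (a :* b) :* (d :* d)) refl (u ^ k) (u ^ l) D ⟩
    (u ^ k * u ^ l) * (u ^ k * u ^ l) * (D * D)
      ≈⟨ *-congˡ (Ladders.Orbits.proportional⇒denominator² ℝ u ladder (reversed m) (reversed n) proportional) ⟩
    (u ^ k * u ^ l) * (u ^ k * u ^ l) * (D′ * D′)
      ≈⟨ solve 3 (λ a b d → (b :* d) :* (b :* d) :* (a :* a) := (a :* b) :* (a :* b) :* (d :* d)) refl (u ^ k) (u ^ l) D′ ⟨
    (u ^ l * D′) * (u ^ l * D′) * (u ^ k * u ^ k)
      ≈⟨ *-cong (*-cong (proj₂ (scaled n u)) (proj₂ (scaled n u))) (trans (⟦X^⟧ k (u * u)) (^-distrib-* u u k)) ⟨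
    Y′ * Y′ * ⟦ X^ k ⟧ (u * u) ∎)
    where
    N  = numerator ℝ u (reversed m)
    N′ = numerator ℝ u (reversed n)
    D  = denominator ℝ u (reversed m)
    D′ = denominator ℝ u (reversed n)
    X₁ = ⟦ pathNumerator m ⟧ (u * u)
    X′ = ⟦ pathNumerator n ⟧ (u * u)
    Y  = ⟦ pathDenominator m ⟧ (u * u)
    Y′ = ⟦ pathDenominator n ⟧ (u * u)
    proportional : N * D′ ≈ N′ * D
    proportional = *-cancelˡ-≉0 (*-≉0 (^-≉0 k u≉0) (^-≉0 l u≉0)) (begin
      u ^ k * u ^ l * (N * D′)
        ≈⟨ solve 4 (λ a b x y → a :* b :* (x :* y) := (a :* x) :* (b :* y)) refl (u ^ k) (u ^ l) N D′ ⟩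
      (u ^ k * N) * (u ^ l * D′)       ≈⟨ *-cong (proj₁ (scaled m u)) (proj₂ (scaled n u)) ⟨
      (u * X₁) * Y′                    ≈⟨ *-assoc u X₁ Y′ ⟩
      u * (X₁ * Y′)                    ≈⟨ *-congˡ (x-y≈0⇒x≈y cross≈0) ⟩
      u * (X′ * Y)                     ≈⟨ *-assoc u X′ Y ⟨
      (u * X′) * Y                     ≈⟨ *-cong (proj₁ (scaled n u)) (proj₂ (scaled m u)) ⟩
      (u ^ l * N′) * (u ^ k * D)
        ≈⟨ solve 4 (λ a b x y → (b :* x) :* (a :* y) := a :* b :* (x :* y)) refl (u ^ k) (u ^ l) N′ D ⟩
      u ^ k * u ^ l * (N′ * D) ∎)

  ∣∣-square : ∀ x → ∣ x ∣ * ∣ x ∣ ≈ x * x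
  ∣∣-square x with compare x 0#
  ... | tri< _ _ _ = solve 1 (λ x → (:- x) :* (:- x) := x :* x) refl x
  ... | tri≈ _ _ _ = refl
  ... | tri> _ _ _ = refl

  ∣∣-nonNeg : ∀ x → NonNeg ∣ x ∣
  ∣∣-nonNeg x with compare x 0#
  ... | tri< x<0 _ _ = pos⇒nonNeg (pos-cong (+-identityˡ _) (<⇒Pos x<0))
  ... | tri≈ _ x≈0 _ = ≈0⇒nonNeg x≈0
  ... | tri> _ _ x>0 = pos⇒nonNeg x>0

  product-nonNeg : ∀ {k} (f : Vector Carrier k) → (∀ i → NonNeg (f i)) → NonNeg (product f)
  product-nonNeg {zero}  f n = pos⇒nonNeg 1-pos
  product-nonNeg {suc k} f n = nonNeg-* (n Fin.zero) (product-nonNeg (f ∘ Fin.suc) (n ∘ Fin.suc))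

  nonNeg-square-injective : ∀ {x y} → NonNeg x → NonNeg y → x * x ≈ y * y → x ≈ y
  nonNeg-square-injective {x} {y} m n x²≈y² = exclude (x²≈y²⇒x≈±y x²≈y²) (nonNeg⇒pos⊎≈0 n)
    where
    exclude : x ≈ y ⊎ x ≈ - y → Pos y ⊎ y ≈ 0# → x ≈ y
    exclude (inj₁ x≈y)  _          = x≈y
    exclude (inj₂ x≈-y) (inj₁ p)   = contradiction (pos-cong (solve 1 (λ y → y := :- (:- y)) refl y) p)
      (nonNeg-cong x≈-y m)
    exclude (inj₂ x≈-y) (inj₂ y≈0) = trans x≈-y (trans (-‿cong y≈0)
      (trans (solve 0 (:- :0 := :0) refl) (sym y≈0)))

  module _ {q : Carrier} (q>0 : 0# < q) where
    open Paths ℝ q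

    continuedFraction-cong : ∀ {k l} → k ≡ l → (m : Vector ℤ (suc k)) (n : Vector ℤ (suc l)) →
      (∀ i j → toℕ i ≡ toℕ j → m i ≡ n j) → continuedFraction m ≡ continuedFraction n
    continuedFraction-cong {zero}  ≡.refl m n eq = ≡.cong (RealField.fromℤ ℝ) (eq Fin.zero Fin.zero ≡.refl)
    continuedFraction-cong {suc k} ≡.refl m n eq = ≡.cong₂ (λ i x → RealField.fromℤ ℝ i + (q * x) ⁻¹)
      (eq _ _ ≡.refl)
      (continuedFraction-cong ≡.refl (init m) (init n)
        (λ i j i≡j → eq (inject₁ i) (inject₁ j) (≡.trans (toℕ-inject₁ i) (≡.trans i≡j (≡.sym (toℕ-inject₁ j))))))

    private
      partial : ∀ {k} (m : Vector ℤ (suc k)) → Fin k → Carrier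
      partial m j = continuedFraction (prefix m (inject₁ j))

      partial-init : ∀ {k} (m : Vector ℤ (suc (suc k))) j → partial m (inject₁ j) ≡ partial (init m) j
      partial-init m j = continuedFraction-cong (toℕ-inject₁ (inject₁ j)) _ _
        (λ i i′ i≡i′ → ≡.cong m (toℕ-injective (≡.trans (toℕ-inject≤ i _) (≡.trans i≡i′
          (≡.sym (≡.trans (toℕ-inject₁ (inject≤ i′ _)) (toℕ-inject≤ i′ _)))))))

      partial-last : ∀ {k} (m : Vector ℤ (suc (suc k))) →
        partial m (fromℕ<suc k) ≡ continuedFraction (init m)
      partial-last {k} m = continuedFraction-cong (≡.trans (toℕ-inject₁ (fromℕ<suc k)) (toℕ-fromℕ k)) _ _
        (λ i i′ i≡i′ → ≡.cong m (toℕ-injective (≡.trans (toℕ-inject≤ i _)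
          (≡.trans i≡i′ (≡.sym (toℕ-inject₁ i′))))))

      absolute : ∀ {k} (m : Vector ℤ (suc k)) → Carrier
      absolute m = product (λ j → ∣ partial m j ∣)

      absolute-suc : ∀ {k} (m : Vector ℤ (suc (suc k))) →
        absolute m ≈ absolute (init m) * ∣ continuedFraction (init m) ∣
      absolute-suc m = trans (MonoidSum.sum-init-last *-monoid (λ j → ∣ partial m j ∣))
        (*-cong (MonoidSum.sum-cong-≋ *-monoid (λ j → reflexive (≡.cong ∣_∣ (partial-init m j))))
          (reflexive (≡.cong ∣_∣ (partial-last m))))

      q≉0 : q ≉ 0#
      q≉0 = pos⇒≉0 q>0

      X₁ Y : ∀ {k} → Vector ℤ (suc k) → Carrier
      X₁ m = ⟦ pathNumerator m ⟧ q
      Y m  = ⟦ pathDenominator m ⟧ q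

    path-init : ∀ {k} (m : Vector ℤ (suc (suc k))) → IsPath m →
      IsPath (init m) × continuedFraction (init m) ≉ 0#
    path-init {k} m path =
      (λ j eq → path (inject₁ j) (trans (reflexive (partial-init m j)) eq))
      , λ eq → path (fromℕ<suc k) (trans (reflexive (partial-last m)) eq)

    continuedFraction-quotient : ∀ {k} (m : Vector ℤ (suc k)) → IsPath m →
      ⟦ pathDenominator m ⟧ q ≉ 0# ×
      continuedFraction m * ⟦ pathDenominator m ⟧ q ≈ ⟦ pathNumerator m ⟧ q ×
      ⟦ pathDenominator m ⟧ q * ⟦ pathDenominator m ⟧ q
        ≈ q ^ k * q ^ k * (absolute m * absolute m)
    continuedFraction-quotient {zero} m path =
      (λ eq → 1≉0 (trans (sym fromℕ-1) eq))
      , trans (*-cong (reflexive (fromℤ≡ (last m))) fromℕ-1) (*-identityʳ _)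
      , trans (*-cong fromℕ-1 fromℕ-1) (solve 0 (:1 :* :1 := :1 :* :1 :* (:1 :* :1)) refl)
    continuedFraction-quotient {suc k} m path with path-init m path
    ... | path′ , c≉0 with continuedFraction-quotient (init m) path′
    ... | Y≉0 , cY≈X , Y²≈ = *-≉0 q≉0 (λ X≈0 → *-≉0 c≉0 Y≉0 (trans cY≈X X≈0))
      , (begin
        (RealField.fromℤ ℝ (last m) + (q * c′) ⁻¹) * (q * X₁ (init m))
          ≈⟨ *-cong (+-congʳ (reflexive (fromℤ≡ (last m)))) (*-congˡ (sym cY≈X)) ⟩
        (fromℤ (last m) + (q * c′) ⁻¹) * (q * (c′ * Y (init m)))
          ≈⟨ solve 5 (λ a i q c y → (a :+ i) :* (q :* (c :* y)) := a :* q :* (c :* y) :+ (q :* c) :* i :* y) refl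
               (fromℤ (last m)) ((q * c′) ⁻¹) q c′ (Y (init m)) ⟩
        fromℤ (last m) * q * (c′ * Y (init m)) + (q * c′) * (q * c′) ⁻¹ * Y (init m)
          ≈⟨ +-cong (*-congˡ cY≈X) (trans (*-congʳ (⁻¹-inverse (*-≉0 q≉0 c≉0))) (*-identityˡ _)) ⟩
        fromℤ (last m) * q * X₁ (init m) + Y (init m) ∎)
      , (begin
        (q * X₁ (init m)) * (q * X₁ (init m))
          ≈⟨ *-cong (*-congˡ cY≈X) (*-congˡ cY≈X) ⟨
        (q * (c′ * Y (init m))) * (q * (c′ * Y (init m)))
          ≈⟨ solve 3 (λ q c y → (q :* (c :* y)) :* (q :* (c :* y)) := (q :* q) :* ((c :* c) :* (y :* y))) refl q c′ (Y (init m)) ⟩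
        (q * q) * ((c′ * c′) * (Y (init m) * Y (init m)))
          ≈⟨ *-congˡ (*-cong (sym (∣∣-square c′)) Y²≈) ⟩
        (q * q) * ((∣ c′ ∣ * ∣ c′ ∣) * (q ^ k * q ^ k * (absolute (init m) * absolute (init m))))
          ≈⟨ solve 4 (λ q c r a → (q :* q) :* ((c :* c) :* (r :* r :* (a :* a)))
                := (q :* r) :* (q :* r) :* ((a :* c) :* (a :* c))) refl q (∣ c′ ∣) (q ^ k) (absolute (init m)) ⟩
        q ^ suc k * q ^ suc k * ((absolute (init m) * ∣ c′ ∣) * (absolute (init m) * ∣ c′ ∣))
          ≈⟨ *-congˡ (*-cong (sym (absolute-suc m)) (sym (absolute-suc m))) ⟩
        q ^ suc k * q ^ suc k * (absolute m * absolute m) ∎)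
      where c′ = continuedFraction (init m)

    private
      √q^k² : ∀ k → √ q ^ k * √ q ^ k ≈ q ^ k
      √q^k² k = trans (sym (^-distrib-* (√ q) (√ q) k)) (SemiringExp.^-congˡ semiring k (√-square q>0))

      weight² : ∀ {k} (m : Vector ℤ (suc k)) → weight m * weight m ≈ q ^ k * (absolute m * absolute m)
      weight² {k} m = trans
        (solve 2 (λ r a → (r :* a) :* (r :* a) := (r :* r) :* (a :* a)) refl (√ q ^ k) (absolute m))
        (*-congʳ (√q^k² k))

      weight-nonNeg : ∀ {k} (m : Vector ℤ (suc k)) → NonNeg (weight m)
      weight-nonNeg {k} m = nonNeg-* (power k) (product-nonNeg _ (λ j → ∣∣-nonNeg (partial m j)))
        where
        power : ∀ k → NonNeg (√ q ^ k)
        power zero    = pos⇒nonNeg 1-pos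
        power (suc k) = nonNeg-* (pos⇒nonNeg (√-pos q>0)) (power k)

    transfer⇒hasUniqueWeight :
      (∀ {k l} (m : Vector ℤ (suc k)) (n : Vector ℤ (suc l)) →
        ⟦ crossDifference m n ⟧ q ≈ 0# → ⟦ weightDifference m n ⟧ q ≈ 0#) →
      HasUniqueWeight
    transfer⇒hasUniqueWeight transfer {k} {l} m n m-path n-path c≈c′
      with continuedFraction-quotient m m-path | continuedFraction-quotient n n-path
    ... | _ , cY≈X , Y²≈ | _ , c′Y′≈X′ , Y′²≈ =
      nonNeg-square-injective (weight-nonNeg m) (weight-nonNeg n)
        (*-cancelˡ-≉0 (*-≉0 (^-≉0 k q≉0) (^-≉0 l q≉0)) (begin
          q ^ k * q ^ l * (weight m * weight m)
            ≈⟨ *-congˡ (weight² m) ⟩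
          q ^ k * q ^ l * (q ^ k * (absolute m * absolute m))
            ≈⟨ solve 3 (λ r s a → r :* s :* (r :* a) := r :* r :* a :* s) refl (q ^ k) (q ^ l) _ ⟩
          q ^ k * q ^ k * (absolute m * absolute m) * q ^ l
            ≈⟨ *-cong Y²≈ (⟦X^⟧ l q) ⟨
          Y m * Y m * ⟦ X^ l ⟧ q
            ≈⟨ x-y≈0⇒x≈y (transfer m n cross≈0) ⟩
          Y n * Y n * ⟦ X^ k ⟧ q
            ≈⟨ *-cong Y′²≈ (⟦X^⟧ k q) ⟩
          q ^ l * q ^ l * (absolute n * absolute n) * q ^ k
            ≈⟨ solve 3 (λ r s a → r :* s :* (s :* a) := s :* s :* a :* r) refl (q ^ k) (q ^ l) _ ⟨
          q ^ k * q ^ l * (q ^ l * (absolute n * absolute n))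
            ≈⟨ *-congˡ (weight² n) ⟨
          q ^ k * q ^ l * (weight n * weight n) ∎))
      where
      cross≈0 : ⟦ crossDifference m n ⟧ q ≈ 0#
      cross≈0 = x≈y⇒x-y≈0 (begin
        X₁ m * Y n                              ≈⟨ *-congʳ cY≈X ⟨
        continuedFraction m * Y m * Y n         ≈⟨ *-congʳ (*-congʳ c≈c′) ⟩
        continuedFraction n * Y m * Y n
          ≈⟨ solve 3 (λ c y z → c :* y :* z := c :* z :* y) refl _ (Y m) (Y n) ⟩
        continuedFraction n * Y n * Y m         ≈⟨ *-congʳ c′Y′≈X′ ⟩
        X₁ n * Y m                              ∎)

primesNotDividing : ℕ → ℕ → ℕ
primesNotDividing j zero    = 1
primesNotDividing j (suc b) with prime? b | b ∣? j
... | yes _ | no _ = b ℕ.* primesNotDividing j b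
... | _     | _    = primesNotDividing j b

∤⇒∣primesNotDividing : ∀ j b {p} → Prime p → p ℕ.< b → p ∤ j → p ∣ primesNotDividing j b
∤⇒∣primesNotDividing j (suc b) {p} p-prime (ℕ.s≤s p≤b) p∤j
  with prime? b | b ∣? j | ℕₚ.m≤n⇒m<n∨m≡n p≤b
... | yes _      | no _    | inj₁ p<b    = ∣n⇒∣m*n b (∤⇒∣primesNotDividing j b p-prime p<b p∤j)
... | yes _      | yes _   | inj₁ p<b    = ∤⇒∣primesNotDividing j b p-prime p<b p∤j
... | no _       | _       | inj₁ p<b    = ∤⇒∣primesNotDividing j b p-prime p<b p∤j
... | yes _      | no _    | inj₂ ≡.refl = m∣m*n _
... | yes _      | yes b∣j | inj₂ ≡.refl = contradiction b∣j p∤j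
... | no ¬prime  | _       | inj₂ ≡.refl = contradiction p-prime ¬prime

∣⇒∤primesNotDividing : ∀ j b {p} → Prime p → p ∣ j → p ∤ primesNotDividing j b
∣⇒∤primesNotDividing j zero    p-prime p∣j p∣1 = ¬prime[1] (≡.subst Prime (∣1⇒≡1 p∣1) p-prime)
∣⇒∤primesNotDividing j (suc b) {p} p-prime p∣j p∣a with prime? b | b ∣? j
... | no _        | _       = ∣⇒∤primesNotDividing j b p-prime p∣j p∣a
... | yes _       | yes _   = ∣⇒∤primesNotDividing j b p-prime p∣j p∣a
... | yes b-prime | no b∤j with euclidsLemma b (primesNotDividing j b) p-prime p∣a
...   | inj₂ p∣a′ = ∣⇒∤primesNotDividing j b p-prime p∣j p∣a′
...   | inj₁ p∣b with prime⇒irreducible b-prime p∣b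
...     | inj₁ ≡.refl = ¬prime[1] p-prime
...     | inj₂ ≡.refl = b∤j p∣j

-- j + Nℤ contains numbers without small prime factors, as j is prime to N = 1 + k j.
avoidPrimes : ∀ j k b {p} → Prime p →
  p ∣ primesNotDividing j b ℕ.* suc (k ℕ.* j) ℕ.+ j → b ℕ.≤ p
avoidPrimes j k b {p} p-prime p∣sum with b ℕₚ.≤? p | p ∣? j
... | yes b≤p | _ = b≤p
... | no b≰p | no p∤j = contradiction
  (∣m+n∣m⇒∣n p∣sum (∣m⇒∣m*n _ (∤⇒∣primesNotDividing j b p-prime (ℕₚ.≰⇒> b≰p) p∤j))) p∤j
... | no b≰p | yes p∣j
  with euclidsLemma (primesNotDividing j b) (suc (k ℕ.* j)) p-prime
         (∣m+n∣m⇒∣n (≡.subst (p ∣_) (ℕₚ.+-comm _ j) p∣sum) p∣j)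
...   | inj₁ p∣a = contradiction p∣a (∣⇒∤primesNotDividing j b p-prime p∣j)
...   | inj₂ p∣N = contradiction (≡.subst Prime (∣1⇒≡1 p∣1) p-prime) ¬prime[1]
  where
  p∣1 : p ∣ 1
  p∣1 = ∣m+n∣m⇒∣n (≡.subst (p ∣_) (ℕₚ.+-comm 1 (k ℕ.* j)) p∣N) (∣n⇒∣m*n k p∣j)

least : ∀ {a} {P : ℕ → Set a} → (∀ n → Dec (P n)) → ∀ {n} → P n →
  ∃[ m ] P m × (∀ k → k ℕ.< m → ¬ P k)
least {P = P} P? {n} pn with P? 0
... | yes p0 = 0 , p0 , λ _ ()
least P? {zero}  pn | no ¬p0 = contradiction pn ¬p0
least P? {suc n} pn | no ¬p0 with least (λ k → P? (suc k)) {n} pn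
... | m , pm , below = suc m , pm , λ { zero _ → ¬p0 ; (suc k) (ℕ.s≤s k<m) → below k k<m }

module Trigonometry {c ℓ₁ ℓ₂ : Level} (ℝ : RealField c ℓ₁ ℓ₂) where
  open RealField ℝ hiding (zero; fromℤ)
  open FieldProperties underlyingField
  open OrderedField ℝ
  open IntegersIn commutativeRing using (solve; _:=_; _:+_; _:*_; _:-_; :-_; :0; :1; :2)
  open Chebyshev commutativeRing
  open SetoidReasoning setoid

  private
    4# : Carrier
    4# = (1# + 1#) + (1# + 1#)

  ⁻¹-cross : ∀ {x y x′ y′} → y ≉ 0# → y′ ≉ 0# → x * y′ ≈ x′ * y → x * y ⁻¹ ≈ x′ * y′ ⁻¹
  ⁻¹-cross {x} {y} {x′} {y′} y≉0 y′≉0 eq = *-cancelˡ-≉0 (*-≉0 y≉0 y′≉0) (begin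
    y * y′ * (x * y ⁻¹)      ≈⟨ solve 4 (λ x y i z → y :* z :* (x :* i) := (x :* z) :* (y :* i)) refl x y (y ⁻¹) y′ ⟩
    (x * y′) * (y * y ⁻¹)    ≈⟨ *-cong eq (trans (⁻¹-inverse y≉0) (sym (⁻¹-inverse y′≉0))) ⟩
    (x′ * y) * (y′ * y′ ⁻¹)  ≈⟨ solve 4 (λ x y z i → (x :* y) :* (z :* i) := y :* z :* (x :* i)) refl x′ y y′ (y′ ⁻¹) ⟩
    y * y′ * (x′ * y′ ⁻¹)    ∎)

  module _ (u : Carrier) where
    private
      s w : ℕ → Carrier
      s = sine commutativeRing u
      w = cosine commutativeRing u

    AtLeast : ℕ → ℕ → Set (ℓ₁ ⊔ ℓ₂)
    AtLeast j i = s i ≈ 0# ⊎ NonNeg (s i * s i - s j * s j)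

    module _ {m : ℕ} (sₘ₊₁≈0 : s (suc m) ≈ 0#) where
      shift : ∀ t → ∃[ e ] e * e ≈ 1# × (∀ i → s (i ℕ.+ t ℕ.* suc m) ≈ e * s i)
      shift zero = 1# , *-identityˡ 1# , λ i → trans (reflexive (≡.cong s (ℕₚ.+-identityʳ i))) (sym (*-identityˡ _))
      shift (suc t) with shift t
      ... | e , e²≈1 , eq = e * - s m
        , trans (solve 2 (λ e x → (e :* (:- x)) :* (e :* (:- x)) := (e :* e) :* (x :* x)) refl e (s m))
            (trans (*-cong e²≈1 sₘ²≈1) (*-identityˡ 1#))
        , λ i → begin
          s (i ℕ.+ (suc m ℕ.+ t ℕ.* suc m))    ≡⟨ ≡.cong s (ℕₚ.+-assoc i (suc m) _) ⟨
          s ((i ℕ.+ suc m) ℕ.+ t ℕ.* suc m)    ≈⟨ eq (i ℕ.+ suc m) ⟩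
          e * s (i ℕ.+ suc m)                  ≈⟨ *-congˡ (sine-+ u i m) ⟩
          e * (s (suc i) * s (suc m) - s i * s m)
            ≈⟨ *-congˡ (+-congʳ (trans (*-congˡ sₘ₊₁≈0) (zeroʳ _))) ⟩
          e * (0# - s i * s m)
            ≈⟨ solve 3 (λ e x y → e :* (:0 :- x :* y) := e :* (:- y) :* x) refl e (s i) (s m) ⟩
          e * - s m * s i ∎
        where
        sₘ²≈1 : s m * s m ≈ 1#
        sₘ²≈1 = begin
          s m * s m
            ≈⟨ solve 2 (λ u x → x :* x := :0 :* :0 :+ x :* x :- u :* (:0 :* x)) refl u (s m) ⟩
          0# * 0# + s m * s m - u * (0# * s m)
            ≈⟨ +-cong (+-congʳ (*-cong sₘ₊₁≈0 sₘ₊₁≈0)) (-‿cong (*-congˡ (*-congʳ sₘ₊₁≈0))) ⟨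
          s (suc m) * s (suc m) + s m * s m - u * (s (suc m) * s m)
            ≈⟨ sine-invariant u m ⟩
          1# ∎

      multiple-of-period : ∀ t → s (t ℕ.* suc m) ≈ 0#
      multiple-of-period t with shift t
      ... | e , _ , eq = trans (eq 0) (zeroʳ e)

      private
        extend : ∀ {j b} → (∀ i → i ℕ.< b → AtLeast j i) → AtLeast j b → ∀ i → i ℕ.< suc b → AtLeast j i
        extend below at i i<1+b with ℕₚ.m<1+n⇒m<n∨m≡n i<1+b
        ... | inj₁ i<b    = below i i<b
        ... | inj₂ ≡.refl = at

        smallest-below : ∀ b → ∃[ j ] s j ≉ 0# × (∀ i → i ℕ.< b → AtLeast j i)
        smallest-below zero = 1 , 1≉0 , λ _ ()
        smallest-below (suc b) with smallest-below b
        ... | j , sⱼ≉0 , above with s b ≟ 0# | sign (s b * s b - s j * s j)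
        ... | yes s≈0 | _        = j , sⱼ≉0 , extend {j} above (inj₁ s≈0)
        ... | no _    | isPos p  = j , sⱼ≉0 , extend {j} above (inj₂ (pos⇒nonNeg p))
        ... | no _    | isZero z = j , sⱼ≉0 , extend {j} above (inj₂ (≈0⇒nonNeg z))
        ... | no s≉0  | isNeg p  = b , s≉0 , extend {b} (λ i i<b → weaken i (above i i<b)) (inj₂ (≈0⇒nonNeg (-‿inverseʳ _)))
          where
          weaken : ∀ i → AtLeast j i → AtLeast b i
          weaken i (inj₁ z) = inj₁ z
          weaken i (inj₂ n) = inj₂ (pos⇒nonNeg (pos-cong
            (solve 3 (λ x y z → :- (x :- y) :+ (z :- y) := z :- x) refl (s b * s b) (s j * s j) (s i * s i))
            (pos-+-nonNeg p n)))

      smallest : ∃[ j ] s j ≉ 0# × (∀ i → AtLeast j i)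
      smallest with smallest-below (suc m)
      ... | j , sⱼ≉0 , above = j , sⱼ≉0 , λ i → everywhere i (above (i % suc m) (m%n<n i (suc m)))
        where
        everywhere : ∀ i → AtLeast j (i % suc m) → AtLeast j i
        everywhere i al with shift (i ℕ./ suc m)
        ... | e , e²≈1 , eq = go al
          where
          sᵢ≈ : s i ≈ e * s (i % suc m)
          sᵢ≈ = trans (reflexive (≡.cong s (m≡m%n+[m/n]*n i (suc m)))) (eq (i % suc m))
          go : AtLeast j (i % suc m) → AtLeast j i
          go (inj₁ z) = inj₁ (trans sᵢ≈ (trans (*-congˡ z) (zeroʳ e)))
          go (inj₂ n) = inj₂ (nonNeg-cong (+-congʳ (begin
            s (i % suc m) * s (i % suc m)                  ≈⟨ *-identityˡ _ ⟨
            1# * (s (i % suc m) * s (i % suc m))           ≈⟨ *-congʳ e²≈1 ⟨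
            e * e * (s (i % suc m) * s (i % suc m))
              ≈⟨ solve 2 (λ e x → e :* e :* (x :* x) := (e :* x) :* (e :* x)) refl e _ ⟩
            (e * s (i % suc m)) * (e * s (i % suc m))      ≈⟨ *-cong sᵢ≈ sᵢ≈ ⟨
            s i * s i ∎)) n)

      -- For c k = s (1 + k j), the ratios W c (k + 1) / c k decrease strictly if all
      -- |c k| ≥ |s j|, while c is periodic up to sign.  Hence 1 + k j is a multiple of
      -- the period for some k.
      module _ {j : ℕ} (sⱼ≉0 : s j ≉ 0#) (above : ∀ i → AtLeast j i) where
        private
          c′ ρ : ℕ → Carrier
          c′ k = s (suc (k ℕ.* j))
          W : Carrier
          W = w j
          ρ k = W * c′ (suc k) * c′ k ⁻¹

          c-recurrence : ∀ k → c′ (suc (suc k)) ≈ W * c′ (suc k) - c′ k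
          c-recurrence k = begin
            c′ (suc (suc k))
              ≈⟨ solve 2 (λ x y → x := (x :+ y) :- y) refl _ (c′ k) ⟩
            (c′ (suc (suc k)) + c′ k) - c′ k
              ≡⟨ ≡.cong (λ x → (s x + c′ k) - c′ k) (≡.sym (≡.trans (≡.cong (j ℕ.+_) (ℕₚ.+-suc j _)) (ℕₚ.+-suc j _))) ⟩
            (s (j ℕ.+ (j ℕ.+ suc (k ℕ.* j))) + c′ k) - c′ k
              ≈⟨ +-congʳ (cosine-*-recurrence u j (suc (k ℕ.* j))) ⟨
            W * s (j ℕ.+ suc (k ℕ.* j)) - c′ k
              ≡⟨ ≡.cong (λ x → W * s x - c′ k) (ℕₚ.+-suc j _) ⟩
            W * c′ (suc k) - c′ k ∎

          c-invariant : ∀ k → c′ (suc k) * c′ (suc k) + c′ k * c′ k - W * (c′ (suc k) * c′ k) ≈ s j * s j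
          c-invariant zero rewrite ℕₚ.+-identityʳ j = begin
            s (suc j) * s (suc j) + 1# * 1# - W * (s (suc j) * 1#)
              ≈⟨ +-cong (+-congˡ (trans (*-identityˡ 1#) (sym (sine-invariant u j)))) (-‿cong (*-congʳ (cosine≈ u j))) ⟩
            s (suc j) * s (suc j) + (s (suc j) * s (suc j) + s j * s j - u * (s (suc j) * s j))
              - ((1# + 1#) * s (suc j) - u * s j) * (s (suc j) * 1#)
              ≈⟨ solve 3 (λ u x y → x :* x :+ (x :* x :+ y :* y :- u :* (x :* y))
                    :- (:2 :* x :- u :* y) :* (x :* :1) := y :* y) refl u (s (suc j)) (s j) ⟩
            s j * s j ∎
          c-invariant (suc k) = begin
            c′ (suc (suc k)) * c′ (suc (suc k)) + c′ (suc k) * c′ (suc k) - W * (c′ (suc (suc k)) * c′ (suc k))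
              ≈⟨ +-cong (+-congʳ (*-cong (c-recurrence k) (c-recurrence k))) (-‿cong (*-congˡ (*-congʳ (c-recurrence k)))) ⟩
            (W * c′ (suc k) - c′ k) * (W * c′ (suc k) - c′ k) + c′ (suc k) * c′ (suc k) - W * ((W * c′ (suc k) - c′ k) * c′ (suc k))
              ≈⟨ solve 3 (λ u x y → (u :* x :- y) :* (u :* x :- y) :+ x :* x :- u :* ((u :* x :- y) :* x)
                    := x :* x :+ y :* y :- u :* (x :* y)) refl W (c′ (suc k)) (c′ k) ⟩
            c′ (suc k) * c′ (suc k) + c′ k * c′ k - W * (c′ (suc k) * c′ k)
              ≈⟨ c-invariant k ⟩
            s j * s j ∎

        ¬all≉0 : ¬ (∀ k → s (suc (k ℕ.* j)) ≉ 0#)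
        ¬all≉0 c≉0 = pos⇒≉0 (decreasing m) (x≈y⇒x-y≈0 (⁻¹-cross (c≉0 0) (c≉0 (suc m)) periodic))
          where
          c²≥ : ∀ k → NonNeg (c′ k * c′ k - s j * s j)
          c²≥ k with above (suc (k ℕ.* j))
          ... | inj₁ z = contradiction z (c≉0 k)
          ... | inj₂ n = n
          product-pos : ∀ k → Pos (W * (c′ (suc k) * c′ k))
          product-pos k = pos-cong (begin
            c′ (suc k) * c′ (suc k) + (c′ k * c′ k - s j * s j)
              ≈⟨ +-congˡ (+-congˡ (-‿cong (c-invariant k))) ⟨
            c′ (suc k) * c′ (suc k) + (c′ k * c′ k - (c′ (suc k) * c′ (suc k) + c′ k * c′ k - W * (c′ (suc k) * c′ k)))
              ≈⟨ solve 3 (λ w x y → x :* x :+ (y :* y :- (x :* x :+ y :* y :- w :* (x :* y))) := w :* (x :* y)) refl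
                   W (c′ (suc k)) (c′ k) ⟩
            W * (c′ (suc k) * c′ k) ∎) (pos-+-nonNeg (square-pos (c≉0 (suc k))) (c²≥ k))
          difference : ∀ k → c′ (suc k) * c′ k * (c′ (suc k) * c′ k) * (ρ k - ρ (suc k))
            ≈ W * (c′ (suc k) * c′ k) * (s j * s j)
          difference k = begin
            x * y * (x * y) * (W * x * y ⁻¹ - W * c′ (suc (suc k)) * x ⁻¹)
              ≈⟨ solve 6 (λ w x y z i h → x :* y :* (x :* y) :* (w :* x :* i :- w :* z :* h)
                    := w :* (x :* y) :* ((y :* i) :* (x :* x) :- (x :* h) :* (y :* z))) refl
                   W x y (c′ (suc (suc k))) (y ⁻¹) (x ⁻¹) ⟩
            W * (x * y) * ((y * y ⁻¹) * (x * x) - (x * x ⁻¹) * (y * c′ (suc (suc k))))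
              ≈⟨ *-congˡ (+-cong (*-congʳ (⁻¹-inverse (c≉0 k)))
                   (-‿cong (*-cong (⁻¹-inverse (c≉0 (suc k))) (*-congˡ (c-recurrence k))))) ⟩
            W * (x * y) * (1# * (x * x) - 1# * (y * (W * x - y)))
              ≈⟨ solve 3 (λ w x y → w :* (x :* y) :* (:1 :* (x :* x) :- :1 :* (y :* (w :* x :- y)))
                    := w :* (x :* y) :* (x :* x :+ y :* y :- w :* (x :* y))) refl W x y ⟩
            W * (x * y) * (x * x + y * y - W * (x * y))
              ≈⟨ *-congˡ (c-invariant k) ⟩
            W * (x * y) * (s j * s j) ∎
            where
            x = c′ (suc k)
            y = c′ k
          decrease : ∀ k → Pos (ρ k - ρ (suc k))
          decrease k = pos-cancel (square-pos (*-≉0 (c≉0 (suc k)) (c≉0 k)))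
            (pos-cong (sym (difference k)) (*-pos (product-pos k) (square-pos sⱼ≉0)))
          decreasing : ∀ k → Pos (ρ 0 - ρ (suc k))
          decreasing zero    = decrease 0
          decreasing (suc k) = pos-cong
            (solve 3 (λ x y z → (x :- y) :+ (y :- z) := x :- z) refl (ρ 0) (ρ (suc k)) (ρ (suc (suc k))))
            (pos-+ (decreasing k) (decrease (suc k)))
          e = proj₁ (shift j)
          c-shift : ∀ k → c′ (k ℕ.+ suc m) ≈ e * c′ k
          c-shift k = trans (reflexive (≡.cong (λ x → s (suc x))
            (≡.trans (ℕₚ.*-distribʳ-+ j k (suc m)) (≡.cong (k ℕ.* j ℕ.+_) (ℕₚ.*-comm (suc m) j)))))
            (proj₂ (proj₂ (shift j)) (suc (k ℕ.* j)))
          periodic : W * c′ 1 * c′ (suc m) ≈ W * c′ (suc (suc m)) * c′ 0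
          periodic = begin
            W * c′ 1 * c′ (suc m)            ≈⟨ *-congˡ (c-shift 0) ⟩
            W * c′ 1 * (e * c′ 0)            ≈⟨ solve 4 (λ w x e y → w :* x :* (e :* y) := w :* (e :* x) :* y) refl W (c′ 1) e (c′ 0) ⟩
            W * (e * c′ 1) * c′ 0            ≈⟨ *-congʳ (*-congˡ (c-shift 1)) ⟨
            W * c′ (suc (suc m)) * c′ 0      ∎

    -- The sine sequence of w j is that of u at the multiples of j, divided by s j.
    ladder-at : ∀ {j k} → s j ≉ 0# → (∀ i → AtLeast j i) → s (suc (k ℕ.* j)) ≈ 0# →
      ∀ {v} → Pos v → v * v ≈ w j * w j → Ladders.Ladder ℝ v
    ladder-at {j} {k} sⱼ≉0 above s≈0 {v} v-pos v²≈w² = go (least (λ n → nonPos? (σ (suc n))) {k ℕ.* j} last-nonPos)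
      where
      σ : ℕ → Carrier
      σ = sine commutativeRing v
      nonPos? : ∀ x → Dec (¬ Pos x)
      nonPos? x with sign x
      ... | isPos p  = no λ n → n p
      ... | isZero z = yes λ p → pos⇒≉0 p z
      ... | isNeg n  = yes λ p → pos⇒¬neg p n
      σ²≈ : ∀ i → σ i * σ i ≈ sine commutativeRing (w j) i * sine commutativeRing (w j) i
      σ²≈ i = same-square (x²≈y²⇒x≈±y v²≈w²)
        where
        same-square : v ≈ w j ⊎ v ≈ - w j →
          σ i * σ i ≈ sine commutativeRing (w j) i * sine commutativeRing (w j) i
        same-square (inj₁ v≈w)  = *-cong (sine-cong v≈w i) (sine-cong v≈w i)
        same-square (inj₂ v≈-w) = trans (*-cong (sine-cong v≈-w i) (sine-cong v≈-w i)) (sine-neg (w j) i)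
      scaled : ∀ i → s j * s j * (σ i * σ i) ≈ s (i ℕ.* j) * s (i ℕ.* j)
      scaled i = trans (*-congˡ (σ²≈ i)) (trans
        (solve 2 (λ x y → x :* x :* (y :* y) := (y :* x) :* (y :* x)) refl (s j) _)
        (*-cong (sine-*-cosine u j i) (sine-*-cosine u j i)))
      sⱼ²-pos = square-pos sⱼ≉0
      zero-or-≥1 : ∀ i → σ i ≈ 0# ⊎ NonNeg (σ i * σ i - 1#)
      zero-or-≥1 i with above (i ℕ.* j)
      ... | inj₁ z = inj₁ (x²≈0⇒x≈0 (*-cancel-≉0 (pos⇒≉0 sⱼ²-pos) (trans (scaled i) (trans (*-congʳ z) (zeroˡ _)))))
      ... | inj₂ n = inj₂ (nonNeg-cancel sⱼ²-pos (nonNeg-cong (trans (+-congʳ (sym (scaled i)))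
        (solve 2 (λ x y → x :* y :- x := x :* (y :- :1)) refl (s j * s j) (σ i * σ i))) n))
      last-nonPos : ¬ Pos (σ (suc (k ℕ.* j)))
      last-nonPos p = pos⇒≉0 (square-pos (pos⇒≉0 p)) (*-cancel-≉0 (pos⇒≉0 sⱼ²-pos)
        (trans (scaled (suc (k ℕ.* j))) (trans (*-congʳ
          (trans (reflexive (≡.cong s (ℕₚ.*-comm (suc (k ℕ.* j)) j))) (multiple-of-period s≈0 j))) (zeroˡ _))))
      go : (∃[ n ] ¬ Pos (σ (suc n)) × (∀ i → i ℕ.< n → ¬ ¬ Pos (σ (suc i)))) → Ladders.Ladder ℝ v
      go (zero , ¬p , _) = contradiction 1-pos ¬p
      go (suc n , ¬p , below) = Ladders.finiteLadder ℝ v n positive σ₁≈1 σ₂≈0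
        where
        positive : ∀ i → i ℕ.≤ n → Pos (σ (suc i))
        positive i i≤n with sign (σ (suc i))
        ... | isPos p  = p
        ... | isZero z = contradiction (λ p → pos⇒≉0 p z) (below i (ℕ.s≤s i≤n))
        ... | isNeg q  = contradiction (λ p → pos⇒¬neg p q) (below i (ℕ.s≤s i≤n))
        σ₁ = σ (suc n)
        σ₂ = σ (suc (suc n))
        σ₁-pos : Pos σ₁
        σ₁-pos = positive n ℕₚ.≤-refl
        σ₂<1 : Pos (1# - σ₂ * σ₂)
        σ₂<1 = pos-cong (begin
          σ₁ * σ₁ + v * (σ₁ * - σ₂)
            ≈⟨ solve 3 (λ v x y → x :* x :+ v :* (x :* (:- y)) := (y :* y :+ x :* x :- v :* (y :* x)) :- y :* y) refl v σ₁ σ₂ ⟩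
          (σ₂ * σ₂ + σ₁ * σ₁ - v * (σ₂ * σ₁)) - σ₂ * σ₂
            ≈⟨ +-congʳ (sine-invariant v (suc n)) ⟩
          1# - σ₂ * σ₂ ∎)
          (pos-+-nonNeg (*-pos σ₁-pos σ₁-pos)
            (nonNeg-* (pos⇒nonNeg v-pos) (nonNeg-* (pos⇒nonNeg σ₁-pos) (¬pos⇒nonNeg-neg ¬p))))
        σ₂≈0 : σ₂ ≈ 0#
        σ₂≈0 with zero-or-≥1 (suc (suc n))
        ... | inj₁ z = z
        ... | inj₂ m = contradiction
          (pos-cong (solve 1 (λ x → :1 :- x := :- (x :- :1)) refl (σ₂ * σ₂)) σ₂<1) m
        σ₁²≈1 : σ₁ * σ₁ ≈ 1# * 1#
        σ₁²≈1 = begin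
          σ₁ * σ₁
            ≈⟨ solve 2 (λ v x → x :* x := :0 :* :0 :+ x :* x :- v :* (:0 :* x)) refl v σ₁ ⟩
          0# * 0# + σ₁ * σ₁ - v * (0# * σ₁)
            ≈⟨ +-cong (+-congʳ (*-cong σ₂≈0 σ₂≈0)) (-‿cong (*-congˡ (*-congʳ σ₂≈0))) ⟨
          σ₂ * σ₂ + σ₁ * σ₁ - v * (σ₂ * σ₁)  ≈⟨ sine-invariant v (suc n) ⟩
          1#                                 ≈⟨ *-identityˡ 1# ⟨
          1# * 1#                            ∎
        not-minus-1 : σ₁ ≈ 1# ⊎ σ₁ ≈ - 1# → σ₁ ≈ 1#
        not-minus-1 (inj₁ eq) = eq
        not-minus-1 (inj₂ eq) = contradiction (pos-cong (trans (solve 0 (:1 := :- (:- :1)) refl) (-‿cong (sym eq))) 1-pos)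
          (pos⇒¬neg σ₁-pos)
        σ₁≈1 : σ₁ ≈ 1#
        σ₁≈1 = not-minus-1 (x²≈y²⇒x≈±y σ₁²≈1)

    cosine²-shift : ∀ {N} → s N ≈ 0# → ∀ b → w (N ℕ.+ b) * w (N ℕ.+ b) ≈ w b * w b
    cosine²-shift {N} sN≈0 b = sym (x-y≈0⇒x≈y (begin
      w b * w b - w (N ℕ.+ b) * w (N ℕ.+ b)          ≈⟨ cosine²-cosine² u N b ⟩
      (4# - u * u) * (s (N ℕ.+ (b ℕ.+ b)) * s N)     ≈⟨ *-congˡ (trans (*-congˡ sN≈0) (zeroʳ _)) ⟩
      (4# - u * u) * 0#                              ≈⟨ zeroʳ _ ⟩
      0#                                             ∎))

    cosine²≈⇒period : 4# - u * u ≉ 0# → ∀ d a → w (suc d ℕ.+ a) * w (suc d ℕ.+ a) ≈ w a * w a →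
      ∃[ m ] s (suc m) ≈ 0#
    cosine²≈⇒period 4-u²≉0 d a eq = conclude (*≈0⇒≈0⊎≈0 {s (suc d ℕ.+ (a ℕ.+ a))} {s (suc d)}
      (*-cancel-≉0 4-u²≉0 product≈0))
      where
      product≈0 : (4# - u * u) * (s (suc d ℕ.+ (a ℕ.+ a)) * s (suc d)) ≈ 0#
      product≈0 = trans (sym (cosine²-cosine² u (suc d) a)) (x≈y⇒x-y≈0 (sym eq))
      conclude : s (suc (d ℕ.+ (a ℕ.+ a))) ≈ 0# ⊎ s (suc d) ≈ 0# → ∃[ m ] s (suc m) ≈ 0#
      conclude (inj₁ z) = d ℕ.+ (a ℕ.+ a) , z
      conclude (inj₂ z) = d , z

module Polynomials {c ℓ : Level} (R : CommutativeRing c ℓ) where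
  open CommutativeRing R
  open IntegersIn R
  open Evaluation R
  open SetoidReasoning setoid

  -- a₀ + a₁t + ⋯ + aₙ₋₁tⁿ⁻¹ + btⁿ
  eval derivative : ∀ {n} → Carrier → Vec Carrier n → Carrier → Carrier
  eval b []       t = b
  eval b (a ∷ as) t = a + t * eval b as t
  derivative b []       t = 0#
  derivative b (a ∷ as) t = eval b as t + t * derivative b as t

  horner≈eval : ∀ {n} i (v : Vec ℤ n) t → ⟦ horner i v ⟧ t ≈ eval (fromℤ i) (Vec.map fromℤ v) t
  horner≈eval i []      t = refl
  horner≈eval i (a ∷ v) t = +-congˡ (*-congˡ (horner≈eval i v t))

  quotient : ∀ {n} → Carrier → Vec Carrier (suc n) → Carrier → Vec Carrier n
  quotient b (a ∷ [])        z = []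
  quotient b (a ∷ as@(_ ∷ _)) z = eval b as z ∷ quotient b as z

  eval-quotient : ∀ {n} b (v : Vec Carrier (suc n)) z t →
    eval b v t ≈ eval b v z + (t - z) * eval b (quotient b v z) t
  eval-quotient b (a ∷ []) z t =
    solve 4 (λ a b z t → a :+ t :* b := (a :+ z :* b) :+ (t :- z) :* b) refl a b z t
  eval-quotient b (a ∷ as@(_ ∷ _)) z t = trans (+-congˡ (*-congˡ (eval-quotient b as z t)))
    (solve 5 (λ a z t p q → a :+ t :* (p :+ (t :- z) :* q) := (a :+ z :* p) :+ (t :- z) :* (p :+ t :* q)) refl
      a z t (eval b as z) (eval b (quotient b as z) t))

  derivative-quotient : ∀ {n} b (v : Vec Carrier (suc n)) z t →
    derivative b v t ≈ eval b (quotient b v z) t + (t - z) * derivative b (quotient b v z) t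
  derivative-quotient b (a ∷ []) z t =
    solve 3 (λ b z t → b :+ t :* :0 := b :+ (t :- z) :* :0) refl b z t
  derivative-quotient b (a ∷ as@(_ ∷ _)) z t =
    trans (+-cong (eval-quotient b as z t) (*-congˡ (derivative-quotient b as z t)))
      (solve 5 (λ z t p q r → (p :+ (t :- z) :* q) :+ t :* (q :+ (t :- z) :* r)
          := (p :+ t :* q) :+ (t :- z) :* (q :+ t :* r)) refl
        z t (eval b as z) (eval b (quotient b as z) t) (derivative b (quotient b as z) t))

  integerDerivative : ∀ {n} i (v : Vec ℤ (suc n)) → ∃[ w ] ∀ t →
    derivative (fromℤ i) (Vec.map fromℤ v) t ≈ ⟦ horner {n} (+ suc n ℤ.* i) w ⟧ t
  integerDerivative i (a ∷ []) = [] , λ t → trans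
    (solve 2 (λ i t → i :+ t :* :0 := :1 :* i) refl (fromℤ i) t)
    (trans (*-congʳ (sym fromℕ-1)) (sym (fromℤ-* (+ 1) i)))
  integerDerivative {suc n} i (a ∷ as@(_ ∷ _)) with integerDerivative i as
  ... | w , eq = zipWith ℤ._+_ as (+ 0 ∷ w) , λ t → begin
    eval (fromℤ i) (Vec.map fromℤ as) t + t * derivative (fromℤ i) (Vec.map fromℤ as) t
      ≈⟨ +-cong (sym (horner≈eval i as t)) (*-congˡ (eq t)) ⟩
    ⟦ horner i as ⟧ t + t * ⟦ horner (+ suc n ℤ.* i) w ⟧ t
      ≈⟨ +-congˡ (+-identityˡ _) ⟨
    ⟦ horner i as ⟧ t + ⟦ horner (+ suc n ℤ.* i) (+ 0 ∷ w) ⟧ t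
      ≈⟨ horner-+ i (+ suc n ℤ.* i) as (+ 0 ∷ w) t ⟨
    ⟦ horner (i ℤ.+ + suc n ℤ.* i) (zipWith ℤ._+_ as (+ 0 ∷ w)) ⟧ t
      ≡⟨ ≡.cong (λ k → ⟦ horner k (zipWith ℤ._+_ as (+ 0 ∷ w)) ⟧ t) (≡.sym (ℤₚ.suc-* (+ suc n) i)) ⟩
    ⟦ horner (+ suc (suc n) ℤ.* i) (zipWith ℤ._+_ as (+ 0 ∷ w)) ⟧ t ∎
    where
    import Data.Integer.Properties as ℤₚ
    horner-+ : ∀ {m} i j (v w : Vec ℤ m) t →
      ⟦ horner (i ℤ.+ j) (zipWith ℤ._+_ v w) ⟧ t ≈ ⟦ horner i v ⟧ t + ⟦ horner j w ⟧ t
    horner-+ i j []      []      t = fromℤ-+ i j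
    horner-+ i j (x ∷ v) (y ∷ w) t = trans (+-cong (fromℤ-+ x y) (*-congˡ (horner-+ i j v w t)))
      (solve 5 (λ x y t p q → (x :+ y) :+ t :* (p :+ q) := (x :+ t :* p) :+ (y :+ t :* q)) refl
        (fromℤ x) (fromℤ y) t (⟦ horner i v ⟧ t) (⟦ horner j w ⟧ t))

module Interpolation {c ℓ₁ ℓ₂ : Level} (ℝ : RealField c ℓ₁ ℓ₂) where
  open RealField ℝ hiding (zero; fromℤ)
  open FieldProperties underlyingField
  open OrderedField ℝ
  open IntegersIn commutativeRing
    using (fromℤ; solve; _:=_; _:+_; _:*_; _:-_; :-_; :1; :2)
  open Evaluation commutativeRing
  open IntegerPolynomials commutativeRing using (horner-∷ʳ)
  open Polynomials commutativeRing
  open SetoidReasoning setoid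

  expr-bound : ∀ e {ε} → Pos ε → ∃[ C ] Pos C × (∀ {t} → Bounded ε t → Bounded C (⟦ e ⟧ t))
  expr-bound (con i) ε-pos with boundOf (fromℤ i)
  ... | C , C-pos , b = C , C-pos , λ _ → b
  expr-bound X ε-pos = _ , ε-pos , λ b → b
  expr-bound (e ⊕ f) ε-pos with expr-bound e ε-pos | expr-bound f ε-pos
  ... | C , p , b | C′ , p′ , b′ = C + C′ , pos-+ p p′ , λ t → bounded-+ (b t) (b′ t)
  expr-bound (e ⊗ f) ε-pos with expr-bound e ε-pos | expr-bound f ε-pos
  ... | C , p , b | C′ , p′ , b′ = C * C′ , *-pos p p′ , λ t → bounded-* (b t) (b′ t)
  expr-bound (⊝ e) ε-pos with expr-bound e ε-pos
  ... | C , p , b = C , p , λ t → bounded-neg (b t)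

  private
    commonBound : ∀ {n} (ys : Vec Carrier n) → ∃[ M ] Pos M × All (Bounded M) ys
    commonBound [] = 1# , 1-pos , []
    commonBound (y ∷ ys) with boundOf y | commonBound ys
    ... | ε , ε-pos , b | M , M-pos , bs = ε + M , pos-+ ε-pos M-pos
      , bounded-≤ (nonNeg-cong (solve 2 (λ e m → m := (e :+ m) :- e) refl ε M) (pos⇒nonNeg M-pos)) b
        ∷ All.map (bounded-≤ (nonNeg-cong (solve 2 (λ e m → e := (e :+ m) :- m) refl ε M) (pos⇒nonNeg ε-pos))) bs

  leading-bound : ∀ {n} (xs : Vec Carrier (suc n)) → AllPairs _≉_ xs → ∃[ B ] Pos B ×
    (∀ b (v : Vec Carrier n) {ε} → All (λ x → Bounded ε (eval b v x)) xs → Bounded (B * ε) b)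
  leading-bound (x ∷ []) _ = 1# , 1-pos , λ { b [] (p ∷ []) → proj₁ (bounded-1* p) , proj₂ (bounded-1* p) }
    where
    bounded-1* : ∀ {ε y} → Bounded ε y → Bounded (1# * ε) y
    bounded-1* (p , n) = nonNeg-cong (+-congʳ (sym (*-identityˡ _))) p , nonNeg-cong (+-congʳ (sym (*-identityˡ _))) n
  leading-bound {suc n} (x ∷ xs@(_ ∷ _)) (x≉xs ∷ distinct) = B * (M * (1# + 1#))
    , *-pos (proj₁ (proj₂ rest)) (*-pos (proj₁ (proj₂ inverses)) (pos-+ 1-pos 1-pos))
    , λ { b v {ε} (p ∷ ps) → bounded-ε (solve 3 (λ B M e → B :* (M :* (e :+ e)) := B :* (M :* :2) :* e) refl B M ε)
        (proj₂ (proj₂ rest) b (quotient b v x) (quotient-bound b v p xs x≉xs (proj₂ (proj₂ inverses)) ps)) }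
    where
    rest = leading-bound xs distinct
    inverses = commonBound (Vec.map (λ y → (y - x) ⁻¹) xs)
    B = proj₁ rest
    M = proj₁ inverses
    bounded-ε : ∀ {ε δ y} → ε ≈ δ → Bounded ε y → Bounded δ y
    bounded-ε ε≈δ (p , n) = nonNeg-cong (+-congʳ ε≈δ) p , nonNeg-cong (+-congʳ ε≈δ) n
    quotient-bound : ∀ b (v : Vec Carrier (suc n)) {ε} → Bounded ε (eval b v x) →
      ∀ {m} (ys : Vec Carrier m) → All (x ≉_) ys → All (Bounded M) (Vec.map (λ y → (y - x) ⁻¹) ys) →
      All (λ y → Bounded ε (eval b v y)) ys → All (λ y → Bounded (M * (ε + ε)) (eval b (quotient b v x) y)) ys
    quotient-bound b v p [] _ _ _ = []
    quotient-bound b v p (y ∷ ys) (x≉y ∷ x≉ys) (i ∷ is) (r ∷ rs) =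
      bounded-cong (begin
        (y - x) ⁻¹ * (eval b v y - eval b v x)
          ≈⟨ *-congˡ (+-congʳ (eval-quotient b v x y)) ⟩
        (y - x) ⁻¹ * ((eval b v x + (y - x) * eval b (quotient b v x) y) - eval b v x)
          ≈⟨ solve 4 (λ i d p q → i :* ((p :+ d :* q) :- p) := d :* i :* q) refl
               ((y - x) ⁻¹) (y - x) (eval b v x) (eval b (quotient b v x) y) ⟩
        (y - x) * (y - x) ⁻¹ * eval b (quotient b v x) y
          ≈⟨ *-congʳ (⁻¹-inverse (λ y-x≈0 → x≉y (sym (x-y≈0⇒x≈y y-x≈0)))) ⟩
        1# * eval b (quotient b v x) y       ≈⟨ *-identityˡ _ ⟩
        eval b (quotient b v x) y            ∎)
        (bounded-* i (bounded-+ r (bounded-neg p)))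
      ∷ quotient-bound b v p ys x≉ys is rs

  discreteness : ∀ {n} (xs : Vec Carrier n) → AllPairs _≉_ xs → ∃[ B ] Pos B ×
    (∀ (v : Vec ℤ n) {ε} → NonNeg ε → Pos (1# - B * ε) →
      All (λ x → Bounded ε (⟦ horner (+ 0) v ⟧ x)) xs → ∀ t → ⟦ horner (+ 0) v ⟧ t ≈ 0#)
  discreteness [] _ = 1# , 1-pos , λ { [] _ _ _ _ → refl }
  discreteness {suc n} (x ∷ xs) (x≉xs ∷ distinct)
    with leading-bound (x ∷ xs) (x≉xs ∷ distinct) | discreteness xs distinct
  ... | B , B-pos , bound | B′ , B′-pos , rest = B + B′ , pos-+ B-pos B′-pos , vanish
    where
    vanish : ∀ (v : Vec ℤ (suc n)) {ε} → NonNeg ε → Pos (1# - (B + B′) * ε) →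
      All (λ x → Bounded ε (⟦ horner (+ 0) v ⟧ x)) (x ∷ xs) → ∀ t → ⟦ horner (+ 0) v ⟧ t ≈ 0#
    vanish v {ε} ε≥0 small values with initLast v
    ... | w , i , ≡.refl = λ t → trans (horner-∷ʳ w i t) (trans
        (reflexive (≡.cong (λ k → ⟦ horner k w ⟧ t) i≡0))
        (rest w ε≥0
          (pos-cong (solve 3 (λ b c e → (:1 :- (b :+ c) :* e) :+ b :* e := :1 :- c :* e) refl B B′ ε)
            (pos-+-nonNeg small (nonNeg-* (pos⇒nonNeg B-pos) ε≥0)))
          (All.map (λ {y} → bounded-cong (trans (horner-∷ʳ w i y)
            (reflexive (≡.cong (λ k → ⟦ horner k w ⟧ y) i≡0)))) (All.tail values)) t))
      where
      i≡0 : i ≡ + 0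
      i≡0 = bounded<1⇒≡0 i
        (bound (fromℤ i) (Vec.map fromℤ w)
          (All.map (λ {y} → bounded-cong (trans (horner-∷ʳ w i y) (horner≈eval i w y))) values))
        (pos-cong (solve 3 (λ b c e → (:1 :- (b :+ c) :* e) :+ c :* e := :1 :- b :* e) refl B B′ ε)
          (pos-+-nonNeg small (nonNeg-* (pos⇒nonNeg B′-pos) ε≥0)))

i^n≢0 : ∀ {i} n → i ≢ + 0 → i ℤ.^ n ≢ + 0
i^n≢0 {i} n i≢0 eq = i≢0 (ℤₚ.i^n≡0⇒i≡0 i n eq)

i*j≢0 : ∀ {i j} → i ≢ + 0 → j ≢ + 0 → i ℤ.* j ≢ + 0
i*j≢0 {i} i≢0 j≢0 eq with ℤₚ.i*j≡0⇒i≡0∨j≡0 i eq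
... | inj₁ z = i≢0 z
... | inj₂ z = j≢0 z

module MinimalPolynomials {c ℓ : Level} (F : Field c ℓ)
    (characteristic-0 : ∀ n → ¬ Field._≈_ F (Field.fromℕ F (suc n)) (Field.0# F)) where
  open Field F hiding (zero) renaming (fromℤ to fromℤ′)
  open FieldProperties F
  open IntegersIn commutativeRing
    using (fromℤ; fromℤ-*; fromℤ-neg; solve; _:=_; _:+_; _:*_; _:-_; :-_; :0)
  open Evaluation commutativeRing
  open IntegerPolynomials commutativeRing
  open Polynomials commutativeRing
  open SetoidReasoning setoid

  private
    fromℤ′≡ : ∀ i → fromℤ′ i ≡ fromℤ i
    fromℤ′≡ (+ n)    = ≡.refl
    fromℤ′≡ -[1+ n ] = ≡.refl

  fromℤ≉0 : ∀ {i} → i ≢ + 0 → fromℤ i ≉ 0#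
  fromℤ≉0 {+ zero}   i≢0 _  = i≢0 ≡.refl
  fromℤ≉0 {+ suc n}  _   eq = characteristic-0 n eq
  fromℤ≉0 { -[1+ n ]} _  eq = characteristic-0 n (trans (solve 1 (λ x → x := :- (:- x)) refl _)
    (trans (-‿cong eq) (solve 0 (:- :0 := :0) refl)))

  evalMonic≈eval : ∀ {n} (p : Vec Carrier n) t → evalMonic p t ≈ eval 1# p t
  evalMonic≈eval []      t = refl
  evalMonic≈eval (a ∷ p) t = +-congˡ (*-congˡ (evalMonic≈eval p t))

  IsMultiple : Carrier → ∀ {n} → Vec Carrier n → Vec Carrier n → Set (c ⊔ ℓ)
  IsMultiple k = Pointwise (λ a b → k * a ≈ b)

  eval-multiple : ∀ {n k b b′} {v w : Vec Carrier n} → IsMultiple k v w → k * b ≈ b′ →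
    ∀ t → k * eval b v t ≈ eval b′ w t
  eval-multiple [] eq t = eq
  eval-multiple {k = k} {b = b} {v = x ∷ v} (p ∷ ps) eq t = trans
    (solve 4 (λ k x t y → k :* (x :+ t :* y) := k :* x :+ t :* (k :* y)) refl k x t (eval b v t))
    (+-cong p (*-congˡ (eval-multiple ps eq t)))

  derivative-multiple : ∀ {n k b b′} {v w : Vec Carrier n} → IsMultiple k v w → k * b ≈ b′ →
    ∀ t → k * derivative b v t ≈ derivative b′ w t
  derivative-multiple [] eq t = zeroʳ _
  derivative-multiple {k = k} {b = b} {v = x ∷ v} (p ∷ ps) eq t = trans
    (solve 4 (λ k y t z → k :* (y :+ t :* z) := k :* y :+ t :* (k :* z)) refl k (eval b v t) t (derivative b v t))
    (+-cong (eval-multiple ps eq t) (*-congˡ (derivative-multiple ps eq t)))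

  private
    denominator-* : ∀ r → fromℤ (↧ r) * fromℚ r ≈ fromℤ (↥ r)
    denominator-* r = begin
      fromℕ (↧ₙ r) * (fromℤ′ (↥ r) * fromℕ (↧ₙ r) ⁻¹)
        ≈⟨ solve 3 (λ d n i → d :* (n :* i) := (d :* i) :* n) refl (fromℕ (↧ₙ r)) (fromℤ′ (↥ r)) (fromℕ (↧ₙ r) ⁻¹) ⟩
      (fromℕ (↧ₙ r) * fromℕ (↧ₙ r) ⁻¹) * fromℤ′ (↥ r)
        ≈⟨ *-congʳ (⁻¹-inverse (characteristic-0 (ℚ.denominator-1 r))) ⟩
      1# * fromℤ′ (↥ r)                ≈⟨ *-identityˡ _ ⟩
      fromℤ′ (↥ r)                     ≡⟨ fromℤ′≡ (↥ r) ⟩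
      fromℤ (↥ r)                      ∎

  clearDenominators : ∀ {n} (p : Vec ℚ n) → ∃[ d ] d ≢ + 0 × ∃[ v ]
    IsMultiple (fromℤ d) (Vec.map fromℚ p) (Vec.map fromℤ v)
  clearDenominators [] = + 1 , (λ ()) , [] , []
  clearDenominators (r ∷ p) with clearDenominators p
  ... | d , d≢0 , v , multiple = ↧ r ℤ.* d , i*j≢0 {↧ r} (λ ()) d≢0 , d ℤ.* ↥ r ∷ Vec.map (↧ r ℤ.*_) v
    , (begin
      fromℤ (↧ r ℤ.* d) * fromℚ r           ≈⟨ *-congʳ (fromℤ-* (↧ r) d) ⟩
      fromℤ (↧ r) * fromℤ d * fromℚ r       ≈⟨ solve 3 (λ x d y → x :* d :* y := d :* (x :* y)) refl (fromℤ (↧ r)) (fromℤ d) (fromℚ r) ⟩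
      fromℤ d * (fromℤ (↧ r) * fromℚ r)     ≈⟨ *-congˡ (denominator-* r) ⟩
      fromℤ d * fromℤ (↥ r)                 ≈⟨ fromℤ-* d (↥ r) ⟨
      fromℤ (d ℤ.* ↥ r)                     ∎)
    ∷ scale p v multiple
    where
    scale : ∀ {m} (p : Vec ℚ m) (v : Vec ℤ m) → IsMultiple (fromℤ d) (Vec.map fromℚ p) (Vec.map fromℤ v) →
      IsMultiple (fromℤ (↧ r ℤ.* d)) (Vec.map fromℚ p) (Vec.map fromℤ (Vec.map (↧ r ℤ.*_) v))
    scale [] [] [] = []
    scale (x ∷ p) (y ∷ v) (eq ∷ eqs) = (begin
      fromℤ (↧ r ℤ.* d) * fromℚ x          ≈⟨ *-congʳ (fromℤ-* (↧ r) d) ⟩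
      fromℤ (↧ r) * fromℤ d * fromℚ x      ≈⟨ *-assoc _ _ _ ⟩
      fromℤ (↧ r) * (fromℤ d * fromℚ x)    ≈⟨ *-congˡ eq ⟩
      fromℤ (↧ r) * fromℤ y                ≈⟨ fromℤ-* (↧ r) y ⟨
      fromℤ (↧ r ℤ.* y)                    ∎) ∷ scale p v eqs

  private
    fromℚ-/ : ∀ i n → fromℕ (suc n) * fromℚ (i / suc n) ≈ fromℤ i
    fromℚ-/ i n = *-cancelˡ-≉0 (fromℤ≉0 {↧ r} λ ()) (begin
      fromℤ (↧ r) * (fromℕ (suc n) * fromℚ r)
        ≈⟨ solve 3 (λ x d y → x :* (d :* y) := d :* (x :* y)) refl (fromℤ (↧ r)) (fromℕ (suc n)) (fromℚ r) ⟩
      fromℕ (suc n) * (fromℤ (↧ r) * fromℚ r)   ≈⟨ *-congˡ (denominator-* r) ⟩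
      fromℤ (+ suc n) * fromℤ (↥ r)             ≈⟨ fromℤ-* (+ suc n) (↥ r) ⟨
      fromℤ (+ suc n ℤ.* ↥ r)                   ≡⟨ ≡.cong fromℤ cross ⟩
      fromℤ (↧ r ℤ.* i)                         ≈⟨ fromℤ-* (↧ r) i ⟩
      fromℤ (↧ r) * fromℤ i                     ∎)
      where
      r = i / suc n
      g = gcd i (+ suc n)
      cross : + suc n ℤ.* ↥ r ≡ ↧ r ℤ.* i
      cross = ≡.trans (≡.cong (ℤ._* ↥ r) (≡.sym (ℚₚ.↧-/ i (suc n))))
        (≡.trans (ℤₚ.*-assoc (↧ r) g (↥ r))
        (≡.cong (↧ r ℤ.*_) (≡.trans (ℤₚ.*-comm g (↥ r)) (ℚₚ.↥-/ i (suc n)))))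

    divide : ∀ i k → k ≢ + 0 → ∃[ r ] fromℤ k * fromℚ r ≈ fromℤ i
    divide i (+ zero)  k≢0 = contradiction ≡.refl k≢0
    divide i (+ suc n) _   = i / suc n , fromℚ-/ i n
    divide i -[1+ n ]  _   = (ℤ.- i) / suc n , trans
      (solve 2 (λ k x → (:- k) :* x := :- (k :* x)) refl _ _)
      (trans (-‿cong (trans (fromℚ-/ (ℤ.- i) n) (fromℤ-neg i))) (solve 1 (λ x → :- (:- x) := x) refl _))

  toMonic : ∀ {m} k → k ≢ + 0 → (v : Vec ℤ m) → ∃[ p ] IsMultiple (fromℤ k) (Vec.map fromℚ p) (Vec.map fromℤ v)
  toMonic k k≢0 [] = [] , []
  toMonic k k≢0 (i ∷ v) with divide i k k≢0 | toMonic k k≢0 v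
  ... | r , eq | p , eqs = r ∷ p , eq ∷ eqs

  ⟦horner⟧≈evalMonic : ∀ {m k} {v : Vec ℤ m} {p} → IsMultiple (fromℤ k) (Vec.map fromℚ p) (Vec.map fromℤ v) →
    ∀ t → ⟦ horner k v ⟧ t ≈ fromℤ k * evalMonic (Vec.map fromℚ p) t
  ⟦horner⟧≈evalMonic {k = k} {v} {p} multiple t = trans (horner≈eval k v t)
    (trans (sym (eval-multiple multiple (*-identityʳ _) t)) (*-congˡ (sym (evalMonic≈eval (Vec.map fromℚ p) t))))

  minimal-degree : ∀ {n α} {f : Vec ℚ n} → IsMinimalPolynomial f α →
    ∀ {m k} (v : Vec ℤ m) → k ≢ + 0 → ⟦ horner k v ⟧ α ≈ 0# → n ℕ.≤ m
  minimal-degree (_ , minimal) {k = k} v k≢0 eq with toMonic k k≢0 v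
  ... | p , multiple = minimal p
    (*-cancel-≉0 (fromℤ≉0 k≢0) (trans (sym (⟦horner⟧≈evalMonic {p = p} multiple _)) eq))

  module Irreducible {n α d} (h : Vec ℤ n) (d≢0 : d ≢ + 0)
      (minimal : ∀ {m k} (v : Vec ℤ m) → k ≢ + 0 → ⟦ horner k v ⟧ α ≈ 0# → n ℕ.≤ m)
      (α-root : ⟦ horner d h ⟧ α ≈ 0#) where

    Root : Carrier → Set ℓ
    Root β = ⟦ horner d h ⟧ β ≈ 0#

    private
      strip : ∀ {β b} → (∀ {m k} (v : Vec ℤ m) → m ℕ.< b → k ≢ + 0 → ⟦ horner k v ⟧ β ≉ 0#) →
        ∀ {m} (v : Vec ℤ m) → m ℕ.≤ b → ⟦ horner (+ 0) v ⟧ β ≈ 0# → ∀ t → ⟦ horner (+ 0) v ⟧ t ≈ 0#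
      strip nonvanishing {zero} [] _ _ t = refl
      strip nonvanishing {suc m} v m<b eq with initLast v
      ... | w , k , ≡.refl with k ℤₚ.≟ + 0
      ...   | no k≢0 = contradiction (trans (sym (horner-∷ʳ w k _)) eq) (nonvanishing w m<b k≢0)
      ...   | yes ≡.refl = λ t → trans (horner-∷ʳ w (+ 0) t)
        (strip nonvanishing w (ℕₚ.<⇒≤ m<b) (trans (sym (horner-∷ʳ w (+ 0) _)) eq) t)

    -- Dividing the minimal polynomial H by v with v(β) = 0 leaves the remainder 0,
    -- so α is a root of v or of the quotient, both of smaller degree.
    nonvanishing-below : ∀ {β} → Root β → ∀ b → b ℕ.≤ n →
      ∀ {m k} (v : Vec ℤ m) → m ℕ.< b → k ≢ + 0 → ⟦ horner k v ⟧ β ≉ 0#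
    nonvanishing-below {β} β-root (suc b) b<n {m} {k} v (ℕ.s≤s m≤b) k≢0 v≈0
      with Division.division-≤ k v (ℕₚ.≤-trans m≤b (ℕₚ.<⇒≤ b<n)) d h
    ... | j , j+m≡n , quot , r , division = conclude (*≈0⇒≈0⊎≈0 product≈0)
      where
      r≈0 : ∀ t → ⟦ horner (+ 0) r ⟧ t ≈ 0#
      r≈0 = strip (nonvanishing-below β-root b (ℕₚ.<⇒≤ b<n)) r m≤b (begin
        ⟦ horner (+ 0) r ⟧ β                  ≈⟨ +-identityˡ _ ⟨
        0# + ⟦ horner (+ 0) r ⟧ β             ≈⟨ +-congʳ (trans (*-congʳ v≈0) (zeroˡ _)) ⟨
        ⟦ horner k v ⟧ β * ⟦ horner (k ℤ.^ j ℤ.* d) quot ⟧ β + ⟦ horner (+ 0) r ⟧ β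
                                              ≈⟨ division β ⟨
        fromℤ (k ℤ.^ suc j) * ⟦ horner d h ⟧ β  ≈⟨ trans (*-congˡ β-root) (zeroʳ _) ⟩
        0#                                    ∎)
      product≈0 : ⟦ horner k v ⟧ α * ⟦ horner (k ℤ.^ j ℤ.* d) quot ⟧ α ≈ 0#
      product≈0 = begin
        ⟦ horner k v ⟧ α * ⟦ horner (k ℤ.^ j ℤ.* d) quot ⟧ α
          ≈⟨ +-identityʳ _ ⟨
        ⟦ horner k v ⟧ α * ⟦ horner (k ℤ.^ j ℤ.* d) quot ⟧ α + 0#
          ≈⟨ +-congˡ (r≈0 α) ⟨
        ⟦ horner k v ⟧ α * ⟦ horner (k ℤ.^ j ℤ.* d) quot ⟧ α + ⟦ horner (+ 0) r ⟧ α
          ≈⟨ division α ⟨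
        fromℤ (k ℤ.^ suc j) * ⟦ horner d h ⟧ α
          ≈⟨ trans (*-congˡ α-root) (zeroʳ _) ⟩
        0# ∎
      m<n : m ℕ.< n
      m<n = ℕₚ.≤-<-trans m≤b b<n
      m≢0 : m ≢ 0
      m≢0 m≡0 = constant v m≡0 v≈0
        where
        constant : ∀ {m} (v : Vec ℤ m) → m ≡ 0 → ⟦ horner k v ⟧ β ≉ 0#
        constant [] _ = fromℤ≉0 k≢0
      conclude : ¬ (⟦ horner k v ⟧ α ≈ 0# ⊎ ⟦ horner (k ℤ.^ j ℤ.* d) quot ⟧ α ≈ 0#)
      conclude (inj₁ z) = ℕₚ.<⇒≱ m<n (minimal v k≢0 z)
      conclude (inj₂ z) = ℕₚ.<⇒≱ (≡.subst (j ℕ.<_) j+m≡n (ℕₚ.m<m+n j (ℕₚ.n≢0⇒n>0 m≢0)))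
        (minimal quot (i*j≢0 (i^n≢0 j k≢0) d≢0) z)

    nonvanishing : ∀ {β} → Root β → ∀ {m k} (v : Vec ℤ m) → m ℕ.< n → k ≢ + 0 → ⟦ horner k v ⟧ β ≉ 0#
    nonvanishing β-root = nonvanishing-below β-root n ℕₚ.≤-refl

    vanishing : ∀ {β} → Root β → (v : Vec ℤ n) → ⟦ horner (+ 0) v ⟧ β ≈ 0# → ∀ t → ⟦ horner (+ 0) v ⟧ t ≈ 0#
    vanishing β-root v = strip (nonvanishing β-root) v ℕₚ.≤-refl

    transfer : ∀ {β γ} → Root β → Root γ → ∀ e → ⟦ e ⟧ β ≈ 0# → ⟦ e ⟧ γ ≈ 0#
    transfer {β} {γ} β-root γ-root e eq with Division.reduce d h e
    ... | l , r , reduction = *-cancel-≉0 (fromℤ≉0 (i^n≢0 l d≢0)) (trans (reduction γ γ-root)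
      (vanishing β-root r (trans (sym (reduction β β-root)) (trans (*-congˡ eq) (zeroʳ _))) γ))

  productOfRoots derivativeOfProduct : ∀ {n} → Vec Carrier n → Carrier → Carrier
  productOfRoots []       t = 1#
  productOfRoots (z ∷ zs) t = (t - z) * productOfRoots zs t
  derivativeOfProduct []       t = 0#
  derivativeOfProduct (z ∷ zs) t = productOfRoots zs t + (t - z) * derivativeOfProduct zs t

  linearFactors : IsAlgebraicallyClosed → ∀ {n} (p : Vec Carrier n) → ∃[ zs ] ∀ t →
    eval 1# p t ≈ productOfRoots {n} zs t × derivative 1# p t ≈ derivativeOfProduct zs t
  linearFactors closed [] = [] , λ t → refl , refl
  linearFactors closed p@(_ ∷ _) with closed p
  ... | z , root with linearFactors closed (quotient 1# p z)
  ... | zs , eq = z ∷ zs , λ t →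
    trans (eval-quotient 1# p z t)
      (trans (+-cong (trans (sym (evalMonic≈eval p z)) root) (*-congˡ (proj₁ (eq t)))) (+-identityˡ _))
    , trans (derivative-quotient 1# p z t) (+-cong (proj₁ (eq t)) (*-congˡ (proj₂ (eq t))))

  productOfRoots-root : ∀ {n} (zs : Vec Carrier n) {t} → productOfRoots zs t ≈ 0# → Any (t ≈_) zs
  productOfRoots-root [] eq = contradiction eq 1≉0
  productOfRoots-root (z ∷ zs) eq with *≈0⇒≈0⊎≈0 eq
  ... | inj₁ t-z≈0 = here (x-y≈0⇒x≈y t-z≈0)
  ... | inj₂ eq′   = there (productOfRoots-root zs eq′)

  productOfRoots-any : ∀ {n} {zs : Vec Carrier n} {t} → Any (t ≈_) zs → productOfRoots zs t ≈ 0#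
  productOfRoots-any (here t≈z)  = trans (*-congʳ (x≈y⇒x-y≈0 t≈z)) (zeroˡ _)
  productOfRoots-any (there any) = trans (*-congˡ (productOfRoots-any any)) (zeroʳ _)

  simple⇒distinct : ∀ {n} (zs : Vec Carrier n) →
    (∀ {z} → Any (z ≈_) zs → derivativeOfProduct zs z ≉ 0#) → AllPairs _≉_ zs
  simple⇒distinct [] simple = []
  simple⇒distinct (z ∷ zs) simple =
    ≉-all zs (λ any → simple (here refl) (trans
      (+-cong (productOfRoots-any any) (trans (*-congʳ (-‿inverseʳ z)) (zeroˡ _))) (+-identityˡ 0#)))
    ∷ simple⇒distinct zs λ any eq → simple (there any) (trans
      (+-cong (productOfRoots-any any) (trans (*-congˡ eq) (zeroʳ _))) (+-identityˡ 0#))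
    where
    ≉-all : ∀ {m} (ys : Vec Carrier m) → ¬ Any (z ≈_) ys → All (z ≉_) ys
    ≉-all []       _    = []
    ≉-all (y ∷ ys) none = (λ z≈y → none (here z≈y)) ∷ ≉-all ys (λ any → none (there any))

prime≥ : ∀ b → ∃[ p ] Prime p × b ℕ.≤ p
prime≥ b with factorise (primesNotDividing 2 b ℕ.* 1 ℕ.+ 2) {{ℕ.>-nonZero (ℕₚ.<-≤-trans ℕ.z<s (ℕₚ.m≤n+m 2 _))}}
... | record { factors = p ∷ ps ; isFactorisation = eq ; factorsPrime = p-prime ∷ _ } =
  p , p-prime , avoidPrimes 2 0 b p-prime (≡.subst (p ∣_) (≡.sym eq) (∈⇒∣product {ns = p ∷ ps} (here ≡.refl)))
... | record { factors = [] ; isFactorisation = eq } =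
  contradiction (≡.subst (2 ℕ.≤_) eq (ℕₚ.m≤n+m 2 (primesNotDividing 2 b ℕ.* 1))) λ { (ℕ.s≤s ()) }

module HeckeConjugate {c ℓ₁ ℓ₂ : Level} (ℝ : RealField c ℓ₁ ℓ₂) where
  open RealField ℝ hiding (zero; fromℤ)
  open FieldProperties underlyingField
  open OrderedField ℝ
  open Chebyshev commutativeRing
  open Trigonometry ℝ

  private
    4# : Carrier
    4# = (1# + 1#) + (1# + 1#)
    multiple′ : Carrier → ℕ → Carrier
    multiple′ = multiple commutativeRing

  -- Here the admissible k are those for which 4 cos² kθ is a conjugate of
  -- q = 4 cos² θ; they include those without prime factors below b.
  module _ {q : Carrier} (q>0 : Pos q) (q<4 : Pos (4# - q)) (b : ℕ) {a} (Admissible : ℕ → Set a)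
      (admissible-1 : Admissible 1)
      (admissible-* : ∀ {p k} → Prime p → b ℕ.≤ p → Admissible k → Admissible (p ℕ.* k))
      (admissible-pos : ∀ k → Admissible k → Pos (multiple′ q k)) where
    private
      u : Carrier
      u = √ q
      u²≈q : u * u ≈ q
      u²≈q = √-square q>0
      s w : ℕ → Carrier
      s = sine commutativeRing u
      w = cosine commutativeRing u

      multiple≈w² : ∀ k → multiple′ q k ≈ w k * w k
      multiple≈w² k = trans (multiple-cong (sym u²≈q) k) (multiple≈cosine² u k)

      admissible-product : ∀ ps → ListAll.All Prime ps → (∀ {p} → p ∈ ps → b ℕ.≤ p) → Admissible (productℕ ps)
      admissible-product []       []             _     = admissible-1
      admissible-product (p ∷ ps) (p-prime ∷ primes) large =
        admissible-* p-prime (large (here ≡.refl)) (admissible-product ps primes (λ p∈ → large (there p∈)))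

    admissible : ∀ k → .{{NonZero k}} → (∀ {p} → Prime p → p ∣ k → b ℕ.≤ p) → Admissible k
    admissible k large with factorise k
    ... | record { factors = ps ; isFactorisation = ≡.refl ; factorsPrime = primes } =
      admissible-product ps primes λ p∈ps → large (ListAll.lookup primes p∈ps) (∈⇒∣product p∈ps)

    ¬¬ladder : ∀ {i j} → i ℕ.< j →
      multiple′ q i ≈ multiple′ q j →
      ¬ (∀ k → Admissible k → ∀ {v} → Pos v → v * v ≈ multiple′ q k → ¬ Ladders.Ladder ℝ v)
    ¬¬ladder {i} {j} i<j eq noLadder with ℕₚ.m≤n⇒∃[o]m+o≡n i<j
    ... | d , ≡.refl = ¬all≉0 u {m} s≈0 sⱼ≉0 above λ k s≈0′ →
      noLadder (j′ k) (j′-admissible k) {√ (multiple′ q (j′ k))}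
        (√-pos (positive k)) (√-square (positive k))
        (ladder-at u {jₘ} {k} sⱼ≉0 above s≈0′ (√-pos (positive k))
          (trans (√-square (positive k)) (multiple≈ k s≈0′)))
      where
      period : ∃[ m ] s (suc m) ≈ 0#
      period = cosine²≈⇒period u (λ 4-u²≈0 → pos⇒≉0 q<4 (trans (+-congˡ (-‿cong (sym u²≈q))) 4-u²≈0)) d i
        (trans (sym (multiple≈w² (suc d ℕ.+ i))) (trans
          (reflexive (≡.cong (λ k → multiple′ q (suc k)) (ℕₚ.+-comm d i)))
          (trans (sym eq) (multiple≈w² i))))
      m = proj₁ period
      s≈0 = proj₂ period
      jₘ = proj₁ (smallest u {m} s≈0)
      sⱼ≉0 : s jₘ ≉ 0#
      sⱼ≉0 = proj₁ (proj₂ (smallest u {m} s≈0))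
      above : ∀ i → AtLeast u jₘ i
      above = proj₂ (proj₂ (smallest u {m} s≈0))
      period-multiple j′ : ℕ → ℕ
      period-multiple k = primesNotDividing jₘ b ℕ.* suc (k ℕ.* jₘ)
      j′ k = period-multiple k ℕ.+ jₘ
      jₘ≢0 : jₘ ≢ 0
      jₘ≢0 eq = sⱼ≉0 (reflexive (≡.cong s eq))
      j′-admissible : ∀ k → Admissible (j′ k)
      j′-admissible k = admissible (j′ k) {{ℕ.≢-nonZero λ eq → jₘ≢0 (ℕₚ.m+n≡0⇒n≡0 (period-multiple k) eq)}}
        (avoidPrimes jₘ k b)
      multiple≈ : ∀ k → s (suc (k ℕ.* jₘ)) ≈ 0# → multiple′ q (j′ k) ≈ w jₘ * w jₘ
      multiple≈ k s≈0′ = trans (multiple≈w² (j′ k))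
        (cosine²-shift u {period-multiple k} (multiple-of-period u {k ℕ.* jₘ} s≈0′ (primesNotDividing jₘ b)) jₘ)
      positive : ∀ k → Pos (multiple′ q (j′ k))
      positive k = admissible-pos (j′ k) (j′-admissible k)

module LargePrimes {c ℓ₁ ℓ₂ : Level} (ℝ : RealField c ℓ₁ ℓ₂) where
  open RealField ℝ hiding (zero; fromℤ)
  open FieldProperties underlyingField
  open OrderedField ℝ
  open IntegersIn commutativeRing
    using (fromℤ; fromℤ-+; fromℕ-1; solve; _:=_; _:+_; _:*_; _:-_; :-_; :1)
  open Evaluation commutativeRing
  open IntegerPolynomials commutativeRing
  open Interpolation ℝ
  open Chebyshev commutativeRing
  open SetoidReasoning setoid

  private
    4# : Carrier
    4# = (1# + 1#) + (1# + 1#)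
    multiple′ : Carrier → ℕ → Carrier
    multiple′ = multiple commutativeRing

  multiple-bounded : ∀ {x} → Pos x → Pos (4# - x) → ∀ k → Bounded 4# (multiple′ x k)
  multiple-bounded {x} x>0 x<4 k = bounded-cong w²≈
    ( nonNeg-cong (sym (4-cosine² u k)) (nonNeg-* (nonNeg-cong (+-congˡ (-‿cong (sym u²≈x))) (pos⇒nonNeg x<4)) (square-nonNeg _))
    , nonNeg-+ (pos⇒nonNeg (pos-+ (pos-+ 1-pos 1-pos) (pos-+ 1-pos 1-pos))) (square-nonNeg _))
    where
    u = √ x
    u²≈x : u * u ≈ x
    u²≈x = √-square x>0
    w = cosine commutativeRing u k
    w²≈ : w * w ≈ multiple′ x k
    w²≈ = trans (sym (multiple≈cosine² u k)) (multiple-cong u²≈x k)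

  horner≈fromCoefficients : ∀ {n} (v : Vec ℤ n) t → ⟦ horner (+ 0) v ⟧ t ≈ ⟦ fromCoefficients (Vec.toList v) ⟧ t
  horner≈fromCoefficients []      t = refl
  horner≈fromCoefficients (a ∷ v) t = +-congˡ (*-congˡ (horner≈fromCoefficients v t))

  module _ {n m d} (h : Vec ℤ n) (d≢0 : d ≢ + 0) (g : Vec ℤ m) where
    Good : Carrier → Set _
    Good x = ⟦ horner d h ⟧ x ≈ 0# × ⟦ horner (+ 1) g ⟧ x ≈ 0# × Pos x × Pos (4# - x)

    -- The factor dᵐ does not depend on y.
    reduce-bounded : ∀ y → ∃[ r ] ∀ t → ⟦ horner d h ⟧ t ≈ 0# → ⟦ horner (+ 1) g ⟧ t ≈ 0# →
      fromℤ (d ℤ.^ m) * ⟦ y ⟧ t ≈ ⟦ horner {n} (+ 0) r ⟧ t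
    reduce-bounded y with Division.reduce (+ 1) g y
    ... | l , r , eq with Division.reduceList d h (Vec.toList r)
    ...   | r′ , eq′ = r′ , λ t h≈0 g≈0 → begin
      fromℤ (d ℤ.^ m) * ⟦ y ⟧ t
        ≈⟨ *-congˡ (trans (sym (*-identityˡ _)) (*-congʳ (sym (trans (reflexive (≡.cong fromℤ (ℤₚ.^-zeroˡ l))) fromℕ-1)))) ⟩
      fromℤ (d ℤ.^ m) * (fromℤ ((+ 1) ℤ.^ l) * ⟦ y ⟧ t)
        ≈⟨ *-congˡ (trans (eq t g≈0) (horner≈fromCoefficients r t)) ⟩
      fromℤ (d ℤ.^ m) * ⟦ fromCoefficients (Vec.toList r) ⟧ t
        ≡⟨ ≡.cong (λ k → fromℤ (d ℤ.^ k) * ⟦ fromCoefficients (Vec.toList r) ⟧ t) (≡.sym (Vecₚ.length-toList r)) ⟩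
      fromℤ (d ℤ.^ List.length (Vec.toList r)) * ⟦ fromCoefficients (Vec.toList r) ⟧ t
        ≈⟨ eq′ t h≈0 ⟩
      ⟦ horner (+ 0) r′ ⟧ t ∎

    -- By Frobenius, h(multiple x p) = p y(x) for an integer polynomial y, whose values at
    -- the conjugates x are O(1/p), hence 0 for large p.
    large-primes : (xs : Vec Carrier n) → AllPairs _≉_ xs → All Good xs →
      ∃[ b ] ∀ {p} → Prime p → b ℕ.≤ p → All (λ x → ⟦ horner d h ⟧ (multiple′ x p) ≈ 0#) xs
    large-primes xs distinct good = b , λ {p} p-prime b≤p → conclusion p p-prime b≤p
      where
      discrete = discreteness xs distinct
      B = proj₁ discrete
      B-pos : Pos B
      B-pos = proj₁ (proj₂ discrete)
      value = expr-bound (horner d h) {4#} (pos-+ (pos-+ 1-pos 1-pos) (pos-+ 1-pos 1-pos))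
      C = proj₁ value
      C-pos : Pos C
      C-pos = proj₁ (proj₂ value)
      power = boundOf (fromℤ (d ℤ.^ m))
      E = proj₁ power
      E-pos : Pos E
      E-pos = proj₁ (proj₂ power)
      b = proj₁ (archimedean (B * (E * C)))
      BEC<b : Pos (fromℕ b - B * (E * C))
      BEC<b = <⇒Pos (proj₂ (archimedean (B * (E * C))))
      conclusion : ∀ p → Prime p → b ℕ.≤ p → All (λ x → ⟦ horner d h ⟧ (multiple′ x p) ≈ 0#) xs
      conclusion p p-prime b≤p = All.map vanish good
        where
        frobenius = multiple-frobenius-polynomial commutativeRing (horner d h) p-prime
        y = proj₁ frobenius
        remainder = reduce-bounded y
        r = proj₁ remainder
        BEC<p : Pos (fromℕ p - B * (E * C))
        BEC<p with ℕₚ.m≤n⇒∃[o]m+o≡n b≤p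
        ... | o , ≡.refl = pos-cong (trans
          (solve 3 (λ b o z → (b :- z) :+ o := (b :+ o) :- z) refl (fromℕ b) (fromℕ o) (B * (E * C)))
          (+-congʳ (sym (fromℤ-+ (+ b) (+ o))))) (pos-+-nonNeg BEC<b (fromℕ-nonNeg o))
        p-pos : Pos (fromℕ p)
        p-pos = pos-cong (solve 2 (λ p z → (p :- z) :+ z := p) refl (fromℕ p) (B * (E * C)))
          (pos-+ BEC<p (*-pos B-pos (*-pos E-pos C-pos)))
        p⁻¹ = fromℕ p ⁻¹
        pp⁻¹≈1 : fromℕ p * p⁻¹ ≈ 1#
        pp⁻¹≈1 = ⁻¹-inverse (pos⇒≉0 p-pos)
        0^p : ∀ {z} → z ≈ 0# → z ^ p ≈ 0#
        0^p z≈0 = go p p-prime z≈0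
          where
          go : ∀ p → Prime p → ∀ {z} → z ≈ 0# → z ^ p ≈ 0#
          go zero    0-prime _   = contradiction 0-prime λ ()
          go (suc k) _       z≈0 = trans (*-congʳ z≈0) (zeroˡ _)
        value≈ : ∀ {x} → Good x → ⟦ horner d h ⟧ (multiple′ x p) ≈ fromℕ p * ⟦ y ⟧ x
        value≈ {x} (h≈0 , _) = trans (proj₂ frobenius x) (trans (+-congʳ (0^p h≈0)) (+-identityˡ _))
        ε = p⁻¹ * (E * C)
        small : Pos (1# - B * ε)
        small = pos-cancel p-pos (pos-cong (trans (+-congʳ (sym (*-identityʳ _)))
          (trans (+-congˡ (-‿cong (trans (sym (*-identityˡ _)) (*-congʳ (sym pp⁻¹≈1)))))
          (solve 4 (λ p i B z → p :* :1 :- p :* i :* (B :* z) := p :* (:1 :- B :* (i :* z))) refl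
            (fromℕ p) p⁻¹ B (E * C)))) BEC<p)
        bounded : ∀ {x} → Good x → Bounded ε (⟦ horner (+ 0) r ⟧ x)
        bounded {x} x-good@(h≈0 , g≈0 , x>0 , x<4) = bounded-cong (begin
          p⁻¹ * (fromℤ (d ℤ.^ m) * ⟦ horner d h ⟧ (multiple′ x p))
            ≈⟨ *-congˡ (*-congˡ (value≈ x-good)) ⟩
          p⁻¹ * (fromℤ (d ℤ.^ m) * (fromℕ p * ⟦ y ⟧ x))
            ≈⟨ solve 4 (λ i e p y → i :* (e :* (p :* y)) := p :* i :* (e :* y)) refl p⁻¹ (fromℤ (d ℤ.^ m)) (fromℕ p) (⟦ y ⟧ x) ⟩
          fromℕ p * p⁻¹ * (fromℤ (d ℤ.^ m) * ⟦ y ⟧ x)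
            ≈⟨ trans (*-congʳ pp⁻¹≈1) (*-identityˡ _) ⟩
          fromℤ (d ℤ.^ m) * ⟦ y ⟧ x
            ≈⟨ proj₂ remainder x h≈0 g≈0 ⟩
          ⟦ horner (+ 0) r ⟧ x ∎)
          (bounded-* (bounded-self (pos⇒nonNeg (⁻¹-pos p-pos)))
            (bounded-* (proj₂ (proj₂ power)) (proj₂ (proj₂ value) (multiple-bounded x>0 x<4 p))))
        r≈0 : ∀ t → ⟦ horner (+ 0) r ⟧ t ≈ 0#
        r≈0 = proj₂ (proj₂ discrete) r (pos⇒nonNeg (*-pos (⁻¹-pos p-pos) (*-pos E-pos C-pos))) small
          (All.map bounded good)
        vanish : ∀ {x} → Good x → ⟦ horner d h ⟧ (multiple′ x p) ≈ 0#
        vanish {x} x-good@(h≈0 , g≈0 , _) = trans (value≈ x-good) (trans (*-congˡ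
          (*-cancel-≉0 (λ z → i^n≢0 m d≢0 (fromℤ≈0⇒≡0 _ z)) (trans (proj₂ remainder x h≈0 g≈0) (r≈0 x))))
          (zeroʳ _))

module Conjugates {c ℓ₁ ℓ₂ c′ ℓ′ : Level} (ℝ : RealField c ℓ₁ ℓ₂) (ℚ̄ : AlgebraicNumbers ℝ c′ ℓ′) where
  private
    module ℝ where
      open RealField ℝ public
      open FieldProperties (RealField.underlyingField ℝ) public
      open OrderedField ℝ public
      open IntegersIn (RealField.commutativeRing ℝ) public using (solve; _:=_; _:+_; _:*_; _:-_; :-_; :0; :1)
      open Evaluation (RealField.commutativeRing ℝ) public
    module ℚ̄ where
      open AlgebraicNumbers ℚ̄ public
      open FieldProperties (AlgebraicNumbers.underlyingField ℚ̄) public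
      open Evaluation (AlgebraicNumbers.commutativeRing ℚ̄) public
    ℝ-ring = RealField.commutativeRing ℝ
    ℚ̄-ring = AlgebraicNumbers.commutativeRing ℚ̄
  open AlgebraicNumbers ℚ̄ using (Represents; ι)
  private
    module ι = IsRingHomomorphism (AlgebraicNumbers.ι-isRingHomomorphism ℚ̄)

  represents-isRingRelation : IsRingRelation ℚ̄-ring ℝ-ring Represents
  represents-isRingRelation = record
    { 0-rel = ι.0#-homo
    ; 1-rel = ι.1#-homo
    ; +-rel = λ {α} {β} (p , p′) (r , r′) → let h , h′ = ι.+-homo α β in
        ℝ.trans h (ℝ.+-cong p r)
        , ℝ.trans h′ (ℝ.trans (ℝ.+-cong p′ r′) (ℝ.+-identityˡ _))
    ; *-rel = λ {α} {β} {x} {y} (p , p′) (r , r′) → let h , h′ = ι.*-homo α β in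
        ℝ.trans h (ℝ.trans (ℝ.+-cong (ℝ.*-cong p r) (ℝ.-‿cong (ℝ.*-cong p′ r′)))
          (ℝ.solve 2 (λ x y → x ℝ.:* y ℝ.:- ℝ.:0 ℝ.:* ℝ.:0 ℝ.:= x ℝ.:* y) ℝ.refl x y))
        , ℝ.trans h′ (ℝ.trans (ℝ.+-cong (ℝ.*-cong p r′) (ℝ.*-cong p′ r))
          (ℝ.solve 2 (λ x y → x ℝ.:* ℝ.:0 ℝ.:+ ℝ.:0 ℝ.:* y ℝ.:= ℝ.:0) ℝ.refl x y))
    ; -‿rel = λ {α} (p , p′) → let h , h′ = ι.-‿homo α in
        ℝ.trans h (ℝ.-‿cong p)
        , ℝ.trans h′ (ℝ.trans (ℝ.-‿cong p′) (ℝ.solve 0 (ℝ.:- ℝ.:0 ℝ.:= ℝ.:0) ℝ.refl))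
    }
  open IsRingRelation represents-isRingRelation

  represents-respˡ : ∀ {α β x} → α ℚ̄.≈ β → Represents α x → Represents β x
  represents-respˡ α≈β (p , p′) = let h , h′ = ι.⟦⟧-cong (ℚ̄.sym α≈β) in ℝ.trans h p , ℝ.trans h′ p′

  represents-functional : ∀ {α x y} → Represents α x → Represents α y → x ℝ.≈ y
  represents-functional (p , _) (r , _) = ℝ.trans (ℝ.sym p) r

  represents-0 : ∀ {α x} → Represents α x → x ℝ.≈ ℝ.0# → α ℚ̄.≈ ℚ̄.0#
  represents-0 {α} {x} (p , p′) x≈0 with α ℚ̄.≟ ℚ̄.0#
  ... | yes α≈0 = α≈0
  ... | no  α≉0 = contradiction 1≈0 ℝ.1≉0
    where
    1≈0 : ℝ.1# ℝ.≈ ℝ.0#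
    1≈0 = ℝ.trans (ℝ.sym (proj₁ ι.1#-homo)) (ℝ.trans (proj₁ (ι.⟦⟧-cong (ℚ̄.sym (ℚ̄.⁻¹-inverse α≉0))))
      (ℝ.trans (proj₁ (ι.*-homo α (α ℚ̄.⁻¹)))
      (ℝ.trans (ℝ.+-cong (ℝ.*-congʳ (ℝ.trans p x≈0)) (ℝ.-‿cong (ℝ.*-congʳ p′)))
        (ℝ.solve 2 (λ x y → ℝ.:0 ℝ.:* x ℝ.:- ℝ.:0 ℝ.:* y ℝ.:= ℝ.:0) ℝ.refl _ _))))

  represents-injective : ∀ {α β x y} → Represents α x → Represents β y → x ℝ.≈ y → α ℚ̄.≈ β
  represents-injective α~x β~y x≈y =
    ℚ̄.x-y≈0⇒x≈y (represents-0 (+-rel α~x (-‿rel β~y)) (ℝ.x≈y⇒x-y≈0 x≈y))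

  vanish-down : ∀ {α x} → Represents α x → ∀ e → ℚ̄.⟦ e ⟧ α ℚ̄.≈ ℚ̄.0# → ℝ.⟦ e ⟧ x ℝ.≈ ℝ.0#
  vanish-down α~x e eq = represents-functional (⟦⟧-rel e α~x) (represents-respˡ (ℚ̄.sym eq) 0-rel)

  vanish-up : ∀ {α x} → Represents α x → ∀ e → ℝ.⟦ e ⟧ x ℝ.≈ ℝ.0# → ℚ̄.⟦ e ⟧ α ℚ̄.≈ ℚ̄.0#
  vanish-up α~x e eq = represents-0 (⟦⟧-rel e α~x) eq

  characteristic-0 : ∀ n → ℚ̄.fromℕ (suc n) ℚ̄.≉ ℚ̄.0#
  characteristic-0 n eq = ℝ.pos⇒≉0 (ℝ.fromℕ-pos n)
    (represents-functional (fromℕ-rel (suc n)) (represents-respˡ (ℚ̄.sym eq) 0-rel))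

  open MinimalPolynomials (AlgebraicNumbers.underlyingField ℚ̄) characteristic-0

  Transfers : ℝ.Carrier → Set ℓ₁
  Transfers x = ∀ {k l} (m : Vector ℤ (suc k)) (n : Vector ℤ (suc l)) →
    ℝ.⟦ crossDifference m n ⟧ x ℝ.≈ ℝ.0# → ℝ.⟦ weightDifference m n ⟧ x ℝ.≈ ℝ.0#

  ladder⇒transfers : ∀ {v} → ℝ.Pos v → Ladders.Ladder ℝ v → ∀ {x} → v ℝ.* v ℝ.≈ x → Transfers x
  ladder⇒transfers v-pos ladder v²≈x m n eq = ℝ.trans (ℝ.⟦⟧-cong (weightDifference m n) (ℝ.sym v²≈x))
    (Weights.ladder-transfer ℝ (ℝ.pos⇒≉0 v-pos) ladder m n
      (ℝ.trans (ℝ.⟦⟧-cong (crossDifference m n) v²≈x) eq))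

  4≤⇒transfers : ∀ {x} → ℝ.fromℕ 4 ℝ.≤ x → Transfers x
  4≤⇒transfers {x} 4≤x = ladder⇒transfers u-pos (Ladders.infiniteLadder ℝ u u≥2) (ℝ.√-square x-pos)
    where
    nonNeg : ℝ.fromℕ 4 ℝ.≤ x → ℝ.NonNeg (x ℝ.- ℝ.fromℕ 4)
    nonNeg (inj₁ 4<x) = ℝ.pos⇒nonNeg (ℝ.<⇒Pos 4<x)
    nonNeg (inj₂ 4≈x) = ℝ.≈0⇒nonNeg (ℝ.x≈y⇒x-y≈0 (ℝ.sym 4≈x))
    x-4 = nonNeg 4≤x
    x-pos : ℝ.Pos x
    x-pos = ℝ.pos-cong (ℝ.solve 2 (λ f x → f ℝ.:+ (x ℝ.:- f) ℝ.:= x) ℝ.refl (ℝ.fromℕ 4) x)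
      (ℝ.pos-+-nonNeg (ℝ.fromℕ-pos 3) x-4)
    u = ℝ.√ x
    u-pos : ℝ.Pos u
    u-pos = ℝ.√-pos x-pos
    u≥2 : ℝ.NonNeg (u ℝ.- (ℝ.1# ℝ.+ ℝ.1#))
    u≥2 = ℝ.nonNeg-cancel (ℝ.pos-+ u-pos (ℝ.pos-+ ℝ.1-pos ℝ.1-pos)) (ℝ.nonNeg-cong
      (ℝ.trans (ℝ.+-congʳ (ℝ.sym (ℝ.√-square x-pos)))
        (ℝ.solve 1 (λ u → 
            u ℝ.:* u ℝ.:- (ℝ.:1 ℝ.:+ (ℝ.:1 ℝ.:+ (ℝ.:1 ℝ.:+ (ℝ.:1 ℝ.:+ ℝ.:0))))
            ℝ.:= (u ℝ.:+ (ℝ.:1 ℝ.:+ ℝ.:1)) ℝ.:* (u ℝ.:- (ℝ.:1 ℝ.:+ ℝ.:1))) ℝ.refl u))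
      x-4)

  galois-transfers : ∀ {α q} → Represents α q → (σ : ℚ̄.Gal) → ∀ {x} → Represents (ℚ̄.Gal.⟦_⟧ σ α) x →
    Transfers x → Transfers q
  galois-transfers {α} α~q σ σα~x transfers m n eq =
    vanish-down α~q (weightDifference m n) (σ.injective (ℚ̄.trans (σ.⟦⟧-rel (weightDifference m n) ℚ̄.refl)
      (ℚ̄.trans (vanish-up σα~x (weightDifference m n) (transfers m n
        (vanish-down σα~x (crossDifference m n)
          (ℚ̄.trans (ℚ̄.sym (σ.⟦⟧-rel (crossDifference m n) ℚ̄.refl))
          (ℚ̄.trans (σ.⟦⟧-cong (vanish-up α~q (crossDifference m n) eq)) σ.0#-homo)))))
        (ℚ̄.sym σ.0#-homo))))
    where
    module σ where
      open IsRingIsomorphism (ℚ̄.Gal.isRingIsomorphism σ) public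
      graph-isRingRelation : IsRingRelation ℚ̄-ring ℚ̄-ring (λ α β → ℚ̄.Gal.⟦_⟧ σ α ℚ̄.≈ β)
      graph-isRingRelation = record
        { 0-rel = 0#-homo
        ; 1-rel = 1#-homo
        ; +-rel = λ {x} {y} p r → ℚ̄.trans (+-homo x y) (ℚ̄.+-cong p r)
        ; *-rel = λ {x} {y} p r → ℚ̄.trans (*-homo x y) (ℚ̄.*-cong p r)
        ; -‿rel = λ {x} p → ℚ̄.trans (-‿homo x) (ℚ̄.-‿cong p)
        }
      open IsRingRelation graph-isRingRelation public using (⟦⟧-rel)

  private
    any-all : ∀ {p n} {P : ℚ̄.Carrier → Set p} (zs : Vec ℚ̄.Carrier n) →
      (∀ z → Any (z ℚ̄.≈_) zs → P z) → All P zs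
    any-all []       f = []
    any-all (z ∷ zs) f = f z (here ℚ̄.refl) ∷ any-all zs (λ y any → f y (there any))

    any⇒0<n : ∀ {p n} {P : ℚ̄.Carrier → Set p} {zs : Vec ℚ̄.Carrier n} → Any P zs → 0 ℕ.< n
    any⇒0<n (here _)  = ℕ.z<s
    any⇒0<n (there _) = ℕ.z<s

    simple-root : ∀ {n d z} (f : Vec ℚ n) (h : Vec ℤ n) → d ≢ + 0 → 0 ℕ.< n →
      IsMultiple (Evaluation.⟦_⟧ ℚ̄-ring (con d) z) (Vec.map ℚ̄.fromℚ f) (Vec.map (IntegersIn.fromℤ ℚ̄-ring) h) →
      (∀ {m k} (v : Vec ℤ m) → m ℕ.< n → k ≢ + 0 → ℚ̄.⟦ horner k v ⟧ z ℚ̄.≉ ℚ̄.0#) →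
      Polynomials.derivative ℚ̄-ring ℚ̄.1# (Vec.map ℚ̄.fromℚ f) z ℚ̄.≉ ℚ̄.0#
    simple-root {suc n} {d} {z} f h d≢0 _ multiple nonvanishing eq
      with Polynomials.integerDerivative ℚ̄-ring d h
    ... | w , derivative≈ = nonvanishing w (ℕₚ.n<1+n n) (i*j≢0 {+ suc n} (λ ()) d≢0)
      (ℚ̄.trans (ℚ̄.sym (derivative≈ z)) (ℚ̄.trans (ℚ̄.sym (derivative-multiple multiple (ℚ̄.*-identityʳ _) z))
        (ℚ̄.trans (ℚ̄.*-congˡ eq) (ℚ̄.zeroʳ _))))

  private
    evalMonic-fromℤ : ∀ {m} (v : Vec ℤ m) t → ℚ̄.⟦ horner (+ 1) v ⟧ t ℚ̄.≈ ℚ̄.evalMonic (Vec.map ℚ̄.fromℤ v) t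
    evalMonic-fromℤ []            t = IntegersIn.fromℕ-1 ℚ̄-ring
    evalMonic-fromℤ (+ i ∷ v)      t = ℚ̄.+-congˡ (ℚ̄.*-congˡ (evalMonic-fromℤ v t))
    evalMonic-fromℤ (-[1+ i ] ∷ v) t = ℚ̄.+-congˡ (ℚ̄.*-congˡ (evalMonic-fromℤ v t))

  module _ {α q} (α~q : Represents α q) {n} (f : Vec ℚ n) (isMinimal : ℚ̄.IsMinimalPolynomial f α)
      (integral : ℚ̄.IsAlgebraicInteger α) (totallyPositive : ℚ̄.IsTotallyPositive α) where
    private
      cleared = clearDenominators f
      d : ℤ
      d = proj₁ cleared
      d≢0 : d ≢ + 0
      d≢0 = proj₁ (proj₂ cleared)
      h : Vec ℤ n
      h = proj₁ (proj₂ (proj₂ cleared))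
      multiple′ : IsMultiple (IntegersIn.fromℤ ℚ̄-ring d) (Vec.map ℚ̄.fromℚ f) (Vec.map (IntegersIn.fromℤ ℚ̄-ring) h)
      multiple′ = proj₂ (proj₂ (proj₂ cleared))
      h≈ : ∀ t → ℚ̄.⟦ horner d h ⟧ t ℚ̄.≈ IntegersIn.fromℤ ℚ̄-ring d ℚ̄.* ℚ̄.evalMonic (Vec.map ℚ̄.fromℚ f) t
      h≈ = ⟦horner⟧≈evalMonic {p = f} multiple′
      isRoot⇒root : ∀ {β} → ℚ̄.IsRoot (Vec.map ℚ̄.fromℚ f) β → ℚ̄.⟦ horner d h ⟧ β ℚ̄.≈ ℚ̄.0#
      isRoot⇒root root = ℚ̄.trans (h≈ _) (ℚ̄.trans (ℚ̄.*-congˡ root) (ℚ̄.zeroʳ _))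
      α-root : ℚ̄.⟦ horner d h ⟧ α ℚ̄.≈ ℚ̄.0#
      α-root = isRoot⇒root (proj₁ isMinimal)
    open Irreducible h d≢0 (minimal-degree {f = f} isMinimal) α-root
    private
      root⇒isRoot : ∀ {β} → Root β → ℚ̄.IsRoot (Vec.map ℚ̄.fromℚ f) β
      root⇒isRoot root = ℚ̄.*-cancel-≉0 (fromℤ≉0 d≢0) (ℚ̄.trans (ℚ̄.sym (h≈ _)) root)
      real : ∀ {β} → Root β → ∃[ x ] Represents β x × ℝ.Pos x
      real {β} root = totallyPositive β (n , f , isMinimal , root⇒isRoot root)
      factors = linearFactors ℚ̄.isAlgebraicallyClosed (Vec.map ℚ̄.fromℚ f)
      zs : Vec ℚ̄.Carrier n
      zs = proj₁ factors
      root⇒any : ∀ {β} → Root β → Any (β ℚ̄.≈_) zs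
      root⇒any {β} root = productOfRoots-root zs (ℚ̄.trans (ℚ̄.sym (proj₁ (proj₂ factors β)))
        (ℚ̄.trans (ℚ̄.sym (evalMonic≈eval (Vec.map ℚ̄.fromℚ f) β)) (root⇒isRoot root)))
      any⇒root : ∀ {β} → Any (β ℚ̄.≈_) zs → Root β
      any⇒root {β} any = isRoot⇒root (ℚ̄.trans (evalMonic≈eval (Vec.map ℚ̄.fromℚ f) β)
        (ℚ̄.trans (proj₁ (proj₂ factors β)) (productOfRoots-any any)))
      distinct : AllPairs ℚ̄._≉_ zs
      distinct = simple⇒distinct zs λ {z} any eq →
        simple-root f h d≢0 (any⇒0<n any) multiple′ (nonvanishing (any⇒root any))
          (ℚ̄.trans (proj₂ (proj₂ factors z)) eq)

      RealRoot : ℚ̄.Carrier → Set _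
      RealRoot z = Root z × ∃[ x ] Represents z x × ℝ.Pos x

      reals : ∀ {m} {ys : Vec ℚ̄.Carrier m} → All RealRoot ys → Vec ℝ.Carrier m
      reals []                   = []
      reals ((_ , x , _) ∷ rest) = x ∷ reals rest

      reals-all : ∀ {p m} {P : ℝ.Carrier → Set p} {ys : Vec ℚ̄.Carrier m} (rs : All RealRoot ys) →
        (∀ {z x} → Root z → Represents z x → ℝ.Pos x → P x) → All P (reals rs)
      reals-all []                           f = []
      reals-all ((root , x , z~x , p) ∷ rs) f = f root z~x p ∷ reals-all rs f

      reals-distinct : ∀ {m} {ys : Vec ℚ̄.Carrier m} (rs : All RealRoot ys) → AllPairs ℚ̄._≉_ ys → AllPairs ℝ._≉_ (reals rs)
      reals-distinct []       []         = []
      reals-distinct ((_ , x , z~x , _) ∷ rs) (z≉ ∷ rest) = go rs z≉ ∷ reals-distinct rs rest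
        where
        go : ∀ {m} {ys : Vec ℚ̄.Carrier m} (rs : All RealRoot ys) → All (_ ℚ̄.≉_) ys → All (x ℝ.≉_) (reals rs)
        go []                        []          = []
        go ((_ , y , w~y , _) ∷ rs) (z≉w ∷ z≉) = (λ x≈y → z≉w (represents-injective z~x w~y x≈y)) ∷ go rs z≉

      roots : All RealRoot zs
      roots = any-all zs λ z any → any⇒root any , real (any⇒root any)

      multiple-represents : ∀ {β x} → Represents β x → ∀ k →
        Represents (multiple ℚ̄-ring β k) (multiple ℝ-ring x k)
      multiple-represents = multiple-rel represents-isRingRelation

      fromℕ-4 : ℝ.fromℕ 4 ℝ.≈ (ℝ.1# ℝ.+ ℝ.1#) ℝ.+ (ℝ.1# ℝ.+ ℝ.1#)
      fromℕ-4 = ℝ.solve 0 (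
        ℝ.:1 ℝ.:+ (ℝ.:1 ℝ.:+ (ℝ.:1 ℝ.:+ (ℝ.:1 ℝ.:+ ℝ.:0))) ℝ.:= (ℝ.:1 ℝ.:+ ℝ.:1) ℝ.:+ (ℝ.:1 ℝ.:+ ℝ.:1)) ℝ.refl

    ¬¬conjugate-transfers : ¬ (∀ {β x} → Root β → Represents β x → ¬ Transfers x)
    ¬¬conjugate-transfers none = absurd
      where
      <4 : ∀ {β x} → Root β → Represents β x → ℝ.Pos ((ℝ.1# ℝ.+ ℝ.1#) ℝ.+ (ℝ.1# ℝ.+ ℝ.1#) ℝ.- x)
      <4 {β} {x} root β~x = below (ℝ.sign (ℝ.fromℕ 4 ℝ.- x))
        where
        below : ℝ.Sign (ℝ.fromℕ 4 ℝ.- x) → ℝ.Pos ((ℝ.1# ℝ.+ ℝ.1#) ℝ.+ (ℝ.1# ℝ.+ ℝ.1#) ℝ.- x)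
        below (ℝ.isPos p)  = ℝ.pos-cong (ℝ.+-congʳ fromℕ-4) p
        below (ℝ.isZero z) = ⊥-elim (none root β~x (4≤⇒transfers (inj₂ (ℝ.x-y≈0⇒x≈y z))))
        below (ℝ.isNeg p)  = ⊥-elim (none root β~x (4≤⇒transfers (inj₁ (ℝ.Pos⇒< (ℝ.pos-cong
          (ℝ.solve 2 (λ f x → ℝ.:- (f ℝ.:- x) ℝ.:= x ℝ.:- f) ℝ.refl (ℝ.fromℕ 4) x) p)))))

      g = proj₁ (proj₂ integral)
      g-root : ∀ {β} → Root β → ℚ̄.⟦ horner (+ 1) g ⟧ β ℚ̄.≈ ℚ̄.0#
      g-root root = transfer α-root root (horner (+ 1) g)
        (ℚ̄.trans (evalMonic-fromℤ g α) (proj₂ (proj₂ integral)))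

      large = LargePrimes.large-primes ℝ h d≢0 g (reals roots) (reals-distinct roots distinct)
        (reals-all roots λ root z~x x>0 →
          vanish-down z~x (horner d h) root , vanish-down z~x (horner (+ 1) g) (g-root root) , x>0 , <4 root z~x)
      b : ℕ
      b = proj₁ large

      multiple-root : ∀ {p} → Prime p → b ℕ.≤ p → ∀ {β} → Root β → Root (multiple ℚ̄-ring β p)
      multiple-root {p} p-prime b≤p {β} root = go roots (proj₂ large p-prime b≤p) (root⇒any root)
        where
        go : ∀ {m} {ys : Vec ℚ̄.Carrier m} (rs : All RealRoot ys) →
          All (λ x → ℝ.⟦ horner d h ⟧ (multiple ℝ-ring x p) ℝ.≈ ℝ.0#) (reals rs) →
          Any (β ℚ̄.≈_) ys → Root (multiple ℚ̄-ring β p)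
        go ((_ , x , z~x , _) ∷ _) (eq ∷ _) (here β≈z) =
          vanish-up (multiple-represents (represents-respˡ (ℚ̄.sym β≈z) z~x) p) (horner d h) eq
        go (_ ∷ rs) (_ ∷ eqs) (there any) = go rs eqs any

      Admissible : ℕ → Set _
      Admissible k = Root (multiple ℚ̄-ring α k)

      admissible-1 : Admissible 1
      admissible-1 = ℚ̄.trans (ℚ̄.⟦⟧-cong (horner d h) (multiple-1 ℚ̄-ring α)) α-root
        where
        multiple-1 : ∀ {a ℓ} (R : CommutativeRing a ℓ) x → CommutativeRing._≈_ R (multiple R x 1) x
        multiple-1 R x = solve 2 (λ t x → t :+ (x :- t) := x) refl (1# + 1#) x
          where
          open CommutativeRing R
          open IntegersIn R

      admissible-* : ∀ {p k} → Prime p → b ℕ.≤ p → Admissible k → Admissible (p ℕ.* k)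
      admissible-* {p} {k} p-prime b≤p root = ℚ̄.trans
        (ℚ̄.⟦⟧-cong (horner d h) (ℚ̄.sym (Chebyshev.multiple-multiple ℚ̄-ring α k p)))
        (multiple-root p-prime b≤p root)

      admissible-pos : ∀ k → Admissible k → ℝ.Pos (multiple ℝ-ring q k)
      admissible-pos k root = let x , β~x , x>0 = real root in
        ℝ.pos-cong (represents-functional β~x (multiple-represents α~q k)) x>0

      q>0 : ℝ.Pos q
      q>0 = let x , α~x , x>0 = real α-root in ℝ.pos-cong (represents-functional α~x α~q) x>0

      prime = prime≥ b
      p = proj₁ prime
      p-prime : Prime p
      p-prime = proj₁ (proj₂ prime)
      b≤p : b ℕ.≤ p
      b≤p = proj₂ (proj₂ prime)

      power-admissible : ∀ k → Admissible (p ℕ.^ k)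
      power-admissible zero    = admissible-1
      power-admissible (suc k) = admissible-* {p} {p ℕ.^ k} p-prime b≤p (power-admissible k)

      index : Fin (suc n) → Fin n
      index k = Any.index (root⇒any (power-admissible (toℕ k)))

      agree : ∀ i j → index i ≡ index j →
        multiple ℚ̄-ring α (p ℕ.^ toℕ i) ℚ̄.≈ multiple ℚ̄-ring α (p ℕ.^ toℕ j)
      agree i j same = ℚ̄.trans (Anyₚ.lookup-index (root⇒any (power-admissible (toℕ i))))
        (ℚ̄.trans (ℚ̄.reflexive (≡.cong (Vec.lookup zs) same))
        (ℚ̄.sym (Anyₚ.lookup-index (root⇒any (power-admissible (toℕ j))))))

      -- Two of the n + 1 conjugates 4 cos² (pᵏ θ) agree.
      absurd : ⊥
      absurd = let i , j , i<j , same = pigeonhole (ℕₚ.n<1+n n) index in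
        HeckeConjugate.¬¬ladder ℝ q>0 (<4 α-root α~q) b
          Admissible admissible-1 (λ {p} {k} → admissible-* {p} {k}) admissible-pos
          (ℕₚ.^-monoʳ-< p (ℕ.nonTrivial⇒n>1 p {{prime⇒nonTrivial p-prime}}) i<j)
          (represents-functional (multiple-represents α~q (p ℕ.^ toℕ i))
            (represents-respˡ (ℚ̄.sym (agree i j same)) (multiple-represents α~q (p ℕ.^ toℕ j))))
          λ k root v>0 v²≈ ladder → none root (multiple-represents α~q k) (ladder⇒transfers v>0 ladder v²≈)

    minimal-transfers : Transfers q
    minimal-transfers m k eq = decidable-stable (ℝ.⟦ weightDifference m k ⟧ q ℝ.≟ ℝ.0#) λ neq →
      ¬¬conjugate-transfers λ {β} {x} root β~x transfers → neq (vanish-down α~q (weightDifference m k)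
        (transfer root α-root (weightDifference m k) (vanish-up β~x (weightDifference m k) (transfers m k
          (vanish-down β~x (crossDifference m k)
            (transfer α-root root (crossDifference m k) (vanish-up α~q (crossDifference m k) eq)))))))

  ¬¬minimalPolynomial : ∀ {α} → ¬ (∀ {n} (f : Vec ℚ n) → ¬ ℚ̄.IsMinimalPolynomial f α)
  ¬¬minimalPolynomial {α} none with ℚ̄.isAlgebraic α
  ... | n , f , root = <-rec (λ n → (f : Vec ℚ n) → ¬ ℚ̄.IsRoot (Vec.map ℚ̄.fromℚ f) α)
    (λ n rec f root → none f (root , λ {m} r r-root → minimal n m rec r r-root)) n f root
    where
    minimal : ∀ n m → (∀ {k} → k ℕ.< n → (f : Vec ℚ k) → ¬ ℚ̄.IsRoot (Vec.map ℚ̄.fromℚ f) α) →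
      (r : Vec ℚ m) → ℚ̄.IsRoot (Vec.map ℚ̄.fromℚ r) α → n ℕ.≤ m
    minimal n m rec r r-root with n ℕₚ.≤? m
    ... | yes n≤m = n≤m
    ... | no  n≰m = contradiction r-root (rec (ℕₚ.≰⇒> n≰m) r)

  totallyPositive-transfers : ∀ {α q} → Represents α q → ℚ̄.IsAlgebraicInteger α → ℚ̄.IsTotallyPositive α → Transfers q
  totallyPositive-transfers {α} {q} α~q integral totallyPositive m k eq =
    decidable-stable (ℝ.⟦ weightDifference m k ⟧ q ℝ.≟ ℝ.0#) λ neq → ¬¬minimalPolynomial λ f isMinimal →
      neq (minimal-transfers α~q f isMinimal integral totallyPositive m k eq)

theorem3 : ∀ {c ℓ₁ ℓ₂ c′ ℓ′ : Level}
    (ℝ : RealField c ℓ₁ ℓ₂) (ℚ̄ : AlgebraicNumbers ℝ c′ ℓ′) →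
    let module ℝ = RealField ℝ
        module ℚ̄ = AlgebraicNumbers ℚ̄
    in
    (q : ℝ.Carrier) → ℝ.0# ℝ.< q →
    (α : ℚ̄.Carrier) → ℚ̄.Represents α q →
    (∃[ σ ] ∃[ x ] ℚ̄.Represents (ℚ̄.Gal.⟦_⟧ σ α) x × ℝ.fromℕ 4 ℝ.≤ x)
      ⊎ (ℚ̄.IsAlgebraicInteger α × ℚ̄.IsTotallyPositive α) →
    Paths.HasUniqueWeight ℝ q
theorem3 ℝ ℚ̄ q q>0 α α~q cases = Weights.transfer⇒hasUniqueWeight ℝ q>0 (transfers cases)
  where
  open Conjugates ℝ ℚ̄
  transfers : _ → Transfers q
  transfers (inj₁ (σ , x , σα~x , 4≤x)) = galois-transfers α~q σ σα~x (4≤⇒transfers 4≤x)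
  transfers (inj₂ (integral , positive)) = totallyPositive-transfers α~q integral positive
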